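{- If $\mathbf{NP}\not\subseteq\mathbf{P_{/poly}}$, then $\mathbf{AC}^0\not\subseteq\mathbf{CF}$.
   Context: Binary strings of length $m$ are identified with vectors in $\{0,1\}^m$. $\mathbf{CF}$ is the set of languages $L\subseteq\{0,1\}^*$ for which there exists a polynomial $p$ such that for every $m\in\mathbb{N}$ there exist $A\in\mathbb{R}^{p(m)\times m}$, $B\in\mathbb{R}^{p(m)\times p(m)}$, $b\in\mathbb{R}^{p(m)}$ with $\operatorname{conv}(\{x\in L: |x|=m\})=\{x\in\mathbb{R}^m\mid\exists y\in\mathbb{R}^{p(m)}: Ax+By\le b\}$. $\mathbf{AC}^0$ is the class of languages decidable by families of polynomial-size, constant-depth Boolean circuits with unbounded fan-in AND/OR gates and NOT gates. $\mathbf{P_{/poly}}$ is the class of languages decidable by families of polynomial-size Boolean circuits. -}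

module Defs where

open import Data.Bool.Base using (Bool; true; false; if_then_else_; _∧_; _∨_)
import Data.Bool.Base as Bool
open import Data.Fin.Base using (Fin)
open import Data.List.Base using (List; []; _∷_; length; foldr)
import Data.List.Base as List
open import Data.List.Membership.Propositional using (_∈_)
open import Data.List.Relation.Unary.All using (All)
open import Data.Nat.Base as ℕ using (ℕ; zero; suc)
import Data.Nat.Properties as ℕₚ
open import Data.Product.Base using (∃; Σ; _×_; _,_)
open import Data.Rational.Base as ℚ using (ℚ; 0ℚ; 1ℚ; ½; Positive; ∣_∣)
import Data.Rational.Properties as ℚₚ
open import Data.Rational.Solver using (module +-*-Solver)
open import Data.Vec.Base using (Vec; []; _∷_; lookup; toList; replicate)
import Data.Vec.Functional as Vector
open import Data.Vec.Functional using (Vector)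
open import Function.Bundles using (_⇔_)
open import Level using (0ℓ)
open import Relation.Binary.PropositionalEquality
  using (_≡_; refl; sym; trans; cong; cong₂; subst)
open import Relation.Unary using (Pred)

-- A polynomial is a coefficient list, constant term first.  Natural
-- coefficients suffice for bounds (and for dimensions, which may be padded by
-- zero rows and columns).

Polynomial : Set
Polynomial = List ℕ

⟦_⟧ : Polynomial → ℕ → ℕ
⟦ []     ⟧ n = 0
⟦ a ∷ as ⟧ n = a ℕ.+ n ℕ.* ⟦ as ⟧ n

Language : Set₁
Language = Pred (List Bool) 0ℓ

data Symbol (k : ℕ) : Set where
  blank : Symbol k
  bit   : Bool → Symbol k
  aux   : Fin k → Symbol k

data Move : Set where
  left stay right : Move

-- A configuration is halting when no instruction applies to it; a halting
-- configuration is accepting according to its state.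

record NTM : Set where
  field
    #states   : ℕ
    #aux      : ℕ
    start     : Fin #states
    accepting : Fin #states → Bool
    δ         : Fin #states → Symbol #aux →
                List (Fin #states × Symbol #aux × Move)

-- The tape is two-way infinite.  The cells on either side of the head are
-- listed outwards from it; all cells beyond the lists are blank.

record Tape (k : ℕ) : Set where
  constructor tape
  field
    before : List (Symbol k)
    head   : Symbol k
    after  : List (Symbol k)

move : ∀ {k} → Move → Tape k → Tape k
move left  (tape []       h rs)       = tape [] blank (h ∷ rs)
move left  (tape (l ∷ ls) h rs)       = tape ls l (h ∷ rs)
move stay  t                          = t
move right (tape ls       h [])       = tape (h ∷ ls) blank []
move right (tape ls       h (r ∷ rs)) = tape (h ∷ ls) r rs

write : ∀ {k} → Symbol k → Tape k → Tape k
write a t = record t { head = a }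

inputTape : ∀ {k} → List Bool → Tape k
inputTape []       = tape [] blank []
inputTape (b ∷ bs) = tape [] (bit b) (List.map bit bs)

module _ (M : NTM) where
  open NTM M

  Config : Set
  Config = Fin #states × Tape #aux

  initial : List Bool → Config
  initial x = start , inputTape x

  successors : Config → List Config
  successors (q , t) =
    List.map (λ (q′ , a , d) → q′ , move d (write a t)) (δ q (Tape.head t))

  data Accepts : Config → Set where
    halt : ∀ {q t} → successors (q , t) ≡ [] → accepting q ≡ true →
           Accepts (q , t)
    step : ∀ {c c′} → c′ ∈ successors c → Accepts c′ → Accepts c

  HaltsWithin : ℕ → Config → Set
  HaltsWithin zero    c = successors c ≡ []
  HaltsWithin (suc t) c = All (HaltsWithin t) (successors c)

NP : Pred Language 0ℓ
NP L = ∃ λ (M : NTM) → ∃ λ (p : Polynomial) →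
  (∀ x → HaltsWithin M (⟦ p ⟧ (length x)) (initial M x)) ×
  (∀ x → L x ⇔ Accepts M (initial M x))

-- The parameter w counts the wires available as inputs; the empty conjunction
-- and disjunction are the constants.

data Gate (w : ℕ) : Set where
  AND OR : List (Fin w) → Gate w
  NOT    : Fin w → Gate w

-- Gates n s: s gates over n inputs in topological order.  The wires
-- available to a new gate are the earlier gates, latest first, followed by
-- the inputs.

data Gates (n : ℕ) : ℕ → Set where
  []  : Gates n 0
  _∷_ : ∀ {s} → Gate (s ℕ.+ n) → Gates n s → Gates n (suc s)

record Circuit (n : ℕ) : Set where
  field
    size   : ℕ
    gates  : Gates n size
    output : Fin (size ℕ.+ n)

evalGate : ∀ {w} → Gate w → Vec Bool w → Bool
evalGate (AND is) v = foldr (λ i → lookup v i ∧_) true is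
evalGate (OR is)  v = foldr (λ i → lookup v i ∨_) false is
evalGate (NOT i)  v = Bool.not (lookup v i)

wireValues : ∀ {n s} → Gates n s → Vec Bool n → Vec Bool (s ℕ.+ n)
wireValues []       x = x
wireValues (g ∷ gs) x = evalGate g (wireValues gs x) ∷ wireValues gs x

gateInputs : ∀ {w} → Gate w → List (Fin w)
gateInputs (AND is) = is
gateInputs (OR is)  = is
gateInputs (NOT i)  = i ∷ []

wireDepths : ∀ {n s} → Gates n s → Vec ℕ (s ℕ.+ n)
wireDepths []       = replicate _ 0
wireDepths (g ∷ gs) =
  suc (foldr (λ i → lookup (wireDepths gs) i ℕ.⊔_) 0 (gateInputs g))
    ∷ wireDepths gs

maxFanIn : ∀ {n s} → Gates n s → ℕ
maxFanIn []       = 0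
maxFanIn (g ∷ gs) = length (gateInputs g) ℕ.⊔ maxFanIn gs

module _ {n : ℕ} (C : Circuit n) where
  open Circuit C

  evaluate : Vec Bool n → Bool
  evaluate x = lookup (wireValues gates x) output

  depth : ℕ
  depth = lookup (wireDepths gates) output

  fanIn : ℕ
  fanIn = maxFanIn gates

  DecidesSlice : Language → Set
  DecidesSlice L = ∀ x → L (toList x) ⇔ evaluate x ≡ true

-- P/poly is over the usual bounded fan-in basis; only AC⁰ has unbounded fan-in.

P/poly : Pred Language 0ℓ
P/poly L = ∃ λ (p : Polynomial) → ∀ m → ∃ λ (C : Circuit m) →
  Circuit.size C ℕ.≤ ⟦ p ⟧ m × fanIn C ℕ.≤ 2 × DecidesSlice C L

AC⁰ : Pred Language 0ℓ
AC⁰ L = ∃ λ (p : Polynomial) → ∃ λ (d : ℕ) → ∀ m → ∃ λ (C : Circuit m) →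
  Circuit.size C ℕ.≤ ⟦ p ⟧ m × depth C ℕ.≤ d × DecidesSlice C L

IsCauchy : (ℕ → ℚ) → Set
IsCauchy s = ∀ ε → 0ℚ ℚ.< ε →
  ∃ λ N → ∀ {m n} → N ℕ.≤ m → N ℕ.≤ n → ∣ s m ℚ.- s n ∣ ℚ.< ε

private
  half-pos : ∀ {ε} → 0ℚ ℚ.< ε → 0ℚ ℚ.< ½ ℚ.* ε
  half-pos {ε} ε>0 = ℚₚ.positive⁻¹ (½ ℚ.* ε)
    {{ℚₚ.pos*pos⇒pos ½ ε {{ℚ.positive ε>0}}}}

  halves : ∀ ε → ½ ℚ.* ε ℚ.+ ½ ℚ.* ε ≡ ε
  halves ε = trans (sym (ℚₚ.*-distribʳ-+ ε ½ ½)) (ℚₚ.*-identityˡ ε)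

  isCauchy-const : ∀ q → IsCauchy (λ _ → q)
  isCauchy-const q ε ε>0 =
    0 , λ _ _ → subst (ℚ._< ε) (sym (cong ∣_∣ (ℚₚ.+-inverseʳ q))) ε>0

  isCauchy-+ : ∀ {s t} → IsCauchy s → IsCauchy t →
               IsCauchy (λ n → s n ℚ.+ t n)
  isCauchy-+ {s} {t} cs ct ε ε>0
    with cs (½ ℚ.* ε) (half-pos ε>0) | ct (½ ℚ.* ε) (half-pos ε>0)
  ... | M , hs | N , ht = M ℕ.⊔ N , λ {m} {n} m≥ n≥ → begin-strict
    ∣ (s m ℚ.+ t m) ℚ.- (s n ℚ.+ t n) ∣
      ≡⟨ cong ∣_∣ (rearrange (s m) (t m) (s n) (t n)) ⟩
    ∣ (s m ℚ.- s n) ℚ.+ (t m ℚ.- t n) ∣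
      ≤⟨ ℚₚ.∣p+q∣≤∣p∣+∣q∣ (s m ℚ.- s n) (t m ℚ.- t n) ⟩
    ∣ s m ℚ.- s n ∣ ℚ.+ ∣ t m ℚ.- t n ∣
      <⟨ ℚₚ.+-mono-<
           (hs (ℕₚ.m⊔n≤o⇒m≤o M N m≥) (ℕₚ.m⊔n≤o⇒m≤o M N n≥))
           (ht (ℕₚ.m⊔n≤o⇒n≤o M N m≥) (ℕₚ.m⊔n≤o⇒n≤o M N n≥)) ⟩
    ½ ℚ.* ε ℚ.+ ½ ℚ.* ε
      ≡⟨ halves ε ⟩
    ε ∎
    where
    open ℚₚ.≤-Reasoning
    open +-*-Solver
    rearrange : ∀ a b c d →
      (a ℚ.+ b) ℚ.- (c ℚ.+ d) ≡ (a ℚ.- c) ℚ.+ (b ℚ.- d)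
    rearrange = solve 4
      (λ a b c d → (a :+ b) :- (c :+ d) := (a :- c) :+ (b :- d)) refl

  EventuallyBounded : (ℕ → ℚ) → Set
  EventuallyBounded s = ∃ λ K → Positive K ×
    ∃ λ N → ∀ {n} → N ℕ.≤ n → ∣ s n ∣ ℚ.≤ K

  cauchy⇒bounded : ∀ {s} → IsCauchy s → EventuallyBounded s
  cauchy⇒bounded {s} cs with cs 1ℚ (ℚₚ.positive⁻¹ 1ℚ)
  ... | N , h = 1ℚ ℚ.+ ∣ s N ∣ ,
    ℚₚ.pos+nonNeg⇒pos 1ℚ ∣ s N ∣ {{ℚₚ.∣-∣-nonNeg (s N)}} ,
    N , λ {n} n≥ → begin
      ∣ s n ∣                        ≡⟨ cong ∣_∣ (split (s n) (s N)) ⟩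
      ∣ (s n ℚ.- s N) ℚ.+ s N ∣      ≤⟨ ℚₚ.∣p+q∣≤∣p∣+∣q∣ (s n ℚ.- s N) (s N) ⟩
      ∣ s n ℚ.- s N ∣ ℚ.+ ∣ s N ∣    ≤⟨ ℚₚ.+-monoˡ-≤ ∣ s N ∣
                                          (ℚₚ.<⇒≤ (h n≥ ℕₚ.≤-refl)) ⟩
      1ℚ ℚ.+ ∣ s N ∣                 ∎
    where
    open ℚₚ.≤-Reasoning
    open +-*-Solver
    split : ∀ a b → a ≡ (a ℚ.- b) ℚ.+ b
    split = solve 2 (λ a b → a := (a :- b) :+ b) refl

  shrink : ∀ K → Positive K → ∀ ε → 0ℚ ℚ.< ε →
    ∃ λ η → 0ℚ ℚ.< η × K ℚ.* η ≡ ½ ℚ.* ε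
  shrink K K+ ε ε>0 =
    K⁻¹ ℚ.* (½ ℚ.* ε) ,
    ℚₚ.positive⁻¹ _ {{ℚₚ.pos*pos⇒pos K⁻¹ {{ℚₚ.1/pos⇒pos K {{K+}}}}
      (½ ℚ.* ε) {{ℚ.positive (half-pos ε>0)}}}} ,
    trans (sym (ℚₚ.*-assoc K K⁻¹ _))
      (trans (cong (ℚ._* (½ ℚ.* ε)) (ℚₚ.*-inverseʳ K {{K≢0}}))
        (ℚₚ.*-identityˡ _))
    where
    K≢0 = ℚₚ.pos⇒nonZero K {{K+}}
    K⁻¹ = (ℚ.1/ K) {{K≢0}}

  ∣*∣-bound : ∀ {a b K η} → Positive K → ∣ a ∣ ℚ.≤ K → ∣ b ∣ ℚ.< η →
              ∣ a ℚ.* b ∣ ℚ.< K ℚ.* η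
  ∣*∣-bound {a} {b} {K} {η} K+ a≤K b<η = begin-strict
    ∣ a ℚ.* b ∣      ≡⟨ ℚₚ.∣p*q∣≡∣p∣*∣q∣ a b ⟩
    ∣ a ∣ ℚ.* ∣ b ∣  ≤⟨ ℚₚ.*-monoʳ-≤-nonNeg ∣ b ∣ {{ℚₚ.∣-∣-nonNeg b}} a≤K ⟩
    K ℚ.* ∣ b ∣      <⟨ ℚₚ.*-monoʳ-<-pos K {{K+}} b<η ⟩
    K ℚ.* η          ∎
    where open ℚₚ.≤-Reasoning

  *-difference-bound : ∀ {a b c d K J η θ} →
    Positive K → Positive J → ∣ a ∣ ℚ.≤ K → ∣ d ∣ ℚ.≤ J →
    ∣ b ℚ.- d ∣ ℚ.< η → ∣ a ℚ.- c ∣ ℚ.< θ →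
    ∣ a ℚ.* b ℚ.- c ℚ.* d ∣ ℚ.< K ℚ.* η ℚ.+ J ℚ.* θ
  *-difference-bound {a} {b} {c} {d} {K} {J} {η} {θ} K+ J+ a≤K d≤J b-d a-c =
    begin-strict
    ∣ a ℚ.* b ℚ.- c ℚ.* d ∣
      ≡⟨ cong ∣_∣ (rearrange a b c d) ⟩
    ∣ a ℚ.* (b ℚ.- d) ℚ.+ d ℚ.* (a ℚ.- c) ∣
      ≤⟨ ℚₚ.∣p+q∣≤∣p∣+∣q∣ (a ℚ.* (b ℚ.- d)) (d ℚ.* (a ℚ.- c)) ⟩
    ∣ a ℚ.* (b ℚ.- d) ∣ ℚ.+ ∣ d ℚ.* (a ℚ.- c) ∣
      <⟨ ℚₚ.+-mono-< (∣*∣-bound {a} {b ℚ.- d} K+ a≤K b-d)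
                     (∣*∣-bound {d} {a ℚ.- c} J+ d≤J a-c) ⟩
    K ℚ.* η ℚ.+ J ℚ.* θ ∎
    where
    open ℚₚ.≤-Reasoning
    open +-*-Solver
    rearrange : ∀ a b c d →
      a ℚ.* b ℚ.- c ℚ.* d ≡ a ℚ.* (b ℚ.- d) ℚ.+ d ℚ.* (a ℚ.- c)
    rearrange = solve 4
      (λ a b c d → a :* b :- c :* d := a :* (b :- d) :+ d :* (a :- c)) refl

  isCauchy-* : ∀ {s t} → IsCauchy s → IsCauchy t →
               IsCauchy (λ n → s n ℚ.* t n)
  isCauchy-* {s} {t} cs ct ε ε>0 =
    let K , K+ , M₁ , hK = cauchy⇒bounded cs
        J , J+ , N₁ , hJ = cauchy⇒bounded ct
        η , η>0 , Kη     = shrink K K+ ε ε>0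
        θ , θ>0 , Jθ     = shrink J J+ ε ε>0
        M₂ , hs          = cs θ θ>0
        N₂ , ht          = ct η η>0
        A = M₁ ℕ.⊔ N₁
        B = M₂ ℕ.⊔ N₂
        ≥A : ∀ {k} → A ℕ.⊔ B ℕ.≤ k → A ℕ.≤ k
        ≥A = ℕₚ.m⊔n≤o⇒m≤o A B
        ≥B : ∀ {k} → A ℕ.⊔ B ℕ.≤ k → B ℕ.≤ k
        ≥B = ℕₚ.m⊔n≤o⇒n≤o A B
    in A ℕ.⊔ B , λ {m} {n} m≥ n≥ →
      subst (∣ s m ℚ.* t m ℚ.- s n ℚ.* t n ∣ ℚ.<_)
        (trans (cong₂ ℚ._+_ Kη Jθ) (halves ε))
        (*-difference-bound {s m} {t m} {s n} {t n} {K} {J} {η} {θ} K+ J+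
          (hK (ℕₚ.m⊔n≤o⇒m≤o M₁ N₁ (≥A m≥)))
          (hJ (ℕₚ.m⊔n≤o⇒n≤o M₁ N₁ (≥A n≥)))
          (ht (ℕₚ.m⊔n≤o⇒n≤o M₂ N₂ (≥B m≥)) (ℕₚ.m⊔n≤o⇒n≤o M₂ N₂ (≥B n≥)))
          (hs (ℕₚ.m⊔n≤o⇒m≤o M₂ N₂ (≥B m≥)) (ℕₚ.m⊔n≤o⇒m≤o M₂ N₂ (≥B n≥))))

-- Real numbers are equal when related by _≃_, not by _≡_.

record ℝ : Set where
  constructor real
  field
    seq      : ℕ → ℚ
    isCauchy : IsCauchy seq

open ℝ public

infix  4 _≃_ _≤_
infixl 6 _+_
infixl 7 _*_

_≃_ : ℝ → ℝ → Set
x ≃ y = ∀ ε → 0ℚ ℚ.< ε →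
  ∃ λ N → ∀ {n} → N ℕ.≤ n → ∣ seq x n ℚ.- seq y n ∣ ℚ.< ε

_≤_ : ℝ → ℝ → Set
x ≤ y = ∀ ε → 0ℚ ℚ.< ε →
  ∃ λ N → ∀ {n} → N ℕ.≤ n → seq x n ℚ.< seq y n ℚ.+ ε

fromℚ : ℚ → ℝ
fromℚ q = real (λ _ → q) (isCauchy-const q)

0ℝ 1ℝ : ℝ
0ℝ = fromℚ 0ℚ
1ℝ = fromℚ 1ℚ

_+_ _*_ : ℝ → ℝ → ℝ
x + y = real (λ n → seq x n ℚ.+ seq y n)
             (isCauchy-+ {seq x} {seq y} (isCauchy x) (isCauchy y))
x * y = real (λ n → seq x n ℚ.* seq y n)
             (isCauchy-* {seq x} {seq y} (isCauchy x) (isCauchy y))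

∑ : ∀ {n} → Vector ℝ n → ℝ
∑ = Vector.foldr _+_ 0ℝ

Matrix : ℕ → ℕ → Set
Matrix r c = Fin r → Fin c → ℝ

infix  4 _≃ᵛ_ _≤ᵛ_
infixl 6 _+ᵛ_
infixr 7 _·_

_≃ᵛ_ _≤ᵛ_ : ∀ {n} → Vector ℝ n → Vector ℝ n → Set
u ≃ᵛ v = ∀ i → u i ≃ v i
u ≤ᵛ v = ∀ i → u i ≤ v i

_+ᵛ_ : ∀ {n} → Vector ℝ n → Vector ℝ n → Vector ℝ n
(u +ᵛ v) i = u i + v i

_·_ : ∀ {r c} → Matrix r c → Vector ℝ c → Vector ℝ r
(A · x) i = ∑ (λ j → A i j * x j)

conv : ∀ {n} → Pred (Vector ℝ n) 0ℓ → Pred (Vector ℝ n) 0ℓ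
conv {n} S x =
  ∃ λ (k : ℕ) → Σ (Vector ℝ k) λ w → Σ (Fin k → Vector ℝ n) λ s →
    (∀ i → S (s i)) × (∀ i → 0ℝ ≤ w i) × ∑ w ≃ 1ℝ ×
    x ≃ᵛ (λ j → ∑ (λ i → w i * s i j))

embed : ∀ {n} → Vec Bool n → Vector ℝ n
embed x i = if lookup x i then 1ℝ else 0ℝ

slice : Language → ∀ m → Pred (Vector ℝ m) 0ℓ
slice L m v = ∃ λ (x : Vec Bool m) → L (toList x) × v ≃ᵛ embed x

CF : Pred Language 0ℓ
CF L = ∃ λ (p : Polynomial) → ∀ m →
  Σ (Matrix (⟦ p ⟧ m) m) λ A → Σ (Matrix (⟦ p ⟧ m) (⟦ p ⟧ m)) λ B →
  Σ (Vector ℝ (⟦ p ⟧ m)) λ b →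
    ∀ (x : Vector ℝ m) → conv (slice L m) x ⇔ ∃ λ y → A · x +ᵛ B · y ≤ᵛ b

{-# OPTIONS --safe #-}
module Submission where

-- If AC⁰ ⊆ CF, then for L ∈ NP the tableaux of the verifying circuits of L form
-- an AC⁰ language, whose slices are projections of polyhedra with r = poly(m)
-- inequalities.  Those tableaux that start with a given x form a face of the
-- cube, so x ∈ L iff the polyhedron has a point with Hamming distance 0 from x
-- on the input letters; if x ∉ L, that distance, which is affine on the cube,
-- is at least 1 on the whole polyhedron.  This constant gap lets a small circuit
-- decide L without exact linear programming:
--
-- * divide every slack by its maximum over the slice and round to a polynomial
--   denominator; mixing in a little of the points of maximal slack turns an
--   almost feasible combination into a feasible one;
-- * by pigeonhole on subset sums, polynomially many points express every point
--   of the slice approximately with coefficients in {-1, 0, 1};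
-- * so x ∈ L iff a system of linear inequalities in polynomially many unknowns
--   is solvable with a margin, which the perceptron decides in polynomially many
--   updates of polynomially bounded integers.
--
-- The real data enter only through the rounded integers, and their existence is
-- needed only doubly negated: whether some circuit of the given size decides a
-- slice of L is a finite question.

-- The entries of the matrices may be huge or irrational, so the polyhedron itself cannot be wired
-- into a circuit; only polynomially bounded integers derived from it can. What survives rounding is
-- nonnegativity of slack: an affine combination of lifted vertices lies in the hull as soon as all
-- its slacks are nonnegative, and its weights may be negative. This is why coefficients -1, 0, 1
-- are admissible, and why approximate feasibility can be repaired by adding, for every inequality,
-- `h` copies of a point of largest slack.
--
-- Repair must not eat up the gap. Rounding and spanning each cost a fraction 1 / `M` of the total
-- weight `Q`, so `h` is about `2 * Q / M`. The `r * h` added points may miss all `m` input letters,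
-- which costs `r * h * m` mismatches; with `M = 1 + 2 * r * m` this stays below `Q` with enough
-- room for the margins.
--
-- A second constraint is that one circuit must serve every x of a given length. The spanning points
-- are therefore fixed before x is known: mismatches with both values of each input letter are among
-- the coordinates that they approximate, and x merely switches inequalities on or off.

open import Data.Bool.Base using (Bool; true; false; if_then_else_; _∧_; _∨_; not)
open import Data.Fin.Base using (Fin; zero; suc; toℕ; fromℕ<; splitAt; _↑ˡ_; _↑ʳ_; combine; remQuot)
open import Data.List.Base using (List; []; _∷_; length)
open import Data.Nat.Base using (ℕ; zero; suc)
open import Data.Product.Base using (∃; _×_; _,_; proj₁; proj₂)
open import Data.Sum.Base using (_⊎_; inj₁; inj₂; [_,_]′)
open import Data.Vec.Base using (Vec; []; _∷_; lookup; toList)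
open import Function.Base using (_∘_; id)
open import Function.Bundles using (_⇔_; mk⇔; Equivalence)
open import Relation.Binary.PropositionalEquality using (_≡_; _≢_; refl; sym; trans; cong; cong₂; subst; subst₂; module ≡-Reasoning)
open import Relation.Nullary using (Dec; yes; no; does; ¬_; contradiction)
open import Relation.Unary using (_⊈_)

-- Polynomials with natural coefficients.

module Polynomials where

  open import Data.Nat.Base using (_+_; _*_; _≤_; z≤n)
  open import Data.Nat.Properties using (+-identityʳ; *-zeroʳ; ≤-refl; +-mono-≤; *-mono-≤; *-identityʳ)
  open import Data.Nat.Solver using (module +-*-Solver)

  open import Defs using (Polynomial; ⟦_⟧)

  -- Equality rather than an upper bound, so that monotonicity carries over from polynomials with
  -- natural coefficients; word lengths rely on it to grow strictly.
  IsPolynomial : (ℕ → ℕ) → Set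
  IsPolynomial f = ∃ λ p → ∀ n → ⟦ p ⟧ n ≡ f n

  infixl 6 _⊕_
  infixl 7 _⊛_

  _⊕_ _⊛_ : Polynomial → Polynomial → Polynomial
  []       ⊕ q        = q
  (a ∷ p)  ⊕ []       = a ∷ p
  (a ∷ p)  ⊕ (b ∷ q)  = a + b ∷ p ⊕ q

  scale : ℕ → Polynomial → Polynomial
  scale a []      = []
  scale a (b ∷ q) = a * b ∷ scale a q

  []      ⊛ q = []
  (a ∷ p) ⊛ q = scale a q ⊕ (0 ∷ p ⊛ q)

  ⊕-correct : ∀ p q n → ⟦ p ⊕ q ⟧ n ≡ ⟦ p ⟧ n + ⟦ q ⟧ n
  ⊕-correct []      q       n = refl
  ⊕-correct (a ∷ p) []      n = sym (+-identityʳ _)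
  ⊕-correct (a ∷ p) (b ∷ q) n rewrite ⊕-correct p q n =
    solve 5 (λ a b n p q → (a :+ b) :+ n :* (p :+ q) := (a :+ n :* p) :+ (b :+ n :* q)) refl
      a b n (⟦ p ⟧ n) (⟦ q ⟧ n)
    where open +-*-Solver using (solve; _:=_; _:+_; _:*_)

  scale-correct : ∀ a q n → ⟦ scale a q ⟧ n ≡ a * ⟦ q ⟧ n
  scale-correct a []      n = sym (*-zeroʳ a)
  scale-correct a (b ∷ q) n rewrite scale-correct a q n =
    solve 4 (λ a b n q → a :* b :+ n :* (a :* q) := a :* (b :+ n :* q)) refl a b n (⟦ q ⟧ n)
    where open +-*-Solver using (solve; _:=_; _:+_; _:*_)

  ⊛-correct : ∀ p q n → ⟦ p ⊛ q ⟧ n ≡ ⟦ p ⟧ n * ⟦ q ⟧ n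
  ⊛-correct []      q n = refl
  ⊛-correct (a ∷ p) q n
    rewrite ⊕-correct (scale a q) (0 ∷ p ⊛ q) n | scale-correct a q n | ⊛-correct p q n =
    solve 4 (λ a n p q → a :* q :+ n :* (p :* q) := (a :+ n :* p) :* q) refl a n (⟦ p ⟧ n) (⟦ q ⟧ n)
    where open +-*-Solver using (solve; _:=_; _:+_; _:*_)

  poly-const : ∀ c → IsPolynomial (λ _ → c)
  poly-const c = c ∷ [] , λ n → trans (cong (c +_) (*-zeroʳ n)) (+-identityʳ c)

  poly-id : IsPolynomial (λ n → n)
  poly-id = 0 ∷ 1 ∷ [] , λ n → trans (cong (n *_) (cong suc (*-zeroʳ n))) (*-identityʳ n)

  poly-+ : ∀ {f g} → IsPolynomial f → IsPolynomial g → IsPolynomial (λ n → f n + g n)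
  poly-+ (p , hp) (q , hq) = p ⊕ q , λ n → trans (⊕-correct p q n) (cong₂ _+_ (hp n) (hq n))

  poly-* : ∀ {f g} → IsPolynomial f → IsPolynomial g → IsPolynomial (λ n → f n * g n)
  poly-* (p , hp) (q , hq) = p ⊛ q , λ n → trans (⊛-correct p q n) (cong₂ _*_ (hp n) (hq n))

  poly-∘ : ∀ p {f} → IsPolynomial f → IsPolynomial (λ n → ⟦ p ⟧ (f n))
  poly-∘ []      hf = poly-const 0
  poly-∘ (a ∷ p) hf = poly-+ (poly-const a) (poly-* hf (poly-∘ p hf))

  ⟦⟧-mono : ∀ p {m n} → m ≤ n → ⟦ p ⟧ m ≤ ⟦ p ⟧ n
  ⟦⟧-mono []      h = z≤n
  ⟦⟧-mono (a ∷ p) h = +-mono-≤ (≤-refl {a}) (*-mono-≤ h (⟦⟧-mono p h))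

  mono : ∀ {f} → IsPolynomial f → ∀ {m n} → m ≤ n → f m ≤ f n
  mono (p , hp) {m} {n} m≤n = subst₂ _≤_ (hp m) (hp n) (⟦⟧-mono p m≤n)

-- Building circuits of fan-in two with explicit size bounds.

module Circuits where

  open import Data.Bool.Properties using (∧-identityʳ; ∨-identityʳ)
  open import Data.List.Base using (allFin)
  open import Data.List.Properties using (length-tabulate)
  open import Data.List.Membership.Propositional using (_∈_)
  open import Data.List.Membership.Propositional.Properties using (∈-allFin)
  open import Data.List.Relation.Unary.Any using (here; there)
  open import Data.Maybe.Base using (Maybe; just; maybe)
  open import Data.Nat.Base using (_+_; _*_; _≤_; z≤n; s≤s)
  open import Data.Nat.Properties using (≤-trans; ≤-refl; +-monoʳ-≤; +-monoˡ-≤; +-assoc; +-comm; ⊔-lub; ≤-reflexive; +-identityʳ)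
  open import Data.Vec.Base using (tail; replicate) renaming (_++_ to _++ᵛ_)
  open import Data.Vec.Properties using (lookup-splitAt)

  open import Defs using (Circuit; evaluate; fanIn; Gate; Gates; AND; OR; NOT; []; _∷_; evalGate; wireValues; gateInputs; maxFanIn)

  record Net (n : ℕ) : Set where
    constructor net
    field
      {size} : ℕ
      gates  : Gates n size

  open Net

  Function : ℕ → Set
  Function n = Vec Bool n → Bool

  inputs : ∀ {n} → Net n
  inputs = net []

  values : ∀ {n} (N : Net n) → Vec Bool n → Vec Bool (size N + n)
  values N = wireValues (gates N)

  record Has {n} (f : Function n) (N : Net n) : Set where
    constructor _,_
    field
      wire    : Fin (size N + n)
      correct : ∀ x → lookup (values N x) wire ≡ f x

  infix 4 _⊑_

  data _⊑_ {n} (N : Net n) : Net n → Set where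
    refl : N ⊑ N
    _∷_  : ∀ {s} {gs : Gates n s} g → N ⊑ net gs → N ⊑ net (g ∷ gs)

  ⊑-trans : ∀ {n} {N N′ N″ : Net n} → N ⊑ N′ → N′ ⊑ N″ → N ⊑ N″
  ⊑-trans p refl    = p
  ⊑-trans p (g ∷ q) = g ∷ ⊑-trans p q

  Stable : ∀ {n} → (Net n → Set) → Set
  Stable P = ∀ {N N′} → N ⊑ N′ → P N → P N′

  has-stable : ∀ {n} {f : Function n} → Stable (Has f)
  has-stable refl    h = h
  has-stable (g ∷ e) h with has-stable e h
  ... | i , p = suc i , p

  has-cong : ∀ {n} {f g : Function n} {N} → (∀ x → f x ≡ g x) → Has f N → Has g N
  has-cong f≗g (i , p) = i , λ x → trans (p x) (f≗g x)

  -- A state monad graded by cost: nets only grow, so wires found earlier remain valid, and the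
  -- costs of successive steps add up. `narrow` carries along the fan-in bound that P/poly demands.
  record Build {n} (c : ℕ) (N : Net n) (P : Net n → Set) : Set where
    constructor build
    field
      {target} : Net n
      extends  : N ⊑ target
      cost     : size target ≤ c + size N
      narrow   : maxFanIn (gates N) ≤ 2 → maxFanIn (gates target) ≤ 2
      result   : P target

  module _ {n : ℕ} where

    return : ∀ {N : Net n} {P} → P N → Build 0 N P
    return p = build refl ≤-refl id p

    infixl 1 _>>=_

    _>>=_ : ∀ {N : Net n} {P Q c d} → Build c N P →
            (∀ {N′} → N ⊑ N′ → P N′ → Build d N′ Q) → Build (c + d) N Q
    _>>=_ {N} {c = c} {d} (build {N′} e co na p) k with k e p
    ... | build e′ co′ na′ q = build (⊑-trans e e′)
      (≤-trans co′ (≤-trans (+-monoʳ-≤ d co)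
        (≤-reflexive (trans (sym (+-assoc d c (size N))) (cong (_+ size N) (+-comm d c))))))
      (na′ ∘ na) q

    at-most : ∀ {N : Net n} {P c d} → c ≤ d → Build c N P → Build d N P
    at-most {N} c≤d (build e co na p) = build e (≤-trans co (+-monoˡ-≤ (size N) c≤d)) na p

    map-result : ∀ {N : Net n} {P Q : Net n → Set} {c} → (∀ {N′} → P N′ → Q N′) → Build c N P → Build c N Q
    map-result f (build e co na p) = build e co na (f p)

    forEach : ∀ {I : Set} {P : I → Net n → Set} {N c} → (∀ i → Stable (P i)) →
              ∀ is → (∀ {i} → i ∈ is → ∀ {N′} → N ⊑ N′ → Build c N′ (P i)) →
              Build (length is * c) N (λ N′ → ∀ {i} → i ∈ is → P i N′)
    forEach st []       mk = return λ ()
    forEach st (i ∷ is) mk =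
      mk (here refl) refl >>= λ e p →
      map-result (λ { (e′ , ps) (here refl) → st i e′ p ; (e′ , ps) (there m) → ps m })
        (keep (forEach st is (λ m e′ → mk (there m) (⊑-trans e e′))))
      where
      keep : ∀ {N : Net n} {P c} → Build c N P → Build c N (λ N′ → N ⊑ N′ × P N′)
      keep (build e co na p) = build e co na (e , p)

    forFin : ∀ {k} {P : Fin k → Net n → Set} {N c} → (∀ i → Stable (P i)) →
             (∀ i {N′} → N ⊑ N′ → Build c N′ (P i)) →
             Build (k * c) N (λ N′ → ∀ i → P i N′)
    forFin {k} {c = c} st mk =
      at-most (≤-reflexive (cong (_* c) (length-tabulate {n = k} id)))
        (map-result (λ h i → h (∈-allFin i)) (forEach st (allFin k) (λ {i} _ → mk i)))

    gate : ∀ {N : Net n} (g : Gate (size N + n)) → length (gateInputs g) ≤ 2 →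
           Build 1 N (Has (λ x → evalGate g (values N x)))
    gate g ≤2 = build (g ∷ refl) ≤-refl (⊔-lub ≤2) (zero , λ _ → refl)

    constant : ∀ {N : Net n} b → Build 1 N (Has (λ _ → b))
    constant true  = gate (AND []) z≤n
    constant false = gate (OR []) z≤n

    _∧ᵇ_ : ∀ {N : Net n} {f g} → Has f N → Has g N → Build 1 N (Has (λ x → f x ∧ g x))
    (i , p) ∧ᵇ (j , q) = map-result
      (has-cong λ x → cong₂ _∧_ (p x) (trans (∧-identityʳ _) (q x)))
      (gate (AND (i ∷ j ∷ [])) ≤-refl)

    _∨ᵇ_ : ∀ {N : Net n} {f g} → Has f N → Has g N → Build 1 N (Has (λ x → f x ∨ g x))
    (i , p) ∨ᵇ (j , q) = map-result
      (has-cong λ x → cong₂ _∨_ (p x) (trans (∨-identityʳ _) (q x)))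
      (gate (OR (i ∷ j ∷ [])) ≤-refl)

    notᵇ : ∀ {N : Net n} {f} → Has f N → Build 1 N (Has (λ x → not (f x)))
    notᵇ (i , p) = map-result (has-cong λ x → cong not (p x)) (gate (NOT i) (s≤s z≤n))

    mux : ∀ {N : Net n} {s f g} → Has s N → Has f N → Has g N →
          Build 4 N (Has (λ x → (s x ∧ f x) ∨ (not (s x) ∧ g x)))
    mux s f g =
      notᵇ s >>= λ e₁ ¬s →
      (has-stable e₁ s ∧ᵇ has-stable e₁ f) >>= λ e₂ sf →
      (has-stable e₂ ¬s ∧ᵇ has-stable (⊑-trans e₁ e₂) g) >>= λ e₃ sg →
      has-stable e₃ sf ∨ᵇ sg

    record HasVec {q} (f : Vec Bool n → Vec Bool q) (N : Net n) : Set where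
      constructor hasVec
      field at : ∀ j → Has (λ x → lookup (f x) j) N

    open HasVec public

    hasVec-stable : ∀ {q} {f : Vec Bool n → Vec Bool q} → Stable (HasVec f)
    hasVec-stable e h = hasVec λ j → has-stable e (at h j)

    hasVec-cong : ∀ {q} {f g : Vec Bool n → Vec Bool q} {N} →
                  (∀ x → f x ≡ g x) → HasVec f N → HasVec g N
    hasVec-cong f≗g h = hasVec λ j → has-cong (λ x → cong (λ v → lookup v j) (f≗g x)) (at h j)

  -- Shannon expansion
  localCost : ℕ → ℕ
  localCost zero    = 1
  localCost (suc q) = localCost q + (localCost q + 4)

  module _ {n : ℕ} where

    -- The cost is exponential in `q`, which is harmless: every use has a `q` that is constant or
    -- fixed by the Turing machine, never growing with the input.
    local : ∀ {q} (g : Vec Bool q → Bool) {f : Vec Bool n → Vec Bool q} {N : Net n} →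
            HasVec f N → Build (localCost q) N (Has (λ x → g (f x)))
    local {zero} g {f} h =
      map-result (has-cong λ x → cong g (nil (f x))) (constant (g []))
      where
      nil : ∀ (v : Vec Bool 0) → [] ≡ v
      nil [] = refl
    local {suc q} g {f} h =
      local (λ v → g (true ∷ v)) (tail-has h) >>= λ e₁ t →
      local (λ v → g (false ∷ v)) (tail-has (hasVec-stable e₁ h)) >>= λ e₂ u →
      map-result (has-cong λ x → expand (f x))
        (mux (has-stable (⊑-trans e₁ e₂) (at h zero)) (has-stable e₂ t) u)
      where
      tail-has : ∀ {N} → HasVec f N → HasVec (λ x → tail (f x)) N
      tail-has h = hasVec λ j → has-cong (λ x → split j (f x)) (at h (suc j))
        where
        split : ∀ j (v : Vec Bool (suc q)) → lookup v (suc j) ≡ lookup (tail v) j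
        split _ (_ ∷ _) = refl
      expand : ∀ v → (lookup v zero ∧ g (true ∷ tail v)) ∨ (not (lookup v zero) ∧ g (false ∷ tail v)) ≡ g v
      expand (true  ∷ v) = ∨-identityʳ _
      expand (false ∷ v) = refl

    localVec : ∀ {q r} (g : Vec Bool q → Vec Bool r) {f : Vec Bool n → Vec Bool q} {N : Net n} →
               HasVec f N → Build (r * localCost q) N (HasVec (λ x → g (f x)))
    localVec g h = map-result hasVec (forFin (λ _ → has-stable)
      λ j e → local (λ v → lookup (g v) j) (hasVec-stable e h))

  -- A partial decoder suffices because `lift` has to be right on codes only; on other bit strings
  -- it may output anything.
  record Bits (A : Set) : Set where
    field
      width   : ℕ
      enc     : A → Vec Bool width
      dec     : Vec Bool width → Maybe A
      dec-enc : ∀ a → dec (enc a) ≡ just a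

    HasVal : ∀ {n} → (Vec Bool n → A) → Net n → Set
    HasVal f N = HasVec (λ x → enc (f x)) N

    hasVal-cong : ∀ {n} {f g : Vec Bool n → A} {N} →
                  (∀ x → f x ≡ g x) → HasVal f N → HasVal g N
    hasVal-cong f≗g = hasVec-cong (λ x → cong enc (f≗g x))

  open Bits

  bits-Bool : Bits Bool
  bits-Bool = record
    { width = 1 ; enc = λ b → b ∷ [] ; dec = λ { (b ∷ []) → just b } ; dec-enc = λ _ → refl }

  bits-Vec : ∀ w → Bits (Vec Bool w)
  bits-Vec w = record { width = w ; enc = id ; dec = just ; dec-enc = λ _ → refl }

  liftCost : ∀ {A B} → Bits A → Bits B → ℕ
  liftCost A B = width B * localCost (width A)

  lift : ∀ {A B : Set} (bA : Bits A) (bB : Bits B) (h : A → B)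
         {n} {f : Vec Bool n → A} {N : Net n} →
         HasVal bA f N → Build (liftCost bA bB) N (HasVal bB (λ x → h (f x)))
  lift bA bB h {f = f} hf = map-result
    (hasVec-cong λ x → cong (maybe _ _) (dec-enc bA (f x)))
    (localVec (λ v → maybe (λ a → enc bB (h a)) (replicate _ false) (dec bA v)) hf)

  constantVal : ∀ {A : Set} (bA : Bits A) (a : A) {n} {N : Net n} →
                Build (liftCost (bits-Vec 0) bA) N (HasVal bA (λ _ → a))
  constantVal bA a = lift (bits-Vec 0) bA (λ _ → a) {f = λ _ → []} (hasVec λ ())

  hasVec-++ : ∀ {n a b} {f : Vec Bool n → Vec Bool a} {g : Vec Bool n → Vec Bool b} {N : Net n} →
              HasVec f N → HasVec g N → HasVec (λ x → f x ++ᵛ g x) N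
  hasVec-++ {a = a} {f = f} {g} {N} hf hg = hasVec part
    where
    part : ∀ i → Has (λ x → lookup (f x ++ᵛ g x) i) N
    part i with splitAt a i | (λ x → lookup-splitAt a (f x) (g x) i)
    ... | inj₁ j | eq = has-cong (λ x → sym (eq x)) (at hf j)
    ... | inj₂ j | eq = has-cong (λ x → sym (eq x)) (at hg j)

  circuitOf : ∀ {n c} {f : Function n} → Build c inputs (Has f) →
              ∃ λ (C : Circuit n) → Circuit.size C ≤ c × fanIn C ≤ 2 × (∀ x → evaluate C x ≡ f x)
  circuitOf {c = c} (build {N} _ co na h) =
    record { gates = gates N ; output = Has.wire h } ,
    ≤-trans co (≤-reflexive (+-identityʳ c)) , na z≤n , Has.correct h

-- From nondeterministic Turing machines to verifying circuits.

module Simulation where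

  import Data.Bool.Properties as Boolₚ
  open import Data.Fin.Properties using (toℕ-fromℕ<; toℕ<n; remQuot-combine)
  open import Data.List.Base as List using (null; map)
  open import Data.List.Membership.Propositional using (_∈_; find; lose)
  open import Data.List.Membership.Propositional.Properties using (∈-map⁺; ∈-map⁻)
  open import Data.List.Relation.Unary.All as All using (All)
  open import Data.List.Relation.Unary.Any as Any using (Any; any?)
  open import Data.Maybe.Base as Maybe using (Maybe; just; nothing; fromMaybe)
  open import Data.Nat.Base using (_+_; _*_; _≤_; _<_; z≤n; s≤s)
  open import Data.Nat.Properties
    using (≤-refl; m≤n⇒m≤1+n; <⇒≤; +-mono-≤; *-monoˡ-≤; *-monoʳ-≤; n≤1+n; +-monoˡ-≤; module ≤-Reasoning; m≤m+n; m≤n+m; +-monoʳ-≤)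
  open import Data.Vec.Base as Vec using (replicate; tabulate)
  open import Data.Vec.Properties using (≡-dec; lookup∘tabulate; tabulate∘lookup; tabulate-cong; length-toList)
  open import Data.Nat.Solver using (module +-*-Solver)
  open import Relation.Nullary.Decidable using (dec-true)

  open import Defs using (Symbol; blank; bit; aux; Move; left; stay; right; NTM; Tape; tape; move; write; Config; initial; Accepts; halt; step; HaltsWithin; ⟦_⟧; Language; NP)
  open Circuits
  open Polynomials

  open Bits

  take-++ : ∀ {A : Set} {m n} (u : Vec A m) (v : Vec A n) → Vec.take m (u Vec.++ v) ≡ u
  take-++ []      v = refl
  take-++ (x ∷ u) v = cong (x ∷_) (take-++ u v)

  drop-++ : ∀ {A : Set} {m n} (u : Vec A m) (v : Vec A n) → Vec.drop m (u Vec.++ v) ≡ v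
  drop-++ []      v = refl
  drop-++ (x ∷ u) v = drop-++ u v

  lookup-take : ∀ {A : Set} {m k} (z : Vec A (m + k)) j → lookup z (j ↑ˡ k) ≡ lookup (Vec.take m z) j
  lookup-take {m = suc m} (b ∷ z) zero    = refl
  lookup-take {m = suc m} (b ∷ z) (suc j) = lookup-take z j

  lookup-drop : ∀ {A : Set} m {k} (z : Vec A (m + k)) j → lookup z (m ↑ʳ j) ≡ lookup (Vec.drop m z) j
  lookup-drop zero    z       j = refl
  lookup-drop (suc m) (b ∷ z) j = lookup-drop m z j

  bits-× : ∀ {A B} → Bits A → Bits B → Bits (A × B)
  bits-× {A} {B} bA bB = record
    { width   = width bA + width bB
    ; enc     = λ (a , b) → enc bA a Vec.++ enc bB b
    ; dec     = decode
    ; dec-enc = λ (a , b) → dec-enc′ a b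
    }
    where
    decode : Vec Bool (width bA + width bB) → Maybe (A × B)
    decode v = dec bA (Vec.take (width bA) v) Maybe.>>= λ a → Maybe.map (a ,_) (dec bB (Vec.drop (width bA) v))
    dec-enc′ : ∀ a b → decode (enc bA a Vec.++ enc bB b) ≡ just (a , b)
    dec-enc′ a b
      rewrite take-++ (enc bA a) (enc bB b) | drop-++ (enc bA a) (enc bB b) | dec-enc bA a | dec-enc bB b = refl

  hasVal-× : ∀ {A B : Set} (bA : Bits A) (bB : Bits B) {n} {f : Vec Bool n → A} {g : Vec Bool n → B} {N} →
             HasVal bA f N → HasVal bB g N → HasVal (bits-× bA bB) (λ x → f x , g x) N
  hasVal-× bA bB = hasVec-++

  one-hot : ∀ {k} → Fin k → Vec Bool k
  one-hot zero    = true ∷ replicate _ false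
  one-hot (suc i) = false ∷ one-hot i

  bits-Fin : ∀ k → Bits (Fin k)
  bits-Fin k = record { width = k ; enc = one-hot ; dec = decode ; dec-enc = correct }
    where
    decode : ∀ {k} → Vec Bool k → Maybe (Fin k)
    decode []          = nothing
    decode (true  ∷ v) = just zero
    decode (false ∷ v) = Maybe.map suc (decode v)
    correct : ∀ {k} (i : Fin k) → decode (one-hot i) ≡ just i
    correct zero    = refl
    correct (suc i) = cong (Maybe.map suc) (correct i)

  retract : ∀ {A B : Set} (to : A → B) (from : B → A) → (∀ a → from (to a) ≡ a) → Bits B → Bits A
  retract to from inv bB = record
    { width = width bB ; enc = enc bB ∘ to ; dec = Maybe.map from ∘ dec bB
    ; dec-enc = λ a → trans (cong (Maybe.map from) (dec-enc bB (to a))) (cong just (inv a)) }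

  bits-Symbol : ∀ k → Bits (Symbol k)
  bits-Symbol k = retract to from inv (bits-Fin (3 + k))
    where
    to : Symbol k → Fin (3 + k)
    to blank       = zero
    to (bit false) = suc zero
    to (bit true)  = suc (suc zero)
    to (aux i)     = suc (suc (suc i))
    from : Fin (3 + k) → Symbol k
    from zero                = blank
    from (suc zero)          = bit false
    from (suc (suc zero))    = bit true
    from (suc (suc (suc i))) = aux i
    inv : ∀ a → from (to a) ≡ a
    inv blank       = refl
    inv (bit false) = refl
    inv (bit true)  = refl
    inv (aux i)     = refl

  bits-Move : Bits Move
  bits-Move = retract to from inv (bits-Fin 3)
    where
    to : Move → Fin 3
    to left  = zero
    to stay  = suc zero
    to right = suc (suc zero)
    from : Fin 3 → Move
    from zero             = left
    from (suc zero)       = stay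
    from (suc (suc zero)) = right
    inv : ∀ a → from (to a) ≡ a
    inv left  = refl
    inv stay  = refl
    inv right = refl

  choose : ∀ {A : Set} → Move → A → A → A → A
  choose left  a b c = a
  choose stay  a b c = b
  choose right a b c = c

  push : ∀ {A : Set} → A → (ℕ → A) → ℕ → A
  push a f zero    = a
  push a f (suc i) = f i

  module Machine (M : NTM) where
    open NTM M

    State Sym Instruction : Set
    State       = Fin #states
    Sym         = Symbol #aux
    Instruction = State × Sym × Move

    bQ : Bits State
    bQ = bits-Fin #states

    bS : Bits Sym
    bS = bits-Symbol #aux

    bI : Bits Instruction
    bI = bits-× bQ (bits-× bS bits-Move)

    w : ℕ
    w = width bI

    Guess : Set
    Guess = Vec Bool w

    bG : Bits Guess
    bG = bits-Vec w

    -- The default for strings that code no instruction does no harm: `verdict` demands that the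
    -- guess code an instruction offered by `δ` whenever a step is taken.
    instruction : Guess → Instruction
    instruction g = fromMaybe (start , blank , stay) (dec bI g)

    encodes? : ∀ (g : Guess) is → Dec (Any (λ i → enc bI i ≡ g) is)
    encodes? g = any? λ i → ≡-dec Boolₚ._≟_ (enc bI i) g

    -- Tapes are functions here, so that only the cells that the head can still
    -- reach need wires.
    record FConfig : Set where
      field
        state  : State
        symbol : Sym
        before : ℕ → Sym
        after  : ℕ → Sym

    open FConfig

    next : Instruction → FConfig → FConfig
    next (q , a , d) c = record
      { state  = q
      ; symbol = choose d (before c 0) a (after c 0)
      ; before = λ i → choose d (before c (suc i)) (before c i) (push a (before c) i)
      ; after  = λ i → choose d (push a (after c) i) (after c i) (after c (suc i))
      }

    -- Halting is tested first and the guess is then ignored, so a computation that stops early can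
    -- be padded with arbitrary guesses.
    verdict : (State × Sym) × (Guess × Bool) → Bool
    verdict ((q , a) , (g , r)) = if null (δ q a) then accepting q else (does (encodes? g (δ q a)) ∧ r)

    run : ∀ s → FConfig → (Fin s → Guess) → Bool
    run zero    c g = null (δ (state c) (symbol c)) ∧ accepting (state c)
    run (suc s) c g = verdict ((state c , symbol c) ,
      (g zero , run s (next (instruction (g zero)) c) (g ∘ suc)))

    cells : List Sym → ℕ → Sym
    cells []       i       = blank
    cells (a ∷ as) zero    = a
    cells (a ∷ as) (suc i) = cells as i

    record Represents (c : Config M) (f : FConfig) : Set where
      open Tape (proj₂ c) renaming (before to ls; after to rs)
      field
        state≡  : state f ≡ proj₁ c
        symbol≡ : symbol f ≡ head
        before≡ : ∀ i → before f i ≡ cells ls i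
        after≡  : ∀ i → after f i ≡ cells rs i

    open Represents

    push-cells : ∀ {a f as} → (∀ i → f i ≡ cells as i) → ∀ i → push a f i ≡ cells (a ∷ as) i
    push-cells h zero    = refl
    push-cells h (suc i) = h i

    apply : Instruction → Tape #aux → Config M
    apply (q , a , d) t = q , move d (write a t)

    represents-next : ∀ {q t f} ins → Represents (q , t) f → Represents (apply ins t) (next ins f)
    represents-next {t = tape [] h rs} (q , a , left) r = record
      { state≡ = refl ; symbol≡ = before≡ r 0 ; before≡ = λ i → before≡ r (suc i) ; after≡ = push-cells (after≡ r) }
    represents-next {t = tape (l ∷ ls) h rs} (q , a , left) r = record
      { state≡ = refl ; symbol≡ = before≡ r 0 ; before≡ = λ i → before≡ r (suc i) ; after≡ = push-cells (after≡ r) }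
    represents-next (q , a , stay) r = record
      { state≡ = refl ; symbol≡ = refl ; before≡ = before≡ r ; after≡ = after≡ r }
    represents-next {t = tape ls h []} (q , a , right) r = record
      { state≡ = refl ; symbol≡ = after≡ r 0 ; before≡ = push-cells (before≡ r) ; after≡ = λ i → after≡ r (suc i) }
    represents-next {t = tape ls h (_ ∷ rs)} (q , a , right) r = record
      { state≡ = refl ; symbol≡ = after≡ r 0 ; before≡ = push-cells (before≡ r) ; after≡ = λ i → after≡ r (suc i) }

    null-map : ∀ {A B : Set} {f : A → B} as → null as ≡ true → map f as ≡ []
    null-map [] _ = refl

    map-null : ∀ {A B : Set} {f : A → B} as → map f as ≡ [] → null as ≡ true
    map-null [] _ = refl

    instruction-enc : ∀ {i g} → enc bI i ≡ g → instruction g ≡ i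
    instruction-enc {i} refl = cong (fromMaybe _) (dec-enc bI i)

    run-sound : ∀ s {c f} g → Represents c f → run s f g ≡ true → Accepts M c
    run-sound zero {q , t} {f} g r e with state f | symbol f | state≡ r | symbol≡ r
    run-sound zero {q , t} g r e | _ | _ | refl | refl with δ q (Tape.head t) in eq | accepting q in acc
    ... | [] | true = halt (null-map (δ q (Tape.head t)) (cong null eq)) acc
    run-sound (suc s) {q , t} {f} g r e with state f | symbol f | state≡ r | symbol≡ r
    run-sound (suc s) {q , t} {f} g r e | _ | _ | refl | refl with null (δ q (Tape.head t)) in eq
    ... | true = halt (null-map (δ q (Tape.head t)) eq) e
    ... | false with encodes? (g zero) (δ q (Tape.head t))
    ...   | yes any with find any
    ...     | i , i∈ , eg = step (∈-map⁺ _ i∈)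
      (run-sound s (g ∘ suc) (represents-next i r)
        (subst (λ j → run s (next j f) (g ∘ suc) ≡ true) (instruction-enc eg) e))

    verdict-halt : ∀ {q a} gr → null (δ q a) ≡ true → accepting q ≡ true → verdict ((q , a) , gr) ≡ true
    verdict-halt gr h acc rewrite h = acc

    verdict-step : ∀ {q a i r} g → enc bI i ≡ g → i ∈ δ q a → r ≡ true → verdict ((q , a) , (g , r)) ≡ true
    verdict-step {q} {a} g e i∈ refl with δ q a
    ... | as@(_ ∷ _) = cong (_∧ true) (dec-true (encodes? g as) (lose i∈ e))

    -- The time bound is what excludes a further step once the guesses are used up.
    run-complete : ∀ s {c f} → Represents c f → HaltsWithin M s c → Accepts M c →
                   ∃ λ g → run s f g ≡ true
    run-complete zero {q , t} r h (halt e acc) rewrite state≡ r | symbol≡ r =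
      (λ ()) , cong₂ _∧_ (map-null (δ q _) e) acc
    run-complete zero r h (step c∈ _) with subst (_ ∈_) h c∈
    ... | ()
    run-complete (suc s) {q , t} {f} r h (halt e acc) = (λ _ → replicate _ false) , done
      where
      done : run (suc s) f (λ _ → replicate _ false) ≡ true
      done rewrite state≡ r | symbol≡ r = verdict-halt _ (map-null (δ q _) e) acc
    run-complete (suc s) {q , t} {f} r h (step c∈ a) with ∈-map⁻ _ c∈
    ... | i , i∈ , refl with run-complete s (represents-next i r) (All.lookup h c∈) a
    ...   | g , p = guess , done
      where
      guess : Fin (suc s) → Guess
      guess zero    = enc bI i
      guess (suc k) = g k
      done : run (suc s) f guess ≡ true
      done rewrite state≡ r | symbol≡ r | instruction-enc {i} refl = verdict-step (enc bI i) refl i∈ p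

    -- `s` counts the steps still to come. The head cannot get past `s` cells on either side in that
    -- time, so each simulated step may forget one cell on each side.
    record HasConfig {n} (s : ℕ) (f : Vec Bool n → FConfig) (N : Net n) : Set where
      field
        has-state  : HasVal bQ (state ∘ f) N
        has-symbol : HasVal bS (symbol ∘ f) N
        has-before : ∀ i → i < s → HasVal bS (λ x → before (f x) i) N
        has-after  : ∀ i → i < s → HasVal bS (λ x → after (f x) i) N

    open HasConfig

    hasConfig-stable : ∀ {n s} {f : Vec Bool n → FConfig} → Stable (HasConfig s f)
    hasConfig-stable e h = record
      { has-state  = hasVec-stable e (has-state h)
      ; has-symbol = hasVec-stable e (has-symbol h)
      ; has-before = λ i i<s → hasVec-stable e (has-before h i i<s)
      ; has-after  = λ i i<s → hasVec-stable e (has-after h i i<s)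
      }

    below : ∀ {n s} {P : ℕ → Net n → Set} {N : Net n} → (∀ (i : Fin s) → P (toℕ i) N) → ∀ i → i < s → P i N
    below {P = P} {N} h i i<s = subst (λ k → P k N) (toℕ-fromℕ< i<s) (h (fromℕ< i<s))

    bCell : Bits (Guess × (Sym × (Sym × Sym)))
    bCell = bits-× bG (bits-× bS (bits-× bS bS))

    bVerdict : Bits ((State × Sym) × (Guess × Bool))
    bVerdict = bits-× (bits-× bQ bS) (bits-× bG bits-Bool)

    cellCost verdictCost : ℕ
    cellCost    = liftCost bCell bS
    verdictCost = liftCost bVerdict bits-Bool

    stepCost : ℕ → ℕ
    stepCost s = liftCost bG bQ + (cellCost + (s * cellCost + (s * cellCost + 0)))

    module _ {n : ℕ} {f : Vec Bool n → FConfig} {g : Vec Bool n → Guess} where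

      private
        lift-cell : ∀ {a b c : Vec Bool n → Sym} {N} (h : Guess × (Sym × (Sym × Sym)) → Sym) →
                    HasVal bG g N → HasVal bS a N → HasVal bS b N → HasVal bS c N →
                    Build cellCost N (HasVal bS (λ x → h (g x , (a x , (b x , c x)))))
        lift-cell {a} {b} {c} h hg ha hb hc = lift bCell bS h
          (hasVal-× bG (bits-× bS (bits-× bS bS)) {g = λ x → a x , (b x , c x)} hg
            (hasVal-× bS (bits-× bS bS) {f = a} {λ x → b x , c x} ha (hasVal-× bS bS {f = b} {c} hb hc)))

        written : Guess → Sym
        written g = proj₁ (proj₂ (instruction g))

        direction : Guess → Move
        direction g = proj₂ (proj₂ (instruction g))

        nextF : Vec Bool n → FConfig
        nextF x = next (instruction (g x)) (f x)

      build-next : ∀ {s N} → HasConfig (suc s) f N → HasVal bG g N → Build (stepCost s) N (HasConfig s nextF)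
      build-next {s} h hg =
        lift bG bQ (proj₁ ∘ instruction) hg >>= λ e₁ q →
        -- `lift-cell` always takes three symbols; where a new cell depends on two old ones only,
        -- one of them is repeated as a placeholder.
        lift-cell (λ (g , (a , (_ , b))) → choose (direction g) a (written g) b)
          (hasVec-stable e₁ hg) (hasVec-stable e₁ (has-before h 0 (s≤s z≤n)))
          (hasVec-stable e₁ (has-before h 0 (s≤s z≤n))) (hasVec-stable e₁ (has-after h 0 (s≤s z≤n)))
          >>= λ e₂ a →
        forFin (λ _ → hasVec-stable) (λ i e → before-cell (hasConfig-stable (⊑-trans e₁ (⊑-trans e₂ e)) h)
            (hasVec-stable (⊑-trans e₁ (⊑-trans e₂ e)) hg) (toℕ i) (toℕ<n i)) >>= λ e₃ l →
        forFin (λ _ → hasVec-stable) (λ i e → after-cell (hasConfig-stable (⊑-trans e₁ (⊑-trans e₂ (⊑-trans e₃ e))) h)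
            (hasVec-stable (⊑-trans e₁ (⊑-trans e₂ (⊑-trans e₃ e))) hg) (toℕ i) (toℕ<n i)) >>= λ e₄ r →
        return record
           { has-state  = hasVec-stable (⊑-trans e₂ (⊑-trans e₃ e₄)) q
           ; has-symbol = hasVec-stable (⊑-trans e₃ e₄) a
           ; has-before = below {P = λ i → HasVal bS (λ x → before (nextF x) i)} (λ i → hasVec-stable e₄ (l i))
           ; has-after  = below {P = λ i → HasVal bS (λ x → after (nextF x) i)} r
           }
        where
        before-cell : ∀ {N} → HasConfig (suc s) f N → HasVal bG g N → ∀ i → i < s →
                      Build cellCost N (HasVal bS (λ x → before (nextF x) i))
        before-cell h hg zero i<s = lift-cell (λ (g , (a , (b , _))) → choose (direction g) a b (written g)) hg
          (has-before h 1 (s≤s i<s)) (has-before h 0 (s≤s z≤n)) (has-before h 0 (s≤s z≤n))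
        before-cell h hg (suc i) i<s = lift-cell (λ (g , (a , (b , c))) → choose (direction g) a b c) hg
          (has-before h (suc (suc i)) (s≤s i<s)) (has-before h (suc i) (m≤n⇒m≤1+n i<s)) (has-before h i (m≤n⇒m≤1+n (<⇒≤ i<s)))
        after-cell : ∀ {N} → HasConfig (suc s) f N → HasVal bG g N → ∀ i → i < s →
                     Build cellCost N (HasVal bS (λ x → after (nextF x) i))
        after-cell h hg zero i<s = lift-cell (λ (g , (a , (b , _))) → choose (direction g) (written g) b a) hg
          (has-after h 1 (s≤s i<s)) (has-after h 0 (s≤s z≤n)) (has-after h 0 (s≤s z≤n))
        after-cell h hg (suc i) i<s = lift-cell (λ (g , (a , (b , c))) → choose (direction g) c b a) hg
          (has-after h (suc (suc i)) (s≤s i<s)) (has-after h (suc i) (m≤n⇒m≤1+n i<s)) (has-after h i (m≤n⇒m≤1+n (<⇒≤ i<s)))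

    runCost : ℕ → ℕ
    runCost zero    = liftCost (bits-× bQ bS) bits-Bool
    runCost (suc s) = stepCost s + (runCost s + verdictCost)

    as-bit : ∀ {n} {f : Function n} {N} → HasVal bits-Bool f N → Has f N
    as-bit h = has-cong (λ _ → refl) (at h zero)

    from-bit : ∀ {n} {f : Function n} {N} → Has f N → HasVal bits-Bool f N
    from-bit h = hasVec λ { zero → has-cong (λ _ → refl) h }

    build-run : ∀ s {n} {f : Vec Bool n → FConfig} {g : Vec Bool n → Fin s → Guess} {N} →
                HasConfig s f N → (∀ t → HasVal bG (λ x → g x t) N) →
                Build (runCost s) N (Has (λ x → run s (f x) (g x)))
    build-run zero {f = f} h hg = map-result as-bit
      (lift (bits-× bQ bS) bits-Bool (λ (q , a) → null (δ q a) ∧ accepting q)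
        (hasVal-× bQ bS {f = state ∘ f} {symbol ∘ f} (has-state h) (has-symbol h)))
    build-run (suc s) {f = f} {g} h hg =
      build-next h (hg zero) >>= λ e₁ h′ →
      build-run s {g = λ x → g x ∘ suc} h′ (λ t → hasVec-stable e₁ (hg (suc t))) >>= λ e₂ r →
      let e = ⊑-trans e₁ e₂ ; h₂ = hasConfig-stable e h in
      map-result as-bit
        (lift bVerdict bits-Bool verdict
          (hasVal-× (bits-× bQ bS) (bits-× bG bits-Bool)
            {f = λ x → state (f x) , symbol (f x)}
            {λ x → g x zero , run s (next (instruction (g x zero)) (f x)) (g x ∘ suc)}
            (hasVal-× bQ bS {f = state ∘ f} {symbol ∘ f} (has-state h₂) (has-symbol h₂))
            (hasVal-× bG bits-Bool {f = λ x → g x zero} (hasVec-stable e (hg zero)) (from-bit r))))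

    inputConfig : List Bool → FConfig
    inputConfig x = record
      { state = start ; symbol = cells (map bit x) 0 ; before = λ _ → blank ; after = cells (map bit x) ∘ suc }

    represents-input : ∀ x → Represents (initial M x) (inputConfig x)
    represents-input []      = record { state≡ = refl ; symbol≡ = refl ; before≡ = λ _ → refl ; after≡ = λ _ → refl }
    represents-input (b ∷ x) = record { state≡ = refl ; symbol≡ = refl ; before≡ = λ _ → refl ; after≡ = λ _ → refl }

    symbolCost : ℕ
    symbolCost = liftCost (bits-Vec 0) bS + liftCost bits-Bool bS

    build-cell : ∀ {n m} {x : Vec Bool n → Vec Bool m} {N} → HasVec x N → ∀ i →
                 Build symbolCost N (HasVal bS (λ z → cells (map bit (toList (x z))) i))
    build-cell {m = zero} {x} h i =
      at-most (m≤m+n _ _) (map-result (hasVal-cong bS λ z → empty (x z)) (constantVal bS blank))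
      where
      empty : (v : Vec Bool 0) → blank ≡ cells (map bit (toList v)) i
      empty [] = refl
    build-cell {m = suc m} {x} h zero =
      at-most (m≤n+m _ (liftCost (bits-Vec 0) bS)) (map-result (hasVal-cong bS λ z → first (x z))
        (lift bits-Bool bS bit (from-bit (at h zero))))
      where
      first : (v : Vec Bool (suc m)) → bit (lookup v zero) ≡ cells (map bit (toList v)) zero
      first (_ ∷ _) = refl
    build-cell {m = suc m} {x} h (suc i) =
      map-result (hasVal-cong bS λ z → rest (x z))
        (build-cell {x = Vec.tail ∘ x} (hasVec λ j → has-cong (λ z → lookup-tail (x z) j) (at h (suc j))) i)
      where
      rest : (v : Vec Bool (suc m)) → cells (map bit (toList (Vec.tail v))) i ≡ cells (map bit (toList v)) (suc i)
      rest (_ ∷ _) = refl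
      lookup-tail : (v : Vec Bool (suc m)) → ∀ j → lookup v (suc j) ≡ lookup (Vec.tail v) j
      lookup-tail (_ ∷ _) j = refl

    configCost : ℕ → ℕ
    configCost s = liftCost (bits-Vec 0) bQ + (liftCost (bits-Vec 0) bS + (symbolCost + (s * symbolCost + 0)))

    build-input : ∀ s {n m} {x : Vec Bool n → Vec Bool m} {N} → HasVec x N →
                  Build (configCost s) N (HasConfig s (λ z → inputConfig (toList (x z))))
    build-input s {x = x} h =
      constantVal bQ start >>= λ e₁ q →
      constantVal bS blank >>= λ e₂ b →
      build-cell {x = x} (hasVec-stable (⊑-trans e₁ e₂) h) 0 >>= λ e₃ a →
      forFin {P = λ (i : Fin s) → HasVal bS (λ z → cells (map bit (toList (x z))) (suc (toℕ i)))} (λ _ → hasVec-stable)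
        (λ i e → build-cell {x = x} (hasVec-stable (⊑-trans e₁ (⊑-trans e₂ (⊑-trans e₃ e))) h) (suc (toℕ i))) >>= λ e₄ r →
      return record
        { has-state  = hasVec-stable (⊑-trans e₂ (⊑-trans e₃ e₄)) q
        ; has-symbol = hasVec-stable e₄ a
        ; has-before = λ i _ → hasVec-stable (⊑-trans e₃ e₄) b
        ; has-after  = below {P = λ i → HasVal bS (λ z → cells (map bit (toList (x z))) (suc i))} r
        }

    module _ (m s : ℕ) where

      word : Vec Bool (m + s * w) → Vec Bool m
      word = Vec.take m

      guesses : Vec Bool (m + s * w) → Fin s → Guess
      guesses z t = tabulate λ j → lookup (Vec.drop m z) (combine t j)

      accepts : Function (m + s * w)
      accepts z = run s (inputConfig (toList (word z))) (guesses z)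

      acceptsCost : ℕ
      acceptsCost = configCost s + runCost s

      build-accepts : Build acceptsCost inputs (Has accepts)
      build-accepts =
        build-input s {x = word} (hasVec λ j → j ↑ˡ (s * w) , λ z → lookup-take z j) >>= λ e h →
        build-run s {g = guesses} h λ t → hasVec-stable e (hasVec λ j → m ↑ʳ combine t j ,
          λ z → trans (lookup-drop m z (combine t j)) (sym (lookup∘tabulate _ j)))

      accepts-sound : ∀ z → accepts z ≡ true → Accepts M (initial M (toList (word z)))
      accepts-sound z = run-sound s (guesses z) (represents-input (toList (word z)))

      accepts-complete : ∀ (x : Vec Bool m) → HaltsWithin M s (initial M (toList x)) →
                         Accepts M (initial M (toList x)) →
                         ∃ λ z → word z ≡ x × accepts z ≡ true
      accepts-complete x h a with run-complete s (represents-input (toList x)) h a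
      ... | g , p = z , take-++ x y ,
        trans (cong (λ v → run s (inputConfig (toList v)) (guesses z)) (take-++ x y))
          (trans (run-cong s _ λ t → trans (tabulate-cong (λ j → read t j)) (tabulate∘lookup (g t))) p)
        where
        y : Vec Bool (s * w)
        y = tabulate λ i → let (t , j) = remQuot {s} w i in lookup (g t) j
        z = x Vec.++ y
        read : ∀ t j → lookup (Vec.drop m z) (combine t j) ≡ lookup (g t) j
        read t j = trans (cong (λ v → lookup v (combine t j)) (drop-++ x y))
          (trans (lookup∘tabulate _ (combine t j))
            (cong (λ (t , j) → lookup (g t) j) (remQuot-combine {s} t j)))
        run-cong : ∀ s f {g g′ : Fin s → Guess} → (∀ t → g t ≡ g′ t) → run s f g ≡ run s f g′
        run-cong zero    f e = refl
        run-cong (suc s) f {g} {g′} e rewrite e zero =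
          cong (λ r → verdict (_ , (g′ zero , r))) (run-cong s _ (λ t → e (suc t)))

    -- `runCost` is recursive in the time and thus no polynomial expression; charging every step the
    -- price of the most expensive one gives such an expression.
    runBound : ℕ → ℕ
    runBound s = liftCost (bits-× bQ bS) bits-Bool + s * (stepCost s + verdictCost)

    stepCost-mono : ∀ {s t} → s ≤ t → stepCost s ≤ stepCost t
    stepCost-mono s≤t = +-monoʳ-≤ (liftCost bG bQ) (+-monoʳ-≤ cellCost
      (+-mono-≤ (*-monoˡ-≤ cellCost s≤t) (+-mono-≤ (*-monoˡ-≤ cellCost s≤t) ≤-refl)))

    runCost≤runBound : ∀ s → runCost s ≤ runBound s
    runCost≤runBound zero    = m≤m+n _ _
    runCost≤runBound (suc s) = begin
      stepCost s + (runCost s + v)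
        ≤⟨ +-monoʳ-≤ (stepCost s) (+-monoˡ-≤ v (runCost≤runBound s)) ⟩
      stepCost s + (b + s * (stepCost s + v) + v)
        ≡⟨ rearrange (stepCost s) v b (s * (stepCost s + v)) ⟩
      b + (stepCost s + v + s * (stepCost s + v))
        ≤⟨ +-monoʳ-≤ b (*-monoʳ-≤ (suc s) (+-monoˡ-≤ v (stepCost-mono (n≤1+n s)))) ⟩
      b + suc s * (stepCost (suc s) + v) ∎
      where
      open ≤-Reasoning
      open +-*-Solver using (solve; _:=_; _:+_)
      v = verdictCost
      b = liftCost (bits-× bQ bS) bits-Bool
      rearrange : ∀ x v b y → x + (b + y + v) ≡ b + (x + v + y)
      rearrange = solve 4 (λ x v b y → x :+ (b :+ y :+ v) := b :+ (x :+ v :+ y)) refl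

    acceptsBound : ℕ → ℕ
    acceptsBound s = configCost s + runBound s

    acceptsBound-poly : ∀ {f} → IsPolynomial f → IsPolynomial (λ n → acceptsBound (f n))
    acceptsBound-poly f = poly-+
      (poly-+ (poly-const (liftCost (bits-Vec 0) bQ)) (poly-+ (poly-const (liftCost (bits-Vec 0) bS))
        (poly-+ (poly-const symbolCost) (poly-+ (poly-* f (poly-const symbolCost)) (poly-const 0)))))
      (poly-+ (poly-const (liftCost (bits-× bQ bS) bits-Bool)) (poly-* f (poly-+
        (poly-+ (poly-const (liftCost bG bQ)) (poly-+ (poly-const cellCost)
          (poly-+ (poly-* f (poly-const cellCost)) (poly-+ (poly-* f (poly-const cellCost)) (poly-const 0)))))
        (poly-const verdictCost))))

  -- The nonuniform form in which the rest of the proof sees NP: a certificate follows the word, and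
  -- a circuit of polynomial size checks both.
  record Verifier (L : Language) : Set where
    field
      extra bound : ℕ → ℕ
      extra-poly  : IsPolynomial extra
      bound-poly  : IsPolynomial bound
      verify      : ∀ m → Function (m + extra m)
      circuit     : ∀ m → Build (bound m) inputs (Has (verify m))
      correct     : ∀ {m} (x : Vec Bool m) → L (toList x) ⇔ ∃ λ z → Vec.take m z ≡ x × verify m z ≡ true

  verifier : ∀ {L} → NP L → Verifier L
  verifier {L} (M , p , halts , decides) = record
    { extra      = λ m → ⟦ p ⟧ m * w
    ; bound      = λ m → acceptsBound (⟦ p ⟧ m)
    ; extra-poly = poly-* time-poly (poly-const w)
    ; bound-poly = acceptsBound-poly time-poly
    ; verify     = λ m → accepts m (⟦ p ⟧ m)
    ; circuit    = λ m → at-most (+-monoʳ-≤ (configCost (⟦ p ⟧ m)) (runCost≤runBound (⟦ p ⟧ m)))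
                     (build-accepts m (⟦ p ⟧ m))
    ; correct    = λ {m} x → mk⇔
        (λ l → accepts-complete m (⟦ p ⟧ m) x (halts′ x) (to (decides (toList x)) l))
        (λ { (z , refl , a) → from (decides (toList x)) (accepts-sound m (⟦ p ⟧ m) z a) })
    }
    where
    open Machine M
    open Equivalence
    time-poly : IsPolynomial (⟦ p ⟧)
    time-poly = p , λ _ → refl
    halts′ : ∀ {m} (x : Vec Bool m) → HaltsWithin M (⟦ p ⟧ m) (initial M (toList x))
    halts′ x = subst (λ k → HaltsWithin M (⟦ p ⟧ k) (initial M (toList x))) (length-toList x) (halts (toList x))

-- The constant-depth language of computation tableaux.

module Tableau where

  open import Data.Bool.Properties using (∧-identityʳ; ∨-identityʳ)
  open import Data.Fin.Base using (inject≤)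
  open import Data.Fin.Properties as Finₚ using (toℕ-inject≤; toℕ-fromℕ<)
  open import Data.List.Base as List using (foldr)
  open import Data.List.Properties using (length-map)
  open import Data.List.Relation.Unary.All as All using (All; []; _∷_)
  open import Data.Nat.Base using (_+_; _*_; _≤_; _<_; _⊔_; z≤n; s≤s)
  open import Data.Nat.Properties as ℕₚ using (≤-trans; ≤-refl; ≤-reflexive; ⊔-lub; m≤m+n; +-monoˡ-≤; +-mono-≤; m⊔n≤o⇒m≤o; m⊔n≤o⇒n≤o; n≤1+n)
  open import Data.Vec.Base as Vec using (tabulate; drop; fromList)
  open import Data.Vec.Properties using (lookup∘tabulate; tabulate∘lookup; tabulate-cong; lookup-replicate)
  open import Relation.Binary.Definitions using (tri<; tri≈; tri>)

  open import Defs using (Gate; Gates; AND; OR; NOT; []; _∷_; Circuit; evaluate; depth; DecidesSlice; evalGate; wireValues; wireDepths; gateInputs; maxFanIn; Language; AC⁰)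
  open Circuits
  open Polynomials
  open Simulation using (Verifier; lookup-take; lookup-drop)

  open Net

  depths : ∀ {n} (N : Net n) → Vec ℕ (size N + n)
  depths N = wireDepths (gates N)

  record HasWithin {n} (d : ℕ) (f : Function n) (N : Net n) : Set where
    constructor within
    field
      wire    : Fin (size N + n)
      correct : ∀ x → lookup (values N x) wire ≡ f x
      shallow : lookup (depths N) wire ≤ d

  open HasWithin

  within-stable : ∀ {n d} {f : Function n} → Stable (HasWithin d f)
  within-stable refl    h = h
  within-stable (g ∷ e) h with within-stable e h
  ... | within i p q = within (suc i) p q

  within-cong : ∀ {n d} {f g : Function n} {N} → (∀ x → f x ≡ g x) → HasWithin d f N → HasWithin d g N
  within-cong f≗g (within i p q) = within i (λ x → trans (p x) (f≗g x)) q

  weaken : ∀ {n d e} {f : Function n} {N} → d ≤ e → HasWithin d f N → HasWithin e f N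
  weaken d≤e (within i p q) = within i p (≤-trans q d≤e)

  inputWire : ∀ {n} {N : Net n} → inputs ⊑ N → ∀ i → HasWithin 0 (λ x → lookup x i) N
  inputWire e i = within-stable e (within i (λ _ → refl) (≤-reflexive (lookup-replicate i 0)))

  foldr-⊔ : ∀ {A : Set} (h : A → ℕ) {d} {is} → All (λ i → h i ≤ d) is → foldr (λ i → h i ⊔_) 0 is ≤ d
  foldr-⊔ h []       = z≤n
  foldr-⊔ h (p ∷ ps) = ⊔-lub p (foldr-⊔ h ps)

  gateWithin : ∀ {n d} {N : Net n} (g : Gate (size N + n)) → length (gateInputs g) ≤ 2 →
               All (λ i → lookup (depths N) i ≤ d) (gateInputs g) →
               Build 1 N (HasWithin (suc d) (λ x → evalGate g (values N x)))
  gateWithin {N = N} g ≤2 ds = build (g ∷ refl) ≤-refl (⊔-lub ≤2)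
    (within zero (λ _ → refl) (s≤s (foldr-⊔ (lookup (depths N)) ds)))

  _xnor_ : Bool → Bool → Bool
  a xnor b = (a ∧ b) ∨ not (a ∨ b)

  xnor⇒≡ : ∀ a b → a xnor b ≡ true → a ≡ b
  xnor⇒≡ false false _ = refl
  xnor⇒≡ true  true  _ = refl

  xnor-refl : ∀ a → a xnor a ≡ true
  xnor-refl false = refl
  xnor-refl true  = refl

  -- The longest path goes through OR, NOT and OR, three levels on top of depth 1.
  build-xnor : ∀ {n} {f g : Function n} {N : Net n} → HasWithin 1 f N → HasWithin 1 g N →
               Build 4 N (HasWithin 4 (λ x → f x xnor g x))
  build-xnor {f = f} {g} (within i p ip) (within j q jq) =
    map-result (within-cong λ x → cong₂ _∧_ (p x) (trans (∧-identityʳ _) (q x)))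
      (gateWithin (AND (i ∷ j ∷ [])) ≤-refl (ip ∷ jq ∷ [])) >>= λ e₁ both →
    map-result (within-cong λ x → cong₂ _∨_ (correct (within-stable e₁ (within i p ip)) x)
        (trans (∨-identityʳ _) (correct (within-stable e₁ (within j q jq)) x)))
      (gateWithin (OR (wire (within-stable e₁ (within i p ip)) ∷ wire (within-stable e₁ (within j q jq)) ∷ [])) ≤-refl
        (shallow (within-stable e₁ (within i p ip)) ∷ shallow (within-stable e₁ (within j q jq)) ∷ [])) >>= λ e₂ some →
    map-result (within-cong λ x → cong not (correct some x))
      (gateWithin (NOT (wire some)) (s≤s z≤n) (shallow some ∷ [])) >>= λ e₃ none →
    let both′ = weaken (n≤1+n 2) (within-stable (⊑-trans e₂ e₃) both) in
    map-result (within-cong λ x → cong₂ _∨_ (correct both′ x) (trans (∨-identityʳ _) (correct none x)))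
      (gateWithin (OR (wire both′ ∷ wire none ∷ [])) ≤-refl (shallow both′ ∷ shallow none ∷ []))

  mapGate : ∀ {v w} → (Fin v → Fin w) → Gate v → Gate w
  mapGate σ (AND is) = AND (List.map σ is)
  mapGate σ (OR is)  = OR (List.map σ is)
  mapGate σ (NOT i)  = NOT (σ i)

  gateInputs-map : ∀ {v w} (σ : Fin v → Fin w) g → gateInputs (mapGate σ g) ≡ List.map σ (gateInputs g)
  gateInputs-map σ (AND is) = refl
  gateInputs-map σ (OR is)  = refl
  gateInputs-map σ (NOT i)  = refl

  evalGate-map : ∀ {v w} (σ : Fin v → Fin w) g {x y} → (∀ i → lookup y (σ i) ≡ lookup x i) →
                 evalGate (mapGate σ g) y ≡ evalGate g x
  evalGate-map σ (AND is) h = go is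
    where
    go : ∀ is → foldr _ true (List.map σ is) ≡ foldr _ true is
    go []       = refl
    go (i ∷ is) = cong₂ _∧_ (h i) (go is)
  evalGate-map σ (OR is) h = go is
    where
    go : ∀ is → foldr _ false (List.map σ is) ≡ foldr _ false is
    go []       = refl
    go (i ∷ is) = cong₂ _∨_ (h i) (go is)
  evalGate-map σ (NOT i) h = cong not (h i)

  all-map : ∀ {A B : Set} {P : B → Set} (f : A → B) → (∀ a → P (f a)) → ∀ as → All P (List.map f as)
  all-map f h []       = []
  all-map f h (a ∷ as) = h a ∷ all-map f h as

  copyGate : ∀ {n v} {N : Net n} (g : Gate v) → length (gateInputs g) ≤ 2 →
             {x : Vec Bool n → Vec Bool v} → (∀ i → HasWithin 0 (λ z → lookup (x z) i) N) →
             Build 1 N (HasWithin 1 (λ z → evalGate g (x z)))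
  copyGate {N = N} g ≤2 h = map-result (within-cong λ z → evalGate-map (λ i → wire (h i)) g λ i → correct (h i) z)
    (gateWithin (mapGate (λ i → wire (h i)) g)
      (≤-trans (≤-reflexive (trans (cong length (gateInputs-map _ g)) (length-map _ (gateInputs g)))) ≤2)
      (subst (All _) (sym (gateInputs-map _ g)) (all-map _ (λ i → shallow (h i)) (gateInputs g))))

  -- Every gate is checked against the claimed values of its input wires instead of computed ones.
  -- The checks are independent of each other, which is what makes the depth constant whatever the
  -- depth of the verifier.
  consistent : ∀ {n s} → Gates n s → Vec Bool (s + n) → Bool
  consistent []       v       = true
  consistent (g ∷ gs) (b ∷ v) = (b xnor evalGate g v) ∧ consistent gs v

  ∧-true : ∀ {a b} → a ∧ b ≡ true → a ≡ true × b ≡ true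
  ∧-true {true} {true} _ = refl , refl

  consistent-sound : ∀ {n s} (gs : Gates n s) v → consistent gs v ≡ true → wireValues gs (drop s v) ≡ v
  consistent-sound []       v       c = refl
  consistent-sound (g ∷ gs) (b ∷ v) c with ∧-true c
  ... | p , q with consistent-sound gs v q
  ...   | eq = cong₂ _∷_ (trans (cong (evalGate g) eq) (sym (xnor⇒≡ b _ p))) eq

  consistent-complete : ∀ {n s} (gs : Gates n s) x → consistent gs (wireValues gs x) ≡ true
  consistent-complete []       x = refl
  consistent-complete (g ∷ gs) x = cong₂ _∧_ (xnor-refl (evalGate g (wireValues gs x))) (consistent-complete gs x)

  -- The conjunction stays a list of wires while the net is built with fan-in two. A single AND gate
  -- of unbounded fan-in, added outside `Build`, closes it and costs only one level.
  record HasAll {n} (d : ℕ) (f : Function n) (N : Net n) : Set where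
    field
      wires   : List (Fin (size N + n))
      correct : ∀ x → foldr (λ i → lookup (values N x) i ∧_) true wires ≡ f x
      shallow : All (λ i → lookup (depths N) i ≤ d) wires

  open HasAll using (wires)

  addWire : ∀ {n d} {f g : Function n} {N} → HasWithin d f N → HasAll d g N → HasAll d (λ x → f x ∧ g x) N
  addWire h hs = record
    { wires   = wire h ∷ wires hs
    ; correct = λ x → cong₂ _∧_ (correct h x) (HasAll.correct hs x)
    ; shallow = shallow h ∷ HasAll.shallow hs }

  hasAll-cong : ∀ {n d} {f g : Function n} {N} → (∀ x → f x ≡ g x) → HasAll d f N → HasAll d g N
  hasAll-cong f≗g h = record
    { wires = wires h ; correct = λ x → trans (HasAll.correct h x) (f≗g x) ; shallow = HasAll.shallow h }

  hasAll-stable : ∀ {n d} {f : Function n} → Stable (HasAll d f)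
  hasAll-stable refl    h = h
  hasAll-stable {n} {d} (_∷_ {s} {gs} g e) h with hasAll-stable e h
  ... | h′ = record
    { wires   = List.map suc (wires h′)
    ; correct = λ x → trans (shift x (wires h′)) (HasAll.correct h′ x)
    ; shallow = shift-depths (HasAll.shallow h′) }
    where
    shift : ∀ x is → foldr (λ i → lookup (values (net (g ∷ gs)) x) i ∧_) true (List.map suc is)
                   ≡ foldr (λ i → lookup (values (net gs) x) i ∧_) true is
    shift x []       = refl
    shift x (i ∷ is) = cong (lookup (values (net gs) x) i ∧_) (shift x is)
    shift-depths : ∀ {is} → All (λ i → lookup (depths (net gs)) i ≤ d) is →
                   All (λ i → lookup (depths (net (g ∷ gs))) i ≤ d) (List.map suc is)
    shift-depths []       = []
    shift-depths (p ∷ ps) = p ∷ shift-depths ps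

  -- Five gates for each gate checked: one copy of it and four for the comparison.
  build-consistent : ∀ {k n s} (gs : Gates n s) → maxFanIn gs ≤ 2 →
                     {v : Vec Bool k → Vec Bool (s + n)} {N : Net k} → (∀ i → HasWithin 0 (λ u → lookup (v u) i) N) →
                     Build (s * 5) N (HasAll 4 (λ u → consistent gs (v u)))
  build-consistent []       ≤2 h = return record { wires = [] ; correct = λ _ → refl ; shallow = [] }
  build-consistent {k} {n} {suc s} (g ∷ gs) ≤2 {v} {N} h =
    (copyGate g (m⊔n≤o⇒m≤o _ _ ≤2) {x = Vec.tail ∘ v} (tail-wires h) >>= λ e c →
     build-xnor (weaken z≤n (within-stable e (h zero))) c) >>= λ e₁ x →
    keep (build-consistent gs (m⊔n≤o⇒n≤o _ _ ≤2) {v = Vec.tail ∘ v} (λ i → within-stable e₁ (tail-wires h i))) x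
    where
    tail-wires : ∀ {N : Net k} → (∀ i → HasWithin 0 (λ u → lookup (v u) i) N) →
                 ∀ i → HasWithin 0 (λ u → lookup (Vec.tail (v u)) i) N
    tail-wires h i = within-cong (λ u → lookup-tail (v u)) (h (suc i))
      where
      lookup-tail : ∀ (w : Vec Bool (suc s + n)) → lookup w (suc i) ≡ lookup (Vec.tail w) i
      lookup-tail (_ ∷ _) = refl
    keep : ∀ {N : Net k} {c} → Build c N (HasAll 4 (λ u → consistent gs (Vec.tail (v u)))) →
           HasWithin 4 (λ u → lookup (v u) zero xnor evalGate g (Vec.tail (v u))) N →
           Build c N (HasAll 4 (λ u → consistent (g ∷ gs) (v u)))
    keep (build e co na p) x = build e co na (hasAll-cong (λ u → join (v u)) (addWire (within-stable e x) p))
      where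
      join : ∀ (w : Vec Bool (suc s + n)) → (lookup w zero xnor evalGate g (Vec.tail w)) ∧ consistent gs (Vec.tail w) ≡ consistent (g ∷ gs) w
      join (_ ∷ _) = refl

  -- Positions beyond the end read `false`; they become the padding letters of a word.
  pick : ∀ {n} → Vec Bool n → ℕ → Bool
  pick []      k       = false
  pick (b ∷ v) zero    = b
  pick (b ∷ v) (suc k) = pick v k

  falseCircuit : ∀ {n} → Circuit n
  falseCircuit = record { size = 1 ; gates = OR [] ∷ [] ; output = zero }

  -- The words of length m + (extra m + bound m) whose first letters list the
  -- values of all wires of an accepting computation of the verifier (newest gate
  -- first, inputs last); the remaining letters are padding.  The length is
  -- strictly increasing in m, so it determines m.
  module _ {L : Language} (V : Verifier L) where
    open Verifier V hiding (correct)

    wordLength : ℕ → ℕ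
    wordLength m = m + (extra m + bound m)

    module _ (m : ℕ) where

      private
        B   = circuit m
        C   = Build.target B
        out = Build.result B
        s   = size C

      #wires≤ : s + (m + extra m) ≤ wordLength m
      #wires≤ = begin
        s + (m + extra m)             ≤⟨ +-monoˡ-≤ (m + extra m) (Build.cost B) ⟩
        bound m + 0 + (m + extra m)   ≡⟨ cong (_+ (m + extra m)) (ℕₚ.+-identityʳ (bound m)) ⟩
        bound m + (m + extra m)       ≡⟨ ℕₚ.+-comm (bound m) _ ⟩
        m + extra m + bound m         ≡⟨ ℕₚ.+-assoc m _ _ ⟩
        wordLength m                  ∎
        where open ℕₚ.≤-Reasoning

      s≤ : s ≤ wordLength m
      s≤ = ≤-trans (m≤m+n s _) #wires≤

      letter : Fin (s + (m + extra m)) → Fin (wordLength m)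
      letter i = inject≤ i #wires≤

      gather : Vec Bool (wordLength m) → Vec Bool (s + (m + extra m))
      gather u = tabulate λ i → lookup u (letter i)

      scatter : Vec Bool (s + (m + extra m)) → Vec Bool (wordLength m)
      scatter v = tabulate λ k → pick v (toℕ k)

      gather-scatter : ∀ v → gather (scatter v) ≡ v
      gather-scatter v = trans (tabulate-cong λ i → trans (lookup∘tabulate _ (letter i))
          (trans (cong (pick v) (toℕ-inject≤ i #wires≤)) (pick-lookup v i)))
        (tabulate∘lookup v)
        where
        pick-lookup : ∀ {n} (v : Vec Bool n) i → pick v (toℕ i) ≡ lookup v i
        pick-lookup (b ∷ v) zero    = refl
        pick-lookup (b ∷ v) (suc i) = pick-lookup v i

      accepting : Vec Bool (wordLength m) → Bool
      accepting u = lookup (gather u) (Has.wire out) ∧ consistent (gates C) (gather u)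

      inputLetter : Fin m → Fin (wordLength m)
      inputLetter j = letter (s ↑ʳ (j ↑ˡ extra m))

      accepting-correct : (x : Vec Bool m) → L (toList x) ⇔
                          ∃ λ u → accepting u ≡ true × (∀ j → lookup u (inputLetter j) ≡ lookup x j)
      accepting-correct x = mk⇔ there back
        where
        open Equivalence
        drop-wireValues : ∀ {n s} (gs : Gates n s) x → drop s (wireValues gs x) ≡ x
        drop-wireValues []       x = refl
        drop-wireValues (g ∷ gs) x = drop-wireValues gs x
        input-letter : ∀ u j → lookup u (inputLetter j) ≡ lookup (Vec.take m (drop s (gather u))) j
        input-letter u j = trans (sym (lookup∘tabulate _ (s ↑ʳ (j ↑ˡ extra m))))
          (trans (lookup-drop s (gather u) (j ↑ˡ extra m)) (lookup-take (drop s (gather u)) j))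
        there : L (toList x) → ∃ λ u → accepting u ≡ true × (∀ j → lookup u (inputLetter j) ≡ lookup x j)
        there l with to (Verifier.correct V x) l
        ... | z , refl , p = u , accepted , λ j → trans (input-letter u j)
            (cong (λ v → lookup (Vec.take m v) j) (trans (cong (drop s) (gather-scatter v)) (drop-wireValues (gates C) z)))
          where
          v = values C z
          u = scatter v
          accepted : accepting u ≡ true
          accepted rewrite gather-scatter v = cong₂ _∧_ (trans (Has.correct out z) p) (consistent-complete (gates C) z)
        back : (∃ λ u → accepting u ≡ true × (∀ j → lookup u (inputLetter j) ≡ lookup x j)) → L (toList x)
        back (u , a , h) with ∧-true {lookup (gather u) (Has.wire out)} a
        ... | o , c = from (Verifier.correct V x) (z , vec-ext (λ j → trans (sym (input-letter u j)) (h j)) ,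
            trans (sym (Has.correct out z)) (trans (cong (λ v → lookup v (Has.wire out)) (consistent-sound (gates C) (gather u) c)) o))
          where
          z = drop s (gather u)
          vec-ext : ∀ {n} {a b : Vec Bool n} → (∀ j → lookup a j ≡ lookup b j) → a ≡ b
          vec-ext {a = a} {b} h = trans (sym (tabulate∘lookup a)) (trans (tabulate-cong h) (tabulate∘lookup b))

      build-accepting : Build (s * 5) inputs (HasAll 4 accepting)
      build-accepting with build-consistent (gates C) (Build.narrow B z≤n) {v = gather} {N = inputs}
                             (λ i → within-cong (λ u → sym (lookup∘tabulate _ i)) (inputWire refl (letter i)))
      ... | build e co na p = build e co na (addWire
        (weaken z≤n (within-cong (λ u → sym (lookup∘tabulate _ (Has.wire out))) (inputWire e (letter (Has.wire out))))) p)

      acceptingCircuit : Circuit (wordLength m)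
      acceptingCircuit = let build {N} _ _ _ p = build-accepting in
        record { size = suc (size N) ; gates = AND (wires p) ∷ gates N ; output = zero }

      acceptingCircuit-correct : ∀ u → evaluate acceptingCircuit u ≡ accepting u
      acceptingCircuit-correct = HasAll.correct (Build.result build-accepting)

      acceptingCircuit-depth : depth acceptingCircuit ≤ 5
      acceptingCircuit-depth = s≤s (foldr-⊔ (lookup (depths (Build.target build-accepting)))
        (HasAll.shallow (Build.result build-accepting)))

      acceptingCircuit-size : Circuit.size acceptingCircuit ≤ 1 + wordLength m * 5
      acceptingCircuit-size = s≤s (≤-trans (Build.cost build-accepting)
        (≤-trans (≤-reflexive (ℕₚ.+-identityʳ (s * 5))) (ℕₚ.*-monoˡ-≤ 5 s≤)))

    wordLength-mono : ∀ {m n} → m < n → wordLength m < wordLength n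
    wordLength-mono m<n = ℕₚ.+-mono-<-≤ m<n (+-mono-≤ (mono extra-poly (ℕₚ.<⇒≤ m<n)) (mono bound-poly (ℕₚ.<⇒≤ m<n)))

    wordLength-injective : ∀ {m n} → wordLength m ≡ wordLength n → m ≡ n
    wordLength-injective {m} {n} eq with ℕₚ.<-cmp m n
    ... | tri< m<n _ _ = contradiction eq (ℕₚ.<⇒≢ (wordLength-mono m<n))
    ... | tri≈ _ m≡n _ = m≡n
    ... | tri> _ _ m>n = contradiction (sym eq) (ℕₚ.<⇒≢ (wordLength-mono m>n))

    wordLength-poly : IsPolynomial wordLength
    wordLength-poly = poly-+ poly-id (poly-+ extra-poly bound-poly)

    -- Since `wordLength k` is at least `k`, only the `k` up to `ℓ` can qualify.
    hasLength? : ∀ ℓ → Dec (∃ λ (k : Fin (suc ℓ)) → wordLength (toℕ k) ≡ ℓ)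
    hasLength? ℓ = Finₚ.any? λ k → wordLength (toℕ k) ℕₚ.≟ ℓ

    circuitFor : ∀ {ℓ} → Dec (∃ λ (k : Fin (suc ℓ)) → wordLength (toℕ k) ≡ ℓ) → Circuit ℓ
    circuitFor (yes (k , eq)) = subst Circuit eq (acceptingCircuit (toℕ k))
    circuitFor (no  _)        = falseCircuit

    wordCircuit : ∀ ℓ → Circuit ℓ
    wordCircuit ℓ = circuitFor (hasLength? ℓ)

    wordCircuit-wordLength : ∀ m → wordCircuit (wordLength m) ≡ acceptingCircuit m
    wordCircuit-wordLength m with hasLength? (wordLength m)
    ... | yes (k , eq) = unique (wordLength-injective eq) eq
      where
      unique : ∀ {k} → k ≡ m → (eq : wordLength k ≡ wordLength m) → subst Circuit eq (acceptingCircuit k) ≡ acceptingCircuit m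
      unique refl refl = refl
    ... | no none = contradiction
      ( fromℕ< (s≤s (m≤m+n m (extra m + bound m)))
      , cong wordLength (toℕ-fromℕ< (s≤s (m≤m+n m (extra m + bound m)))) ) none

    Words : Language
    Words u = evaluate (wordCircuit (length u)) (fromList u) ≡ true

    words-decided : ∀ ℓ → DecidesSlice (wordCircuit ℓ) Words
    words-decided ℓ u = at-toList (λ k v → evaluate (wordCircuit k) v ≡ true) u
      where
      at-toList : ∀ {ℓ} (P : ∀ k → Vec Bool k → Set) (u : Vec Bool ℓ) → P (length (toList u)) (fromList (toList u)) ⇔ P ℓ u
      at-toList P []      = mk⇔ id id
      at-toList P (b ∷ u) = at-toList (λ k v → P (suc k) (b ∷ v)) u

    transport : ∀ {a b} (P : ∀ n → Circuit n → Set) (eq : a ≡ b) {C} → P a C → P b (subst Circuit eq C)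
    transport P refl p = p

    circuitFor-size : ∀ {ℓ} (d : Dec (∃ λ (k : Fin (suc ℓ)) → wordLength (toℕ k) ≡ ℓ)) → Circuit.size (circuitFor d) ≤ 1 + ℓ * 5
    circuitFor-size (yes (k , eq))   = transport (λ n C → Circuit.size C ≤ 1 + n * 5) eq (acceptingCircuit-size (toℕ k))
    circuitFor-size (no _)           = s≤s z≤n

    circuitFor-depth : ∀ {ℓ} (d : Dec (∃ λ (k : Fin (suc ℓ)) → wordLength (toℕ k) ≡ ℓ)) → depth (circuitFor d) ≤ 5
    circuitFor-depth (yes (k , eq))   = transport (λ _ C → depth C ≤ 5) eq (acceptingCircuit-depth (toℕ k))
    circuitFor-depth (no _)           = s≤s z≤n

    words∈AC⁰ : AC⁰ Words
    words∈AC⁰ with p , hp ← poly-+ (poly-const 1) (poly-* poly-id (poly-const 5)) = p , 5 , λ ℓ →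
      wordCircuit ℓ , ≤-trans (circuitFor-size (hasLength? ℓ)) (≤-reflexive (sym (hp ℓ))) , circuitFor-depth (hasLength? ℓ) , words-decided ℓ

    accepting⇔Words : ∀ m u → accepting m u ≡ true ⇔ Words (toList u)
    accepting⇔Words m u = mk⇔
      (λ a → from (words-decided (wordLength m) u) (trans same a))
      (λ w → trans (sym same) (to (words-decided (wordLength m) u) w))
      where
      open Equivalence
      same : evaluate (wordCircuit (wordLength m)) u ≡ accepting m u
      same = trans (cong (λ C → evaluate C u) (wordCircuit-wordLength m)) (acceptingCircuit-correct m u)

-- The perceptron algorithm over the integers.

module Perceptron where

  import Data.Bool.Properties as Boolₚ
  open import Data.Integer.Base hiding (suc)
  open import Data.Integer.Properties using (≤-refl; ≤-trans; ≤-reflexive; <⇒≤; ≰⇒>; i<j⇒suc[i]≤j; i≤i+j; i≤j+i; +-mono-≤; +-monoˡ-≤; +-monoʳ-≤; +-identityʳ; pos-*; *-distribˡ-+; _≤?_; +-*-semiring; module ≤-Reasoning)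
  open import Data.Integer.Solver using (module +-*-Solver)
  open import Data.List.Relation.Unary.All as All using (All; []; _∷_)
  open import Data.Maybe.Base using (Maybe; just; nothing)
  import Data.Nat.Base as ℕ
  import Data.Nat.Properties as ℕₚ
  open import Relation.Nullary.Decidable using (⌊_⌋)
  open import Algebra.Properties.Semiring.Sum +-*-semiring using (sum; sum-cong-≗; ∑-distrib-+)

  +-cancelʳ-≤ : ∀ k {i j} → i + k ≤ j + k → i ≤ j
  +-cancelʳ-≤ k {i} {j} h = subst₂ _≤_ (back i) (back j) (+-monoˡ-≤ (- k) h)
    where
    open +-*-Solver using (solve; _:=_; _:+_; :-_)
    back : ∀ i → i + k + - k ≡ i
    back i = solve 2 (λ i k → i :+ k :+ :- k := i) refl i k

  Weights : ℕ → Set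
  Weights k = Fin k → ℤ

  infix 8 _∙_

  _∙_ : ∀ {k} → Weights k → Weights k → ℤ
  a ∙ b = sum λ i → a i * b i

  _⊕ʷ_ _⊖ʷ_ : ∀ {k} → Weights k → Weights k → Weights k
  (a ⊕ʷ b) i = a i + b i
  (a ⊖ʷ b) i = a i - b i

  sum-mono : ∀ {k} {f g : Weights k} → (∀ i → f i ≤ g i) → sum f ≤ sum g
  sum-mono {zero}  h = ≤-refl
  sum-mono {suc k} h = +-mono-≤ (h zero) (sum-mono (h ∘ suc))

  sum-nonneg : ∀ {k} {f : Weights k} → (∀ i → 0ℤ ≤ f i) → 0ℤ ≤ sum f
  sum-nonneg {zero}  h = ≤-refl
  sum-nonneg {suc k} h = +-mono-≤ (h zero) (sum-nonneg (h ∘ suc))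

  square-nonneg : ∀ i → 0ℤ ≤ i * i
  square-nonneg (+ n)    = subst (0ℤ ≤_) (pos-* n n) (+≤+ ℕ.z≤n)
  square-nonneg -[1+ n ] = +≤+ ℕ.z≤n

  ∙-self-nonneg : ∀ {k} (a : Weights k) → 0ℤ ≤ a ∙ a
  ∙-self-nonneg a = sum-nonneg λ i → square-nonneg (a i)

  ∙-⊕ʳ : ∀ {k} (a b c : Weights k) → a ∙ (b ⊕ʷ c) ≡ a ∙ b + a ∙ c
  ∙-⊕ʳ a b c = trans (sum-cong-≗ λ i → *-distribˡ-+ (a i) (b i) (c i)) (∑-distrib-+ (λ i → a i * b i) (λ i → a i * c i))

  -- The law of cosines, written without subtraction outside the squares. It measures how one update
  -- by `v` changes the squared distance to `c`.
  ∙-square : ∀ {k} (u v c : Weights k) →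
    ((u ⊕ʷ v) ⊖ʷ c) ∙ ((u ⊕ʷ v) ⊖ʷ c) + (v ∙ c + v ∙ c) ≡ (u ⊖ʷ c) ∙ (u ⊖ʷ c) + (v ∙ u + v ∙ u + v ∙ v)
  ∙-square {zero}  u v c = refl
  ∙-square {suc k} u v c = begin
    (X + R) + ((P + S) + (P + S))  ≡⟨ shuffle₁ X R P S ⟩
    (X + (P + P)) + (R + (S + S))  ≡⟨ cong₂ _+_ (square (u zero) (v zero) (c zero)) (∙-square (u ∘ suc) (v ∘ suc) (c ∘ suc)) ⟩
    (X′ + (P′ + P′ + Y)) + (R′ + (S′ + S′ + Y′)) ≡⟨ shuffle₂ X′ P′ Y R′ S′ Y′ ⟩
    (X′ + R′) + ((P′ + S′) + (P′ + S′) + (Y + Y′)) ∎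
    where
    open ≡-Reasoning
    open +-*-Solver using (solve; _:=_; _:+_; _:*_; _:-_)
    X  = (u zero + v zero - c zero) * (u zero + v zero - c zero)
    X′ = (u zero - c zero) * (u zero - c zero)
    P  = v zero * c zero
    P′ = v zero * u zero
    Y  = v zero * v zero
    R  = (((u ∘ suc) ⊕ʷ (v ∘ suc)) ⊖ʷ (c ∘ suc)) ∙ (((u ∘ suc) ⊕ʷ (v ∘ suc)) ⊖ʷ (c ∘ suc))
    R′ = ((u ∘ suc) ⊖ʷ (c ∘ suc)) ∙ ((u ∘ suc) ⊖ʷ (c ∘ suc))
    S  = (v ∘ suc) ∙ (c ∘ suc)
    S′ = (v ∘ suc) ∙ (u ∘ suc)
    Y′ = (v ∘ suc) ∙ (v ∘ suc)
    square : ∀ u v c → (u + v - c) * (u + v - c) + (v * c + v * c) ≡ (u - c) * (u - c) + (v * u + v * u + v * v)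
    square = solve 3 (λ u v c → (u :+ v :- c) :* (u :+ v :- c) :+ (v :* c :+ v :* c)
                       := (u :- c) :* (u :- c) :+ (v :* u :+ v :* u :+ v :* v)) refl
    shuffle₁ : ∀ x r p s → (x + r) + ((p + s) + (p + s)) ≡ (x + (p + p)) + (r + (s + s))
    shuffle₁ = solve 4 (λ x r p s → (x :+ r) :+ ((p :+ s) :+ (p :+ s)) := (x :+ (p :+ p)) :+ (r :+ (s :+ s))) refl
    shuffle₂ : ∀ x p y r s z → (x + (p + p + y)) + (r + (s + s + z)) ≡ (x + r) + ((p + s) + (p + s) + (y + z))
    shuffle₂ = solve 6 (λ x p y r s z → (x :+ (p :+ p :+ y)) :+ (r :+ (s :+ s :+ z))
                         := (x :+ r) :+ ((p :+ s) :+ (p :+ s) :+ (y :+ z))) refl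

  -- The guard is the only channel through which the input acts on the system: coefficients and
  -- thresholds are the same for all inputs of a length.
  record Row (k m : ℕ) : Set where
    field
      coefficients : Weights k
      threshold    : ℤ
      guard        : Maybe (Fin m × Bool)

  open Row public

  module _ {k m : ℕ} where

    active : Row k m → Vec Bool m → Bool
    active ρ x with guard ρ
    ... | nothing      = true
    ... | just (l , b) = ⌊ lookup x l Boolₚ.≟ b ⌋

    Satisfied : Vec Bool m → Weights k → Row k m → Set
    Satisfied x C ρ = active ρ x ≡ true → threshold ρ ≤ coefficients ρ ∙ C

    violated : Vec Bool m → Weights k → Row k m → Bool
    violated x C ρ = active ρ x ∧ not ⌊ threshold ρ ≤? coefficients ρ ∙ C ⌋

    unviolated : ∀ x C ρ → violated x C ρ ≡ false → Satisfied x C ρ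
    unviolated x C ρ v a with active ρ x | threshold ρ ≤? coefficients ρ ∙ C
    ... | true | yes p = p

    update : Vec Bool m → Row k m → Weights k → Weights k
    update x ρ C = if violated x C ρ then C ⊕ʷ coefficients ρ else C

    sweep : Vec Bool m → List (Row k m) → Weights k → Weights k
    sweep x []       C = C
    sweep x (ρ ∷ ρs) C = sweep x ρs (update x ρ C)

    sweeps : ℕ → Vec Bool m → List (Row k m) → Weights k → Weights k
    sweeps zero    x ρs C = C
    sweeps (suc t) x ρs C = sweeps t x ρs (sweep x ρs C)

    settled : Vec Bool m → List (Row k m) → Weights k → Bool
    settled x []       C = true
    settled x (ρ ∷ ρs) C = not (violated x C ρ) ∧ settled x ρs C

    settled⇒satisfied : ∀ x ρs C → settled x ρs C ≡ true → All (Satisfied x C) ρs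
    settled⇒satisfied x []       C _ = []
    settled⇒satisfied x (ρ ∷ ρs) C s with violated x C ρ in eq
    ... | false = unviolated x C ρ eq ∷ settled⇒satisfied x ρs C s

    sweep-settled : ∀ x ρs C → settled x ρs C ≡ true → sweep x ρs C ≡ C
    sweep-settled x []       C _ = refl
    sweep-settled x (ρ ∷ ρs) C s with violated x C ρ
    ... | false = sweep-settled x ρs C s

    sweeps-settled : ∀ t x ρs C → settled x ρs C ≡ true → sweeps t x ρs C ≡ C
    sweeps-settled zero    x ρs C s = refl
    sweeps-settled (suc t) x ρs C s rewrite sweep-settled x ρs C s = sweeps-settled t x ρs C s

    -- The squared distance to a target that meets every active row with margin S
    -- drops whenever a violated row is added.
    module _ (x : Vec Bool m) (S : ℕ) (target : Weights k) where

      Margin : Row k m → Set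
      Margin ρ = coefficients ρ ∙ coefficients ρ ≤ + S ×
                 (active ρ x ≡ true → threshold ρ + + S ≤ coefficients ρ ∙ target)

      distance : Weights k → ℤ
      distance C = (C ⊖ʷ target) ∙ (C ⊖ʷ target)

      distance-update : ∀ ρ C → Margin ρ → violated x C ρ ≡ true → distance (C ⊕ʷ coefficients ρ) + 1ℤ ≤ distance C
      distance-update ρ C (small , margin) v with active ρ x | threshold ρ ≤? coefficients ρ ∙ C
      ... | true | no θ≰ = +-cancelʳ-≤ (d + d) (begin
        D′ + 1ℤ + (d + d)                      ≡⟨ shuffle₁ D′ d ⟩
        D′ + (d + d) + 1ℤ                      ≡⟨ cong (_+ 1ℤ) (∙-square C a target) ⟩
        D + (e + e + s) + 1ℤ                   ≤⟨ +-monoˡ-≤ 1ℤ (+-monoʳ-≤ D (+-monoʳ-≤ (e + e) small)) ⟩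
        D + (e + e + + S) + 1ℤ                 ≡⟨ shuffle₂ D e (+ S) ⟩
        D + (e + (1ℤ + e + + S))               ≤⟨ +-monoʳ-≤ D (+-mono-≤ e≤d (≤-trans (+-monoˡ-≤ (+ S) (i<j⇒suc[i]≤j (≰⇒> θ≰))) (margin refl))) ⟩
        D + (d + d)                            ∎)
        where
        open ≤-Reasoning
        open +-*-Solver using (solve; _:=_; _:+_; con)
        a  = coefficients ρ
        D  = distance C
        D′ = distance (C ⊕ʷ a)
        d  = a ∙ target
        e  = a ∙ C
        s  = a ∙ a
        e≤d : e ≤ d
        e≤d = ≤-trans (<⇒≤ (≰⇒> θ≰)) (≤-trans (i≤i+j (threshold ρ) (+ S)) (margin refl))
        shuffle₁ : ∀ x d → x + 1ℤ + (d + d) ≡ x + (d + d) + 1ℤ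
        shuffle₁ = solve 2 (λ x d → x :+ con 1ℤ :+ (d :+ d) := x :+ (d :+ d) :+ con 1ℤ) refl
        shuffle₂ : ∀ x e s → x + (e + e + s) + 1ℤ ≡ x + (e + (1ℤ + e + s))
        shuffle₂ = solve 3 (λ x e s → x :+ (e :+ e :+ s) :+ con 1ℤ := x :+ (e :+ (con 1ℤ :+ e :+ s))) refl

      -- The first violated row of a sweep already brings the distance down by one, and the updates
      -- after it never raise it again.
      distance-sweep : ∀ ρs C → All Margin ρs → distance (sweep x ρs C) ≤ distance C ×
                       (settled x ρs C ≡ true ⊎ distance (sweep x ρs C) + 1ℤ ≤ distance C)
      distance-sweep []       C []       = ≤-refl , inj₁ refl
      distance-sweep (ρ ∷ ρs) C (p ∷ ps) with violated x C ρ in eq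
      ... | false = distance-sweep ρs C ps
      ... | true  = ≤-trans (i≤i+j _ 1ℤ) drop , inj₂ drop
        where
        drop : distance (sweep x ρs (C ⊕ʷ coefficients ρ)) + 1ℤ ≤ distance C
        drop = ≤-trans (+-monoˡ-≤ 1ℤ (proj₁ (distance-sweep ρs _ ps))) (distance-update ρ C p eq)

      distance-sweeps : ∀ t ρs C → All Margin ρs →
                        settled x ρs (sweeps t x ρs C) ≡ true ⊎ distance (sweeps t x ρs C) + + t ≤ distance C
      distance-sweeps zero    ρs C ps = inj₂ (≤-reflexive (+-identityʳ _))
      distance-sweeps (suc t) ρs C ps with proj₂ (distance-sweep ρs C ps)
      ... | inj₁ s rewrite sweep-settled x ρs C s | sweeps-settled t x ρs C s = inj₁ s
      ... | inj₂ drop with distance-sweeps t ρs (sweep x ρs C) ps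
      ...   | inj₁ s  = inj₁ s
      ...   | inj₂ le = inj₂ (≤-trans (≤-reflexive (shuffle (distance (sweeps t x ρs (sweep x ρs C))) (+ t))) (≤-trans (+-monoˡ-≤ 1ℤ le) drop))
        where
        open +-*-Solver using (solve; _:=_; _:+_; con)
        shuffle : ∀ d t → d + (1ℤ + t) ≡ d + t + 1ℤ
        shuffle = solve 2 (λ d t → d :+ (con 1ℤ :+ t) := d :+ t :+ con 1ℤ) refl

      -- From the zero vector the squared distance starts at `target ∙ target`; losing a unit in
      -- each of `R + 1` sweeps would make it negative.
      settles : ∀ {R} ρs → All Margin ρs → target ∙ target ≤ + R →
                settled x ρs (sweeps (suc R) x ρs (λ _ → 0ℤ)) ≡ true
      settles {R} ρs ps small with distance-sweeps (suc R) ρs (λ _ → 0ℤ) ps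
      ... | inj₁ s  = s
      ... | inj₂ le = contradiction (begin
        + suc R                                   ≤⟨ i≤j+i (+ suc R) _ {{nonNegative (∙-self-nonneg (C ⊖ʷ target))}} ⟩
        distance C + + suc R                      ≤⟨ le ⟩
        distance (λ _ → 0ℤ)                       ≡⟨ sum-cong-≗ (λ i → negate (target i)) ⟩
        target ∙ target                           ≤⟨ small ⟩
        + R                                       ∎) (λ { (+≤+ h) → ℕₚ.<-irrefl refl h })
        where
        open ≤-Reasoning
        open +-*-Solver using (solve; _:=_; _:-_; _:*_; con)
        C = sweeps (suc R) x ρs (λ _ → 0ℤ)
        negate : ∀ a → (0ℤ - a) * (0ℤ - a) ≡ a * a
        negate = solve 1 (λ a → (con 0ℤ :- a) :* (con 0ℤ :- a) := a :* a) refl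

-- A polynomial-size circuit running the perceptron.

module Separation where

  import Data.Bool.Properties as Boolₚ
  open import Data.Fin.Properties using (toℕ-fromℕ<)
  open import Data.Integer.Base hiding (suc)
  open import Data.Integer.Properties
    using (≤-refl; ≤-trans; ≤-reflexive; ≰⇒>; <⇒≱; +-mono-≤; +-mono-<; +-monoˡ-≤; +-monoʳ-≤; _≤?_; ∣i+j∣≤∣i∣+∣j∣; +-*-semiring; *-zeroʳ; drop‿+≤+; i<j⇒suc[i]≤j; module ≤-Reasoning)
  open import Data.Integer.Solver using (module +-*-Solver)
  open import Data.Nat.Solver renaming (module +-*-Solver to ℕ-Solver)
  open import Data.List.Relation.Unary.All as All using ([]; _∷_)
  open import Data.List.Relation.Unary.Any using (here; there)
  open import Data.List.Membership.Propositional using (_∈_)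
  open import Data.Maybe.Base using (just; nothing)
  import Data.Nat.Base as ℕ
  import Data.Nat.Properties as ℕₚ
  open import Relation.Nullary.Decidable using (⌊_⌋; dec-true; dec-false; isYes≗does; does-⇔)
  open import Algebra.Properties.Semiring.Sum +-*-semiring using (sum; sum-cong-≗; sum-replicate-zero; ∑-distrib-+)

  open Circuits
  open Perceptron

  ∣∣-bound : ∀ {i n} → - + n ≤ i → i ≤ + n → ∣ i ∣ ℕ.≤ n
  ∣∣-bound {+ i}      l u = drop‿+≤+ u
  ∣∣-bound { -[1+ i ]} {suc n} (-≤- l) u = ℕ.s≤s l

  ∣∣-lower : ∀ {i n} → ∣ i ∣ ℕ.≤ n → - + n ≤ i
  ∣∣-lower {+ i}      {zero}  h = +≤+ ℕ.z≤n
  ∣∣-lower {+ i}      {suc n} h = -≤+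
  ∣∣-lower { -[1+ i ]} {suc n} (ℕ.s≤s h) = -≤- h

  ∣∣-upper : ∀ {i n} → ∣ i ∣ ℕ.≤ n → i ≤ + n
  ∣∣-upper {+ i}       h = +≤+ h
  ∣∣-upper { -[1+ i ]} h = -≤+

  +-double : ∀ {i j} → i + i ≤ j + j → i ≤ j
  +-double {i} {j} h with i ≤? j
  ... | yes p = p
  ... | no ¬p = contradiction h (<⇒≱ (+-mono-< (≰⇒> ¬p) (≰⇒> ¬p)))

  -- Instead of the Cauchy-Schwarz inequality, the nonnegativity of the squares of `x - y` and
  -- `x + y` in each coordinate is enough, as both norms have the same bound.
  ∙-bound : ∀ {k} (a b : Weights k) {S} → a ∙ a ≤ + S → b ∙ b ≤ + S → ∣ a ∙ b ∣ ℕ.≤ S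
  ∙-bound a b {S} a≤ b≤ = ∣∣-bound (+-double {j = a ∙ b} lower) (+-double {a ∙ b} upper)
    where
    open ≤-Reasoning
    open +-*-Solver using (solve; _:=_; _:+_; _:*_; _:-_; :-_; con)
    P = λ i → a i * b i
    A = λ i → a i * a i
    B = λ i → b i * b i
    0≤minus : ∀ x y → (x - y) * (x - y) + (x * y + x * y) ≡ x * x + y * y
    0≤minus = solve 2 (λ x y → (x :- y) :* (x :- y) :+ (x :* y :+ x :* y) := x :* x :+ y :* y) refl
    0≤plus : ∀ x y → (x + y) * (x + y) ≡ (x * y + x * y) + (x * x + y * y)
    0≤plus = solve 2 (λ x y → (x :+ y) :* (x :+ y) := (x :* y :+ x :* y) :+ (x :* x :+ y :* y)) refl
    upper : a ∙ b + a ∙ b ≤ + S + + S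
    upper = begin
      sum P + sum P            ≡⟨ sym (∑-distrib-+ P P) ⟩
      sum (λ i → P i + P i)    ≤⟨ sum-mono (λ i → subst (P i + P i ≤_) (0≤minus (a i) (b i)) (0+≤ (square-nonneg (a i - b i)))) ⟩
      sum (λ i → A i + B i)    ≡⟨ ∑-distrib-+ A B ⟩
      sum A + sum B            ≤⟨ +-mono-≤ a≤ b≤ ⟩
      + S + + S                ∎
      where
      0+≤ : ∀ {i j} → 0ℤ ≤ i → j ≤ i + j
      0+≤ {i} {j} h = subst (_≤ i + j) (solve 1 (λ j → con 0ℤ :+ j := j) refl j) (+-monoˡ-≤ j h)
    lower : - + S + - + S ≤ a ∙ b + a ∙ b
    lower = +-cancelʳ-≤ (+ S + + S) (begin
      - + S + - + S + (+ S + + S)              ≡⟨ solve 1 (λ s → :- s :+ :- s :+ (s :+ s) := con 0ℤ) refl (+ S) ⟩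
      0ℤ                                       ≤⟨ sum-nonneg (λ i → subst (0ℤ ≤_) (0≤plus (a i) (b i)) (square-nonneg (a i + b i))) ⟩
      sum (λ i → (P i + P i) + (A i + B i))    ≡⟨ ∑-distrib-+ (λ i → P i + P i) (λ i → A i + B i) ⟩
      sum (λ i → P i + P i) + sum (λ i → A i + B i) ≡⟨ cong₂ _+_ (∑-distrib-+ P P) (∑-distrib-+ A B) ⟩
      (sum P + sum P) + (sum A + sum B)        ≤⟨ +-monoʳ-≤ (sum P + sum P) (+-mono-≤ a≤ b≤) ⟩
      (sum P + sum P) + (+ S + + S)            ∎)

  _≤ᵇᶻ_ : ℤ → ℤ → Bool
  θ ≤ᵇᶻ i = ⌊ θ ≤? i ⌋

  ≤ᵇᶻ-true : ∀ {θ i} → θ ≤ i → θ ≤ᵇᶻ i ≡ true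
  ≤ᵇᶻ-true {θ} {i} h = trans (isYes≗does (θ ≤? i)) (dec-true (θ ≤? i) h)

  ≤ᵇᶻ-false : ∀ {θ i} → ¬ θ ≤ i → θ ≤ᵇᶻ i ≡ false
  ≤ᵇᶻ-false {θ} {i} h = trans (isYes≗does (θ ≤? i)) (dec-false (θ ≤? i) h)

  ≤ᵇᶻ-⇔ : ∀ {θ i θ′ i′} → θ ≤ i ⇔ θ′ ≤ i′ → θ ≤ᵇᶻ i ≡ θ′ ≤ᵇᶻ i′
  ≤ᵇᶻ-⇔ {θ} {i} {θ′} {i′} h =
    trans (isYes≗does (θ ≤? i)) (trans (does-⇔ h (θ ≤? i) (θ′ ≤? i′)) (sym (isYes≗does (θ′ ≤? i′))))

  ≤ᵇᶻ-shift : ∀ θ c d → (θ - c) ≤ᵇᶻ d ≡ θ ≤ᵇᶻ (d + c)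
  ≤ᵇᶻ-shift θ c d = ≤ᵇᶻ-⇔ (mk⇔
    (λ h → subst (_≤ d + c) (solve 2 (λ θ c → θ :- c :+ c := θ) refl θ c) (+-monoˡ-≤ c h))
    (λ h → subst (θ - c ≤_) (solve 2 (λ d c → d :+ c :- c := d) refl d c) (+-monoˡ-≤ (- c) h)))
    where open +-*-Solver using (solve; _:=_; _:+_; _:-_)

  -- An integer is carried by the wires that compare it with every threshold;
  -- for a bounded integer all but finitely many of these are constants.
  Thermometer : ∀ {n} → (Vec Bool n → ℤ) → Net n → Set
  Thermometer g N = ∀ θ → Has (λ x → θ ≤ᵇᶻ g x) N

  thermometer-stable : ∀ {n} {g : Vec Bool n → ℤ} → Stable (Thermometer g)
  thermometer-stable e h θ = has-stable e (h θ)

  thermometerCost : ℕ → ℕ → ℕ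
  thermometerCost B c = 1 ℕ.+ (1 ℕ.+ ((B ℕ.+ B) ℕ.* c ℕ.+ 0))

  build-thermometer : ∀ {n c B} {g : Vec Bool n → ℤ} {N : Net n} → (∀ x → ∣ g x ∣ ℕ.≤ B) →
                      (∀ θ {N′} → N ⊑ N′ → Build c N′ (Has (λ x → θ ≤ᵇᶻ g x))) →
                      Build (thermometerCost B c) N (Thermometer g)
  build-thermometer {n} {B = B} {g} bounded mk =
    constant true >>= λ e₁ tt →
    constant false >>= λ e₂ ff →
    forFin {k = B ℕ.+ B} (λ _ → has-stable)
      -- The thresholds from `1 - B` to `B`; a lower one is always met and a higher one never.
      (λ i e → mk (+ suc (toℕ i) - + B) (⊑-trans e₁ (⊑-trans e₂ e))) >>= λ e₃ ws →
    return (everywhere (has-stable (⊑-trans e₂ e₃) tt) (has-stable e₃ ff) ws)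
    where
    open +-*-Solver using (solve; _:=_; _:+_; _:-_; :-_)
    everywhere : ∀ {N : Net n} → Has (λ _ → true) N → Has (λ _ → false) N →
                 (∀ (i : Fin (B ℕ.+ B)) → Has (λ x → (+ suc (toℕ i) - + B) ≤ᵇᶻ g x) N) → Thermometer g N
    everywhere {N} tt ff ws θ with θ ≤? - + B
    ... | yes low = has-cong (λ x → sym (≤ᵇᶻ-true (≤-trans low (∣∣-lower (bounded x))))) tt
    ... | no θ≰-B with θ ≤? + B
    ...   | no θ≰B = has-cong (λ x → sym (≤ᵇᶻ-false λ θ≤ → θ≰B (≤-trans θ≤ (∣∣-upper (bounded x))))) ff
    ...   | yes θ≤B = inside (θ + + B) refl (+-monoˡ-≤ (+ B) (i<j⇒suc[i]≤j (≰⇒> θ≰-B))) (+-monoˡ-≤ (+ B) θ≤B)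
      where
      inside : ∀ k → θ + + B ≡ k → 1ℤ + - + B + + B ≤ k → k ≤ + B + + B → Has (λ x → θ ≤ᵇᶻ g x) N
      inside k eq l u with subst (_≤ k) (solve 2 (λ o b → o :+ :- b :+ b := o) refl 1ℤ (+ B)) l
      inside (+ suc i) eq l u | _ = subst (λ θ → Has (λ x → θ ≤ᵇᶻ g x) N)
        (trans (cong (λ j → + suc j - + B) (toℕ-fromℕ< (drop‿+≤+ u))) (trans (cong (_- + B) (sym eq))
          (solve 2 (λ θ b → θ :+ b :- b := θ) refl θ (+ B))))
        (ws (fromℕ< (drop‿+≤+ u)))
      inside (+ zero) eq l u | +≤+ ()

  module _ {k m : ℕ} (rows : List (Row k m)) (S : ℕ)
           (small : ∀ {ρ} → ρ ∈ rows → coefficients ρ ∙ coefficients ρ ≤ + S) where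

    Bounded : ℕ → (Vec Bool m → Weights k) → Set
    Bounded t C = ∀ {ρ} → ρ ∈ rows → ∀ x → ∣ coefficients ρ ∙ C x ∣ ℕ.≤ t ℕ.* S

    bounded-update : ∀ {t C ρ} → ρ ∈ rows → Bounded t C → Bounded (suc t) (λ x → update x ρ (C x))
    bounded-update {t} {C} {ρ} ρ∈ h {ρ′} ρ′∈ x with violated x (C x) ρ
    ... | false = ℕₚ.≤-trans (h ρ′∈ x) (ℕₚ.m≤n+m _ S)
    ... | true  = begin
      ∣ a′ ∙ (C x ⊕ʷ a) ∣          ≡⟨ cong ∣_∣ (∙-⊕ʳ a′ (C x) a) ⟩
      ∣ a′ ∙ C x + a′ ∙ a ∣        ≤⟨ ∣i+j∣≤∣i∣+∣j∣ (a′ ∙ C x) (a′ ∙ a) ⟩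
      ∣ a′ ∙ C x ∣ ℕ.+ ∣ a′ ∙ a ∣  ≤⟨ ℕₚ.+-mono-≤ (h ρ′∈ x) (∙-bound a′ a (small ρ′∈) (small ρ∈)) ⟩
      t ℕ.* S ℕ.+ S                ≡⟨ ℕₚ.+-comm (t ℕ.* S) S ⟩
      S ℕ.+ t ℕ.* S                ∎
      where
      open ℕₚ.≤-Reasoning
      a  = coefficients ρ
      a′ = coefficients ρ′

    -- The weight vector itself gets no wires. Only its inner products with the rows are kept, and
    -- these are all that testing and updating require.
    HasRows : (Vec Bool m → Weights k) → Net m → Set
    HasRows C N = ∀ {ρ} → ρ ∈ rows → Thermometer (λ x → coefficients ρ ∙ C x) N

    pair : Bool → Bool → Vec Bool 2
    pair a b = a ∷ b ∷ []

    build-violated : ∀ {C N} ρ → ρ ∈ rows → inputs ⊑ N → HasRows C N →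
                     Build (localCost 2) N (Has (λ x → violated x (C x) ρ))
    build-violated ρ ρ∈ e h with guard ρ
    ... | nothing      = at-most (ℕ.s≤s ℕ.z≤n) (notᵇ (h ρ∈ (threshold ρ)))
    ... | just (l , b) = local (λ { (u ∷ t ∷ []) → ⌊ u Boolₚ.≟ b ⌋ ∧ not t })
      {f = λ x → pair (lookup x l) _}
      (hasVec λ { zero → has-stable e (l , λ _ → refl) ; (suc zero) → has-cong (λ _ → refl) (h ρ∈ (threshold ρ)) })

    module _ (T : ℕ) where

      -- `T` bounds the number of row visits in the whole run, so every update may be charged for
      -- the final range `T * S` of the inner products.
      updateCost : ℕ
      updateCost = localCost 2 ℕ.+ length rows ℕ.* thermometerCost (T ℕ.* S) (localCost 3)

      -- Adding the coefficients `a` of `ρ` shifts the inner product with another row `a′` by the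
      -- constant `a′ ∙ a`. Comparing the new product with `θ` is therefore comparing the old one
      -- with `θ - a′ ∙ a`, for which a wire exists; the circuit only selects between two old wires
      -- and performs no addition.
      build-update : ∀ {C t N ρ} → ρ ∈ rows → inputs ⊑ N → suc t ℕ.≤ T → Bounded t C → HasRows C N →
                     Build updateCost N (HasRows (λ x → update x ρ (C x)))
      build-update {C} {t} {N} {ρ} ρ∈ e t<T bd h =
        build-violated ρ ρ∈ e h >>= λ e₁ v →
        forEach (λ _ → thermometer-stable) rows
          (λ {ρ′} ρ′∈ e₂ → build-row ρ′ ρ′∈ (has-stable e₂ v) λ ρ∈ θ → has-stable (⊑-trans e₁ e₂) (h ρ∈ θ))
        where
        a = coefficients ρ
        build-row : ∀ ρ′ (ρ′∈ : ρ′ ∈ rows) {N′} → Has (λ x → violated x (C x) ρ) N′ → HasRows C N′ →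
                    Build (thermometerCost (T ℕ.* S) (localCost 3)) N′ (Thermometer (λ x → coefficients ρ′ ∙ update x ρ (C x)))
        build-row ρ′ ρ′∈ v h = build-thermometer
          (λ x → ℕₚ.≤-trans (bounded-update {t} {C} ρ∈ bd ρ′∈ x) (ℕₚ.*-monoˡ-≤ S t<T))
          λ θ e → map-result (has-cong λ x → select x θ) (local choice
            {f = λ x → violated x (C x) ρ ∷ ((θ - a′ ∙ a) ≤ᵇᶻ (a′ ∙ C x)) ∷ (θ ≤ᵇᶻ (a′ ∙ C x)) ∷ []}
            (hasVec λ { zero             → has-stable e v
                      ; (suc zero)       → has-stable e (h ρ′∈ (θ - a′ ∙ a))
                      ; (suc (suc zero)) → has-stable e (h ρ′∈ θ) }))
          where
          a′ = coefficients ρ′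
          choice : Vec Bool 3 → Bool
          choice (v ∷ p ∷ q ∷ []) = if v then p else q
          select : ∀ x θ → (if violated x (C x) ρ then (θ - a′ ∙ a) ≤ᵇᶻ (a′ ∙ C x) else θ ≤ᵇᶻ (a′ ∙ C x))
                         ≡ θ ≤ᵇᶻ (a′ ∙ update x ρ (C x))
          select x θ with violated x (C x) ρ
          ... | false = refl
          ... | true  = trans (≤ᵇᶻ-shift θ (a′ ∙ a) (a′ ∙ C x)) (cong (θ ≤ᵇᶻ_) (sym (∙-⊕ʳ a′ (C x) a)))

      build-sweep : ∀ ρs {C t N} → (∀ {ρ} → ρ ∈ ρs → ρ ∈ rows) → inputs ⊑ N → t ℕ.+ length ρs ℕ.≤ T →
                    Bounded t C → HasRows C N →
                    Build (length ρs ℕ.* updateCost) N (HasRows (λ x → sweep x ρs (C x)))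
      build-sweep []       ⊆rows e t≤T bd h = return h
      build-sweep (ρ ∷ ρs) {C} {t} ⊆rows e t≤T bd h =
        build-update (⊆rows (here refl)) e (ℕₚ.≤-trans (ℕₚ.m≤m+n (suc t) (length ρs)) t≤T′) bd h >>= λ e₁ h′ →
        build-sweep ρs (⊆rows ∘ there) (⊑-trans e e₁) t≤T′ (bounded-update {t} {C} (⊆rows (here refl)) bd) h′
        where
        t≤T′ : suc t ℕ.+ length ρs ℕ.≤ T
        t≤T′ = subst (ℕ._≤ T) (ℕₚ.+-suc t (length ρs)) t≤T

      bounded-sweep : ∀ ρs {C t} → (∀ {ρ} → ρ ∈ ρs → ρ ∈ rows) → Bounded t C →
                      Bounded (length ρs ℕ.+ t) (λ x → sweep x ρs (C x))
      bounded-sweep []       ⊆rows bd = bd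
      bounded-sweep (ρ ∷ ρs) {C} {t} ⊆rows bd =
        subst (λ u → Bounded u (λ x → sweep x ρs (update x ρ (C x)))) (ℕₚ.+-suc (length ρs) t)
          (bounded-sweep ρs (⊆rows ∘ there) (bounded-update {t} {C} (⊆rows (here refl)) bd))

      build-sweeps : ∀ n {C t N} → inputs ⊑ N → t ℕ.+ n ℕ.* length rows ℕ.≤ T → Bounded t C → HasRows C N →
                     Build (n ℕ.* (length rows ℕ.* updateCost)) N (HasRows (λ x → sweeps n x rows (C x)))
      build-sweeps zero    e t≤T bd h = return h
      build-sweeps (suc n) {C} {t} e t≤T bd h =
        build-sweep rows id e (ℕₚ.≤-trans (ℕₚ.+-monoʳ-≤ t (ℕₚ.m≤m+n _ _)) t≤T) bd h >>= λ e₁ h′ →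
        build-sweeps n (⊑-trans e e₁) t≤T′ (bounded-sweep rows id bd) h′
        where
        t≤T′ : length rows ℕ.+ t ℕ.+ n ℕ.* length rows ℕ.≤ T
        t≤T′ = subst (ℕ._≤ T) (trans (sym (ℕₚ.+-assoc t _ _)) (cong (ℕ._+ n ℕ.* length rows) (ℕₚ.+-comm t (length rows)))) t≤T

    build-settled : ∀ ρs {C N} → (∀ {ρ} → ρ ∈ ρs → ρ ∈ rows) → inputs ⊑ N → HasRows C N →
                    Build (length ρs ℕ.* (localCost 2 ℕ.+ 2) ℕ.+ 1) N (Has (λ x → settled x ρs (C x)))
    build-settled []       ⊆rows e h = constant true
    build-settled (ρ ∷ ρs) {C} ⊆rows e h = at-most (ℕₚ.≤-reflexive (shuffle (localCost 2) (length ρs ℕ.* (localCost 2 ℕ.+ 2))))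
      (build-violated ρ (⊆rows (here refl)) e h >>= λ e₁ v →
       notᵇ v >>= λ e₂ ¬v →
       build-settled ρs {C} (⊆rows ∘ there) (⊑-trans e (⊑-trans e₁ e₂)) (λ ρ∈ θ → has-stable (⊑-trans e₁ e₂) (h ρ∈ θ)) >>= λ e₃ s →
       has-stable e₃ ¬v ∧ᵇ s)
      where
      open ℕ-Solver using (solve; _:=_; _:+_; con)
      shuffle : ∀ c l → c ℕ.+ (1 ℕ.+ (l ℕ.+ 1 ℕ.+ 1)) ≡ c ℕ.+ 2 ℕ.+ l ℕ.+ 1
      shuffle = solve 2 (λ c l → c :+ (con 1 :+ (l :+ con 1 :+ con 1)) := c :+ con 2 :+ l :+ con 1) refl

    decide : ℕ → Function m
    decide R x = settled x rows (sweeps (suc R) x rows (λ _ → 0ℤ))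

  decideCost : ℕ → ℕ → ℕ → ℕ
  decideCost J S R = J ℕ.* thermometerCost 0 1 ℕ.+
    (suc R ℕ.* (J ℕ.* (localCost 2 ℕ.+ J ℕ.* thermometerCost (suc R ℕ.* J ℕ.* S) (localCost 3))) ℕ.+
     (J ℕ.* (localCost 2 ℕ.+ 2) ℕ.+ 1))

  build-decide : ∀ {k m} (rows : List (Row k m)) S (small : ∀ {ρ} → ρ ∈ rows → coefficients ρ ∙ coefficients ρ ≤ + S) R →
                 Build (decideCost (length rows) S R) inputs (Has (decide rows S small R))
  build-decide rows S small R =
    forEach (λ _ → thermometer-stable) rows
      (λ {ρ} _ e → build-thermometer {B = 0} (λ x → ℕₚ.≤-reflexive (cong ∣_∣ (zero-dot (coefficients ρ))))
        λ θ e → map-result (has-cong λ x → cong (θ ≤ᵇᶻ_) (sym (zero-dot (coefficients ρ)))) (constant (θ ≤ᵇᶻ 0ℤ))) >>= λ e₁ h →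
    build-sweeps rows S small (suc R ℕ.* length rows) (suc R) {λ _ _ → 0ℤ} {0} e₁ ℕₚ.≤-refl
      (λ {ρ} _ x → ℕₚ.≤-reflexive (cong ∣_∣ (zero-dot (coefficients ρ)))) h >>= λ e₂ h′ →
    build-settled rows S small rows id (⊑-trans e₁ e₂) h′
    where
    zero-dot : ∀ {k} (a : Weights k) → a ∙ (λ _ → 0ℤ) ≡ 0ℤ
    zero-dot {k} a = trans (sum-cong-≗ {k} λ i → *-zeroʳ (a i)) (sum-replicate-zero k)

-- Few points that approximately span all others, by counting subset sums.

module Spanner where

  open import Data.Fin.Base as Fin using (funToFin; finToFun)
  open import Data.Fin.Properties using (pigeonhole; funToFin-finToFin; finToFun-funToFin; fromℕ<-injective)
  import Data.Fin.Properties as Finₚ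
  open import Data.Integer.Base as ℤ using (ℤ; +_; 0ℤ; 1ℤ; -1ℤ; ∣_∣)
  import Data.Integer.Properties as ℤₚ
  open import Data.Integer.Solver using (module +-*-Solver)
  open import Data.Nat.Base hiding (∣_-_∣)
  open import Data.Nat.DivMod using (_/_; _%_; m≡m%n+[m/n]*n; m%n<n; /-monoˡ-≤; m*n/n≡m)
  open import Data.Nat.Properties
  open import Data.Nat.Solver renaming (module +-*-Solver to ℕ-Solver)
  open import Data.Vec.Base as Vec using (tabulate)
  open import Data.Vec.Properties using (lookup∘tabulate)
  open import Algebra.Properties.Semiring.Sum ℤₚ.+-*-semiring using (sum)

  open Perceptron using (Weights)

  -- Finiteness lets double negation pass under the quantifier.
  ¬¬-all : ∀ {n} {P : Fin n → Set} → (∀ i → ¬ ¬ P i) → ¬ ¬ (∀ i → P i)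
  ¬¬-all {zero}  h k = k λ ()
  ¬¬-all {suc n} h k = h zero λ p → ¬¬-all (h ∘ suc) λ ps → k λ { zero → p ; (suc i) → ps i }

  m≤2^m : ∀ m → suc m ≤ 2 ^ m
  m≤2^m zero    = ≤-refl
  m≤2^m (suc m) = begin
    1 + suc m          ≤⟨ +-mono-≤ (m^n>0 2 m) (m≤2^m m) ⟩
    2 ^ m + 2 ^ m      ≡⟨ cong (λ t → 2 ^ m + t) (sym (+-identityʳ (2 ^ m))) ⟩
    2 ^ suc m          ∎
    where open ≤-Reasoning

  -- A polynomial solution `K` of `(K * M + 1) ^ D < 2 ^ K` for positive `D`: the number of subsets
  -- must beat the number of boxes.
  spannerSize : ℕ → ℕ → ℕ
  spannerSize D M = 4 * (D + M) * D

  -- After removing the common exponent `D` it remains to bound `4 * a * D * M + 1` by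
  -- `2 ^ (4 * a)`, where `a = D + M`. This follows from `n + 1 ≤ 2 ^ n` applied to `D`, `M` and
  -- `a`, with two further factors `2 ^ a` absorbing the 4.
  few-cells : ∀ D M → suc (spannerSize (suc D) M * M) ^ suc D < 2 ^ spannerSize (suc D) M
  few-cells D′ M = subst (suc (4 * a * D * M) ^ D <_) (^-*-assoc 2 (4 * a) D) (^-monoˡ-< D (begin-strict
    suc (4 * a * D * M)                       <⟨ s≤s (s≤s (m≤m+n _ (4 * a * a + 8 * a + 4 * (D * M) + 2))) ⟩
    2 + (4 * a * D * M + (4 * a * a + 8 * a + 4 * (D * M) + 2)) ≡⟨ expand a D M ⟩
    4 * ((D * M + a + 1) * (1 + a))           ≡⟨ cong (λ t → 4 * (t * (1 + a))) (factor D M) ⟩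
    4 * ((suc D * suc M) * (1 + a))           ≤⟨ *-mono-≤ four (*-mono-≤ (*-mono-≤ (m≤2^m D) (m≤2^m M)) (m≤2^m a)) ⟩
    2 ^ a * 2 ^ a * (2 ^ D * 2 ^ M * 2 ^ a)   ≡⟨ cong (λ t → 2 ^ a * 2 ^ a * (t * 2 ^ a)) (sym (^-distribˡ-+-* 2 D M)) ⟩
    2 ^ a * 2 ^ a * (2 ^ a * 2 ^ a)           ≡⟨ cong (λ t → t * t) (sym (^-distribˡ-+-* 2 a a)) ⟩
    2 ^ (a + a) * 2 ^ (a + a)                 ≡⟨ sym (^-distribˡ-+-* 2 (a + a) (a + a)) ⟩
    2 ^ (a + a + (a + a))                     ≡⟨ cong (2 ^_) (quadruple a) ⟩
    2 ^ (4 * a)                               ∎))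
    where
    open ≤-Reasoning
    open ℕ-Solver using (solve; _:=_; _:+_; _:*_; con)
    D = suc D′
    a = D + M
    four : 4 ≤ 2 ^ a * 2 ^ a
    four = *-mono-≤ two two
      where
      two : 2 ≤ 2 ^ a
      two = ≤-trans (s≤s (s≤s z≤n)) (m≤2^m a)
    expand : ∀ a d m → 2 + (4 * a * d * m + (4 * a * a + 8 * a + 4 * (d * m) + 2)) ≡ 4 * ((d * m + a + 1) * (1 + a))
    expand = solve 3 (λ a d m → con 2 :+ (con 4 :* a :* d :* m :+ (con 4 :* a :* a :+ con 8 :* a :+ con 4 :* (d :* m) :+ con 2))
                         := con 4 :* ((d :* m :+ a :+ con 1) :* (con 1 :+ a))) refl
    factor : ∀ d m → d * m + (d + m) + 1 ≡ (1 + d) * (1 + m)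
    factor = solve 2 (λ d m → d :* m :+ (d :+ m) :+ con 1 := (con 1 :+ d) :* (con 1 :+ m)) refl
    quadruple : ∀ a → a + a + (a + a) ≡ 4 * a
    quadruple = solve 1 (λ a → a :+ a :+ (a :+ a) := con 4 :* a) refl

  module _ {V D : ℕ} (U : Fin V → Fin D → ℕ) (E M : ℕ) .{{_ : NonZero E}} (U≤ : ∀ z d → U z d ≤ E * M) where

    combination : ∀ {k} → Weights k → Vec (Fin V) k → Fin D → ℤ
    combination c σ d = sum λ i → c i ℤ.* + U (lookup σ i) d

    Near : ℤ → ℤ → Set
    Near i j = ∣ i ℤ.- j ∣ < E

    Spans : ∀ {k} → Vec (Fin V) k → Fin V → Set
    Spans {k} σ z = ∃ λ (c : Weights k) → (∀ i → ∣ c i ∣ ≤ 1) × (∀ d → Near (combination c σ d) (+ U z d))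

    data Independent : ∀ {k} → Vec (Fin V) k → Set where
      []  : Independent []
      _∷_ : ∀ {k z} {σ : Vec (Fin V) k} → ¬ Spans σ z → Independent σ → Independent (z ∷ σ)

    subsetSum : ∀ {k} → Vec (Fin V) k → Vec Bool k → Fin D → ℕ
    subsetSum []      []          d = 0
    subsetSum (z ∷ σ) (true  ∷ b) d = U z d + subsetSum σ b d
    subsetSum (z ∷ σ) (false ∷ b) d = subsetSum σ b d

    subsetSum≤ : ∀ {k} (σ : Vec (Fin V) k) b d → subsetSum σ b d ≤ k * (E * M)
    subsetSum≤ []      []          d = z≤n
    subsetSum≤ (z ∷ σ) (true  ∷ b) d = +-mono-≤ (U≤ z d) (subsetSum≤ σ b d)
    subsetSum≤ (z ∷ σ) (false ∷ b) d = ≤-trans (subsetSum≤ σ b d) (m≤n+m _ (E * M))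

    sign : Bool → Bool → ℤ
    sign true  false = 1ℤ
    sign false true  = -1ℤ
    sign _     _     = 0ℤ

    sign≤1 : ∀ a b → ∣ sign a b ∣ ≤ 1
    sign≤1 true  true  = z≤n
    sign≤1 true  false = ≤-refl
    sign≤1 false true  = ≤-refl
    sign≤1 false false = z≤n

    signs : ∀ {k} → Vec Bool k → Vec Bool k → Weights k
    signs b b′ i = sign (lookup b i) (lookup b′ i)

    combination-signs : ∀ {k} (σ : Vec (Fin V) k) b b′ d →
                        combination (signs b b′) σ d ≡ + subsetSum σ b d ℤ.- + subsetSum σ b′ d
    combination-signs []      []      []        d = refl
    combination-signs (z ∷ σ) (x ∷ b) (x′ ∷ b′) d with x | x′ | combination-signs σ b b′ d
    ... | true  | true  | ih rewrite ih = solve 3 (λ u s t → con 0ℤ :* u :+ (s :- t) := (u :+ s) :- (u :+ t)) refl (+ U z d) (+ subsetSum σ b d) (+ subsetSum σ b′ d)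
      where open +-*-Solver using (solve; _:=_; _:+_; _:-_; _:*_; con)
    ... | true  | false | ih rewrite ih = solve 3 (λ u s t → con 1ℤ :* u :+ (s :- t) := (u :+ s) :- t) refl (+ U z d) (+ subsetSum σ b d) (+ subsetSum σ b′ d)
      where open +-*-Solver using (solve; _:=_; _:+_; _:-_; _:*_; con)
    ... | false | true  | ih rewrite ih = solve 3 (λ u s t → con -1ℤ :* u :+ (s :- t) := s :- (u :+ t)) refl (+ U z d) (+ subsetSum σ b d) (+ subsetSum σ b′ d)
      where open +-*-Solver using (solve; _:=_; _:+_; _:-_; _:*_; con)
    ... | false | false | ih rewrite ih = solve 3 (λ u s t → con 0ℤ :* u :+ (s :- t) := s :- t) refl (+ U z d) (+ subsetSum σ b d) (+ subsetSum σ b′ d)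
      where open +-*-Solver using (solve; _:=_; _:+_; _:-_; _:*_; con)

    Close : ∀ {k} → Vec (Fin V) k → Vec Bool k → Vec Bool k → Set
    Close σ b b′ = ∀ d → Near (+ subsetSum σ b d) (+ subsetSum σ b′ d)

    close-sym : ∀ {k} {σ : Vec (Fin V) k} {b b′} → Close σ b b′ → Close σ b′ b
    close-sym {σ = σ} {b} {b′} h d = subst (_< E) (ℤₚ.∣i-j∣≡∣j-i∣ (+ subsetSum σ b d) (+ subsetSum σ b′ d)) (h d)

    -- The topmost difference between two subsets with close sums would express
    -- one vector through the earlier ones.
    spanned : ∀ {k z} {σ : Vec (Fin V) k} {b b′} → Close (z ∷ σ) (true ∷ b) (false ∷ b′) → Spans σ z
    spanned {z = z} {σ} {b} {b′} h = signs b′ b , (λ i → sign≤1 (lookup b′ i) (lookup b i)) , λ d →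
      subst (_< E) (trans (ℤₚ.∣i-j∣≡∣j-i∣ (+ (U z d + subsetSum σ b d)) (+ subsetSum σ b′ d))
        (cong ∣_∣ (trans (shuffle (+ U z d) (+ subsetSum σ b d) (+ subsetSum σ b′ d))
          (cong (ℤ._- + U z d) (sym (combination-signs σ b′ b d)))))) (h d)
      where
      open +-*-Solver using (solve; _:=_; _:+_; _:-_)
      shuffle : ∀ u s t → t ℤ.- (u ℤ.+ s) ≡ (t ℤ.- s) ℤ.- u
      shuffle = solve 3 (λ u s t → t :- (u :+ s) := (t :- s) :- u) refl

    close⇒≡ : ∀ {k} {σ : Vec (Fin V) k} → Independent σ → ∀ b b′ → Close σ b b′ → b ≡ b′
    close⇒≡ []                        []          []           h = refl
    close⇒≡ {σ = z ∷ σ} (_ ∷ ind)     (true  ∷ b) (true  ∷ b′) h = cong (true ∷_) (close⇒≡ ind b b′ λ d →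
      subst (λ i → ∣ i ∣ < E) (solve 3 (λ u s t → (u :+ s) :- (u :+ t) := s :- t) refl (+ U z d) (+ subsetSum σ b d) (+ subsetSum σ b′ d)) (h d))
      where open +-*-Solver using (solve; _:=_; _:+_; _:-_)
    close⇒≡ (_ ∷ ind)                 (false ∷ b) (false ∷ b′) h = cong (false ∷_) (close⇒≡ ind b b′ h)
    close⇒≡ {σ = z ∷ σ} (¬sp ∷ _)     (true  ∷ b) (false ∷ b′) h = contradiction (spanned {σ = σ} {b} {b′} h) ¬sp
    close⇒≡ {σ = z ∷ σ} (¬sp ∷ _)     (false ∷ b) (true  ∷ b′) h =
      contradiction (spanned {σ = σ} {b′} {b} (close-sym {σ = z ∷ σ} {false ∷ b} {true ∷ b′} h)) ¬sp

    /-near : ∀ m n → m / E ≡ n / E → Near (+ m) (+ n)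
    /-near m n eq = subst (λ i → ∣ i ∣ < E) (sym difference) (small (m%n<n m E) (m%n<n n E))
      where
      open +-*-Solver using (solve; _:=_; _:+_; _:-_)
      difference : + m ℤ.- + n ≡ + (m % E) ℤ.- + (n % E)
      difference = trans (cong₂ (λ i j → + i ℤ.- + j) (m≡m%n+[m/n]*n m E) (trans (m≡m%n+[m/n]*n n E) (cong (λ q → n % E + q * E) (sym eq))))
        (solve 3 (λ a b c → (a :+ c) :- (b :+ c) := a :- b) refl (+ (m % E)) (+ (n % E)) (+ (m / E * E)))
      small : ∀ {a b} → a < E → b < E → ∣ + a ℤ.- + b ∣ < E
      small {a} {b} a< b< rewrite ℤₚ.m-n≡m⊖n a b with ≤-total a b
      ... | inj₁ a≤b rewrite ℤₚ.∣⊖∣-≤ a≤b = ≤-<-trans (m∸n≤m b a) b<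
      ... | inj₂ b≤a rewrite ℤₚ.∣m⊖n∣≡∣n⊖m∣ a b | ℤₚ.∣⊖∣-≤ b≤a = ≤-<-trans (m∸n≤m a b) a<

    cell : ∀ {k} → Vec (Fin V) k → Vec Bool k → Fin D → Fin (suc (k * M))
    cell {k} σ b d = fromℕ< (s≤s (≤-trans (/-monoˡ-≤ E (subsetSum≤ σ b d)) (≤-reflexive
      (trans (cong (_/ E) (trans (cong (k *_) (*-comm E M)) (sym (*-assoc k M E)))) (m*n/n≡m (k * M) E)))))

    bool : Fin 2 → Bool
    bool zero       = false
    bool (suc zero) = true

    bool-injective : ∀ {a b} → bool a ≡ bool b → a ≡ b
    bool-injective {zero}     {zero}     _ = refl
    bool-injective {zero}     {suc zero} ()
    bool-injective {suc zero} {suc zero} _ = refl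

    bits : ∀ {k} → Fin (2 ^ k) → Vec Bool k
    bits i = tabulate (bool ∘ finToFun i)

    bits-injective : ∀ {k} {i j : Fin (2 ^ k)} → bits {k} i ≡ bits j → i ≡ j
    bits-injective {k} {i} {j} eq = trans (sym (funToFin-finToFin {k} i))
      (trans (funToFin-cong λ l → bool-injective (trans (sym (lookup∘tabulate (bool ∘ finToFun i) l))
          (trans (cong (λ v → lookup v l) eq) (lookup∘tabulate (bool ∘ finToFun j) l))))
        (funToFin-finToFin {k} j))
      where
      funToFin-cong : ∀ {m n} {f g : Fin m → Fin n} → (∀ i → f i ≡ g i) → funToFin f ≡ funToFin g
      funToFin-cong {zero}  h = refl
      funToFin-cong {suc m} h = cong₂ Fin.combine (h zero) (funToFin-cong (h ∘ suc))

    -- Boxes of side `E` number `k * M + 1` in each direction. Two of the `2 ^ k` subset sums share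
    -- a box and are thus close, which independence permits for equal subsets only.
    no-long-independent : ∀ {k} (σ : Vec (Fin V) k) → suc (k * M) ^ D < 2 ^ k → ¬ Independent σ
    no-long-independent {k} σ many ind with pigeonhole many (λ i → funToFin (cell σ (bits i)))
    ... | i , j , i<j , eq = contradiction (bits-injective {k} (close⇒≡ ind (bits i) (bits j) close)) (Finₚ.<⇒≢ i<j)
      where
      close : Close σ (bits i) (bits j)
      close d = /-near (subsetSum σ (bits i) d) (subsetSum σ (bits j) d) (fromℕ<-injective _ _ _ _
        (trans (sym (finToFun-funToFin (cell σ (bits i)) d))
          (trans (cong (λ t → finToFun t d) eq) (finToFun-funToFin (cell σ (bits j)) d))))

    Spanning : ℕ → Set
    Spanning K = ∃ λ k → k ≤ K × ∃ λ (σ : Vec (Fin V) k) → ∀ z → Spans σ z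

    -- Greedy choice: as long as some point is not spanned it can be put in front without losing
    -- independence, and length `K` contradicts the count.
    extend : ∀ {K k} n (σ : Vec (Fin V) k) → Independent σ → n + k ≡ K → suc (K * M) ^ D < 2 ^ K → ¬ ¬ Spanning K
    extend zero    σ ind refl many _ = no-long-independent σ many ind
    extend {k = k} (suc n) σ ind refl many none = ¬¬-all spans λ all → none (k , m≤n+m k (suc n) , σ , all)
      where
      spans : ∀ z → ¬ ¬ Spans σ z
      spans z ¬sp = extend n (z ∷ σ) (¬sp ∷ ind) (+-suc n k) many none

    spanning : ∀ {K} → suc (K * M) ^ D < 2 ^ K → ¬ ¬ Spanning K
    spanning {K} many = extend K [] [] (+-identityʳ K) many

-- Inequalities between Cauchy reals as statements about rational sequences.

module Reals where

  open import Algebra.Bundles using (CommutativeRing)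
  import Data.Nat.Base as ℕ
  import Data.Nat.Properties as ℕₚ
  open import Data.Rational.Base hiding (_≃_)
  open import Data.Rational.Properties
  open import Data.Rational.Solver using (module +-*-Solver)
  open import Data.Vec.Functional using (Vector)

  open import Defs using (ℝ; seq; isCauchy; _≃_; fromℚ; ∑) renaming (_≤_ to _≤ʳ_; _+_ to _+ʳ_; _*_ to _*ʳ_)

  ℚ-semiring = CommutativeRing.semiring +-*-commutativeRing

  open import Algebra.Properties.Semiring.Sum ℚ-semiring
    using (sum; sum-cong-≗; ∑-distrib-+; ∑-comm; *-distribˡ-sum; *-distribʳ-sum; sum-replicate-zero) public

  Sequence : Set
  Sequence = ℕ → ℚ

  neg-involutive : ∀ p → - (- p) ≡ p
  neg-involutive = solve 1 (λ p → :- (:- p) := p) refl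
    where open +-*-Solver using (solve; _:=_; :-_)

  p≤p+q : ∀ p {q} → 0ℚ ≤ q → p ≤ p + q
  p≤p+q p {q} h = subst (_≤ p + q) (+-identityʳ p) (+-monoʳ-≤ p h)

  half-pos : ∀ {ε} → 0ℚ < ε → 0ℚ < ½ * ε
  half-pos {ε} ε>0 = positive⁻¹ (½ * ε) {{pos*pos⇒pos ½ ε {{positive ε>0}}}}

  halves : ∀ ε → ½ * ε + ½ * ε ≡ ε
  halves ε = trans (sym (*-distribʳ-+ ε ½ ½)) (*-identityˡ ε)

  shrink : ∀ {K ε} → 0ℚ < K → 0ℚ < ε → ∃ λ δ → 0ℚ < δ × K * δ ≡ ε
  shrink {K} {ε} K>0 ε>0 = K⁻¹ * ε ,
    positive⁻¹ (K⁻¹ * ε) {{pos*pos⇒pos K⁻¹ {{1/pos⇒pos K {{positive K>0}}}} ε {{positive ε>0}}}} ,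
    trans (sym (*-assoc K K⁻¹ ε)) (trans (cong (_* ε) (*-inverseʳ K {{K≢0}})) (*-identityˡ ε))
    where
    K≢0 = pos⇒nonZero K {{positive K>0}}
    K⁻¹ = (1/ K) {{K≢0}}

  -- lim inf s ≥ 0
  Nonneg : Sequence → Set
  Nonneg s = ∀ ε → 0ℚ < ε → ∃ λ N → ∀ {n} → N ℕ.≤ n → - ε < s n

  Null : Sequence → Set
  Null s = ∀ ε → 0ℚ < ε → ∃ λ N → ∀ {n} → N ℕ.≤ n → ∣ s n ∣ < ε

  nonneg-cong : ∀ {s t} → (∀ n → s n ≡ t n) → Nonneg s → Nonneg t
  nonneg-cong s≗t h ε ε>0 with h ε ε>0
  ... | N , p = N , λ {n} n≥ → subst (- ε <_) (s≗t n) (p n≥)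

  null-cong : ∀ {s t} → (∀ n → s n ≡ t n) → Null s → Null t
  null-cong s≗t h ε ε>0 with h ε ε>0
  ... | N , p = N , λ {n} n≥ → subst (λ q → ∣ q ∣ < ε) (s≗t n) (p n≥)

  p≤∣p∣ : ∀ p → p ≤ ∣ p ∣
  p≤∣p∣ p with ≤-total 0ℚ p
  ... | inj₁ 0≤p = ≤-reflexive (sym (0≤p⇒∣p∣≡p 0≤p))
  ... | inj₂ p≤0 = ≤-trans p≤0 (0≤∣p∣ p)

  -∣p∣≤p : ∀ p → - ∣ p ∣ ≤ p
  -∣p∣≤p p = subst (- ∣ p ∣ ≤_) (neg-involutive p) (neg-antimono-≤ (subst (- p ≤_) (∣-p∣≡∣p∣ p) (p≤∣p∣ (- p))))

  null⇒nonneg : ∀ {s} → Null s → Nonneg s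
  null⇒nonneg {s} h ε ε>0 with h ε ε>0
  ... | N , p = N , λ {n} n≥ → <-≤-trans (neg-antimono-< (p n≥)) (-∣p∣≤p (s n))

  nonneg-const : ∀ {q} → 0ℚ ≤ q → Nonneg (λ _ → q)
  nonneg-const q≥0 ε ε>0 = 0 , λ _ → <-≤-trans (neg-antimono-< ε>0) q≥0

  nonneg-const⁻¹ : ∀ {q} → Nonneg (λ _ → q) → 0ℚ ≤ q
  nonneg-const⁻¹ {q} h with 0ℚ ≤? q
  ... | yes p = p
  ... | no ¬p with h (- q) (neg-antimono-< (≰⇒> ¬p))
  ...   | N , k = contradiction (subst (_< q) (neg-involutive q) (k {N} ℕₚ.≤-refl)) (<-irrefl refl)

  nonneg-+ : ∀ {s t} → Nonneg s → Nonneg t → Nonneg (λ n → s n + t n)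
  nonneg-+ hs ht ε ε>0 with hs (½ * ε) (half-pos ε>0) | ht (½ * ε) (half-pos ε>0)
  ... | M , p | N , q = M ℕ.⊔ N , λ {n} n≥ →
    subst (_< _) (trans (sym (neg-distrib-+ (½ * ε) (½ * ε))) (cong -_ (halves ε)))
      (+-mono-< (p (ℕₚ.m⊔n≤o⇒m≤o M N n≥)) (q (ℕₚ.m⊔n≤o⇒n≤o M N n≥)))

  null-+ : ∀ {s t} → Null s → Null t → Null (λ n → s n + t n)
  null-+ {s} {t} hs ht ε ε>0 with hs (½ * ε) (half-pos ε>0) | ht (½ * ε) (half-pos ε>0)
  ... | M , p | N , q = M ℕ.⊔ N , λ {n} n≥ →
    subst (∣ s n + t n ∣ <_) (halves ε)
      (≤-<-trans (∣p+q∣≤∣p∣+∣q∣ (s n) (t n)) (+-mono-< (p (ℕₚ.m⊔n≤o⇒m≤o M N n≥)) (q (ℕₚ.m⊔n≤o⇒n≤o M N n≥))))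

  nonneg-* : ∀ {q s} → 0ℚ ≤ q → Nonneg s → Nonneg (λ n → q * s n)
  nonneg-* {q} {s} q≥0 h ε ε>0 with shrink {1ℚ + q} (<-≤-trans (positive⁻¹ 1ℚ) (p≤p+q 1ℚ q≥0)) ε>0
  ... | δ , δ>0 , eq with h δ δ>0
  ...   | N , p = N , λ {n} n≥ → begin-strict
    - ε                  ≡⟨ cong -_ (sym eq) ⟩
    - ((1ℚ + q) * δ)     ≡⟨ split q δ ⟩
    q * (- δ) + - δ      <⟨ +-monoʳ-< (q * (- δ)) (neg-antimono-< δ>0) ⟩
    q * (- δ) + 0ℚ       ≡⟨ +-identityʳ (q * (- δ)) ⟩
    q * (- δ)            ≤⟨ *-monoˡ-≤-nonNeg q {{nonNegative q≥0}} (<⇒≤ (p n≥)) ⟩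
    q * s n              ∎
    where
    open ≤-Reasoning
    open +-*-Solver using (solve; _:=_; _:+_; _:*_; :-_; con)
    split : ∀ q δ → - ((1ℚ + q) * δ) ≡ q * (- δ) + - δ
    split = solve 2 (λ q δ → :- ((con 1ℚ :+ q) :* δ) := q :* (:- δ) :+ :- δ) refl

  null-* : ∀ (x : ℝ) {t} → Null t → Null (λ n → seq x n * t n)
  null-* x {t} h ε ε>0 with isCauchy x 1ℚ (positive⁻¹ 1ℚ)
  ... | M , close = result
    where
    open ≤-Reasoning
    open +-*-Solver using (solve; _:=_; _:+_; _:-_)
    K = 1ℚ + ∣ seq x M ∣
    K>0 : 0ℚ < K
    K>0 = <-≤-trans (positive⁻¹ 1ℚ) (p≤p+q 1ℚ (0≤∣p∣ (seq x M)))
    split : ∀ a b → a ≡ (a - b) + b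
    split = solve 2 (λ a b → a := (a :- b) :+ b) refl
    bounded : ∀ {n} → M ℕ.≤ n → ∣ seq x n ∣ ≤ K
    bounded {n} n≥ = begin
      ∣ seq x n ∣                             ≡⟨ cong ∣_∣ (split (seq x n) (seq x M)) ⟩
      ∣ (seq x n - seq x M) + seq x M ∣       ≤⟨ ∣p+q∣≤∣p∣+∣q∣ (seq x n - seq x M) (seq x M) ⟩
      ∣ seq x n - seq x M ∣ + ∣ seq x M ∣     ≤⟨ +-monoˡ-≤ ∣ seq x M ∣ (<⇒≤ (close n≥ ℕₚ.≤-refl)) ⟩
      K                                       ∎
    result : ∃ λ N → ∀ {n} → N ℕ.≤ n → ∣ seq x n * t n ∣ < ε
    result with shrink K>0 ε>0
    ... | δ , δ>0 , eq with h δ δ>0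
    ...   | N , p = M ℕ.⊔ N , λ {n} n≥ → begin-strict
      ∣ seq x n * t n ∣      ≡⟨ ∣p*q∣≡∣p∣*∣q∣ (seq x n) (t n) ⟩
      ∣ seq x n ∣ * ∣ t n ∣  ≤⟨ *-monoʳ-≤-nonNeg ∣ t n ∣ {{∣-∣-nonNeg (t n)}} (bounded (ℕₚ.m⊔n≤o⇒m≤o M N n≥)) ⟩
      K * ∣ t n ∣            <⟨ *-monoʳ-<-pos K {{positive K>0}} (p (ℕₚ.m⊔n≤o⇒n≤o M N n≥)) ⟩
      K * δ                  ≡⟨ eq ⟩
      ε                      ∎

  nonneg-sum : ∀ {k} {s : Fin k → Sequence} → (∀ i → Nonneg (s i)) → Nonneg (λ n → sum λ i → s i n)
  nonneg-sum {zero}  h = nonneg-const ≤-refl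
  nonneg-sum {suc k} h = nonneg-+ (h zero) (nonneg-sum (h ∘ suc))

  null-sum : ∀ {k} {s : Fin k → Sequence} → (∀ i → Null (s i)) → Null (λ n → sum λ i → s i n)
  null-sum {zero}  h ε ε>0 = 0 , λ _ → ε>0
  null-sum {suc k} h = null-+ (h zero) (null-sum (h ∘ suc))

  -- If neither sign held, the number would still be provably nonnegative: a late term below
  -- `- (½ * ε)` would make all later terms negative and so establish the other sign.
  dichotomy : ∀ (x : ℝ) → ¬ ¬ (Nonneg (seq x) ⊎ Nonneg (λ n → - seq x n))
  dichotomy x k = k (inj₁ nonneg)
    where
    open ≤-Reasoning
    open +-*-Solver using (solve; _:=_; _:+_; _:-_; :-_)
    recombine : ∀ a b → b + (a - b) ≡ a
    recombine = solve 2 (λ a b → b :+ (a :- b) := a) refl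
    nonneg : Nonneg (seq x)
    nonneg ε ε>0 with isCauchy x (½ * ε) (half-pos ε>0)
    ... | N , close with - (½ * ε) ≤? seq x N
    ...   | yes above = N , λ {n} n≥ → begin-strict
      - ε                             ≡⟨ cong -_ (sym (halves ε)) ⟩
      - (½ * ε + ½ * ε)               ≡⟨ neg-distrib-+ (½ * ε) (½ * ε) ⟩
      - (½ * ε) + - (½ * ε)           <⟨ +-monoʳ-< (- (½ * ε)) (neg-antimono-< (close n≥ ℕₚ.≤-refl)) ⟩
      - (½ * ε) + - ∣ seq x n - seq x N ∣ ≤⟨ +-mono-≤ above (-∣p∣≤p (seq x n - seq x N)) ⟩
      seq x N + (seq x n - seq x N)   ≡⟨ recombine (seq x n) (seq x N) ⟩
      seq x n                         ∎
    ...   | no below = contradiction (inj₂ λ δ δ>0 → N , λ {n} n≥ → neg-antimono-< (begin-strict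
      seq x n                         ≡⟨ sym (recombine (seq x n) (seq x N)) ⟩
      seq x N + (seq x n - seq x N)   <⟨ +-mono-<-≤ (≰⇒> below) (p≤∣p∣ (seq x n - seq x N)) ⟩
      - (½ * ε) + ∣ seq x n - seq x N ∣ <⟨ +-monoʳ-< (- (½ * ε)) (close n≥ ℕₚ.≤-refl) ⟩
      - (½ * ε) + ½ * ε               ≡⟨ +-inverseˡ (½ * ε) ⟩
      0ℚ                              <⟨ δ>0 ⟩
      δ                               ∎)) k

  ≤⇒nonneg : ∀ {x y} → x ≤ʳ y → Nonneg (λ n → seq y n - seq x n)
  ≤⇒nonneg {x} {y} h ε ε>0 with h ε ε>0
  ... | N , p = N , λ {n} n≥ → subst₂ _<_ (left (seq x n) ε) (right (seq y n) (seq x n) ε) (+-monoˡ-< (- seq x n - ε) (p n≥))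
    where
    open +-*-Solver using (solve; _:=_; _:+_; _:-_; :-_)
    left : ∀ x ε → x + (- x - ε) ≡ - ε
    left = solve 2 (λ x ε → x :+ (:- x :- ε) := :- ε) refl
    right : ∀ y x ε → y + ε + (- x - ε) ≡ y - x
    right = solve 3 (λ y x ε → y :+ ε :+ (:- x :- ε) := y :- x) refl

  nonneg⇒≤ : ∀ {x y} → Nonneg (λ n → seq y n - seq x n) → x ≤ʳ y
  nonneg⇒≤ {x} {y} h ε ε>0 with h ε ε>0
  ... | N , p = N , λ {n} n≥ → subst₂ _<_ (left (seq x n) ε) (right (seq y n) (seq x n) ε) (+-monoˡ-< (seq x n + ε) (p n≥))
    where
    open +-*-Solver using (solve; _:=_; _:+_; _:-_; :-_)
    left : ∀ x ε → - ε + (x + ε) ≡ x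
    left = solve 2 (λ x ε → :- ε :+ (x :+ ε) := x) refl
    right : ∀ y x ε → y - x + (x + ε) ≡ y + ε
    right = solve 3 (λ y x ε → y :- x :+ (x :+ ε) := y :+ ε) refl

  pointwise⇒≃ : ∀ {x y} → (∀ n → seq x n ≡ seq y n) → x ≃ y
  pointwise⇒≃ {x} {y} eq ε ε>0 = 0 , λ {n} _ → subst (λ q → ∣ q ∣ < ε)
    (trans (sym (+-inverseʳ (seq y n))) (cong (_- seq y n) (sym (eq n)))) ε>0

  seq-∑ : ∀ {k} (v : Vector ℝ k) n → seq (∑ v) n ≡ sum λ i → seq (v i) n
  seq-∑ {zero}  v n = refl
  seq-∑ {suc k} v n = cong (seq (v zero) n +_) (seq-∑ (v ∘ suc) n)

  infixl 6 _-ʳ_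

  _-ʳ_ : ℝ → ℝ → ℝ
  x -ʳ y = x +ʳ fromℚ (- 1ℚ) *ʳ y

  seq-minus : ∀ x y n → seq (x -ʳ y) n ≡ seq x n - seq y n
  seq-minus x y n = cong (seq x n +_) (trans (sym (neg-distribˡ-* 1ℚ (seq y n))) (cong -_ (*-identityˡ (seq y n))))

-- Convex hulls of slices and combinations of lifted vertices.

module Polytopes where

  open import Data.Rational.Base hiding (_≃_)
  open import Data.Rational.Properties
  open import Data.Rational.Solver using (module +-*-Solver)
  open import Data.Vec.Functional using (Vector)

  open import Defs using (ℝ; seq; _≃_; fromℚ; 0ℝ; 1ℝ; ∑; Matrix; _·_; _+ᵛ_; _≤ᵛ_; conv; slice; embed; Language) renaming (_≤_ to _≤ʳ_; _*_ to _*ʳ_)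
  open Reals

  indicator : Bool → ℚ
  indicator b = if b then 1ℚ else 0ℚ

  seq-embed : ∀ {ℓ} (u : Vec Bool ℓ) i n → seq (embed u i) n ≡ indicator (lookup u i)
  seq-embed u i n with lookup u i
  ... | true  = refl
  ... | false = refl

  sum-swap : ∀ {k t} (a : Fin k → ℚ) (w : Fin t → ℚ) (f : Fin t → Fin k → ℚ) →
             sum (λ l → a l * sum (λ i → w i * f i l)) ≡ sum (λ i → w i * sum (λ l → a l * f i l))
  sum-swap a w f = begin
    sum (λ l → a l * sum (λ i → w i * f i l))    ≡⟨ sum-cong-≗ (λ l → *-distribˡ-sum (a l) (λ i → w i * f i l)) ⟩
    sum (λ l → sum (λ i → a l * (w i * f i l)))  ≡⟨ ∑-comm (λ l i → a l * (w i * f i l)) ⟩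
    sum (λ i → sum (λ l → a l * (w i * f i l)))  ≡⟨ sum-cong-≗ (λ i → sum-cong-≗ (λ l → exchange (a l) (w i) (f i l))) ⟩
    sum (λ i → sum (λ l → w i * (a l * f i l)))  ≡⟨ sum-cong-≗ (λ i → sym (*-distribˡ-sum (w i) (λ l → a l * f i l))) ⟩
    sum (λ i → w i * sum (λ l → a l * f i l))    ∎
    where
    open ≡-Reasoning
    open +-*-Solver using (solve; _:=_; _:*_)
    exchange : ∀ a w f → a * (w * f) ≡ w * (a * f)
    exchange = solve 3 (λ a w f → a :* (w :* f) := w :* (a :* f)) refl

  sum-neg : ∀ {k} (f : Fin k → ℚ) → sum (λ i → - f i) ≡ - sum f
  sum-neg {zero}  f = refl
  sum-neg {suc k} f = trans (cong (- f zero +_) (sum-neg (f ∘ suc))) (sym (neg-distrib-+ (f zero) (sum (f ∘ suc))))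

  -- The equations of a convex combination hold only in the limit. Termwise, the excess over `β` is
  -- a nonnegative combination of the excesses at the vertices plus three null errors: in the
  -- coordinates of `v`, in those of the vertices, and in the total weight.
  conv-lower-bound : ∀ {L ℓ m} {v : Vector ℝ ℓ} (e : Fin m → ℚ) (pos : Fin m → Fin ℓ) {β} →
    (∀ u → L (toList u) → β ≤ sum λ l → e l * indicator (lookup u (pos l))) →
    conv (slice L ℓ) v → Nonneg (λ n → sum (λ l → e l * seq (v (pos l)) n) - β)
  conv-lower-bound {v = v} e pos {β} h (t , w , s , s∈ , w≥0 , Σw , v≃) = nonneg-cong total
    (nonneg-+ (null⇒nonneg (null-sum λ l → null-* (fromℚ (e l)) (coordinate l)))
    (nonneg-+ (null⇒nonneg (null-sum λ l → null-* (fromℚ (e l)) (null-sum λ i → null-* (w i) (vertex i l))))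
    (nonneg-+ (nonneg-sum λ i → nonneg-* (excess≥0 i) (nonneg-cong (λ n → weight (seq (w i) n)) (≤⇒nonneg {0ℝ} {w i} (w≥0 i))))
              (null⇒nonneg (null-* (fromℚ β) weights)))))
    where
    u : ∀ i → Vec Bool _
    u i = proj₁ (s∈ i)
    z : ∀ i l → ℚ
    z i l = indicator (lookup (u i) (pos l))
    excess : Fin t → ℚ
    excess i = sum (λ l → e l * z i l) - β
    excess≥0 : ∀ i → 0ℚ ≤ excess i
    excess≥0 i = subst (_≤ excess i) (+-inverseʳ β) (+-monoˡ-≤ (- β) (h (u i) (proj₁ (proj₂ (s∈ i)))))
    weight : ∀ w → w - 0ℚ ≡ w
    weight w = +-identityʳ w
    coordinate : ∀ l → Null (λ n → seq (v (pos l)) n - sum (λ i → seq (w i) n * seq (s i (pos l)) n))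
    coordinate l = null-cong (λ n → cong (λ q → seq (v (pos l)) n - q) (seq-∑ (λ i → w i *ʳ s i (pos l)) n)) (v≃ (pos l))
    vertex : ∀ i l → Null (λ n → seq (s i (pos l)) n - z i l)
    vertex i l = null-cong (λ n → cong (λ q → seq (s i (pos l)) n - q) (seq-embed (u i) (pos l) n)) (proj₂ (proj₂ (s∈ i)) (pos l))
    weights : Null (λ n → sum (λ i → seq (w i) n) - 1ℚ)
    weights = null-cong (λ n → cong (_- 1ℚ) (seq-∑ w n)) Σw
    module _ (n : ℕ) where
      open ≡-Reasoning
      open +-*-Solver using (solve; _:=_; _:+_; _:*_; _:-_; :-_; con)
      wₙ : Fin t → ℚ
      wₙ i = seq (w i) n
      x P Q : Fin _ → ℚ
      x l = seq (v (pos l)) n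
      P l = sum (λ i → wₙ i * seq (s i (pos l)) n)
      Q l = sum (λ i → wₙ i * z i l)
      difference : ∀ l → e l * (x l - P l) + e l * sum (λ i → wₙ i * (seq (s i (pos l)) n - z i l)) ≡ e l * x l + - (e l * Q l)
      difference l = begin
        e l * (x l - P l) + e l * sum (λ i → wₙ i * (seq (s i (pos l)) n - z i l))
          ≡⟨ cong (λ q → e l * (x l - P l) + e l * q) (trans (sum-cong-≗ λ i → distrib (wₙ i) (seq (s i (pos l)) n) (z i l))
               (trans (∑-distrib-+ (λ i → wₙ i * seq (s i (pos l)) n) (λ i → - (wₙ i * z i l))) (cong (P l +_) (sum-neg (λ i → wₙ i * z i l))))) ⟩
        e l * (x l - P l) + e l * (P l + - Q l)
          ≡⟨ cancel (e l) (x l) (P l) (Q l) ⟩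
        e l * x l + - (e l * Q l) ∎
        where
        distrib : ∀ w s z → w * (s - z) ≡ w * s + - (w * z)
        distrib = solve 3 (λ w s z → w :* (s :- z) := w :* s :- w :* z) refl
        cancel : ∀ e x p q → e * (x - p) + e * (p + - q) ≡ e * x + - (e * q)
        cancel = solve 4 (λ e x p q → e :* (x :- p) :+ e :* (p :- q) := e :* x :- e :* q) refl
      total : sum (λ l → e l * (x l - P l)) + (sum (λ l → e l * sum (λ i → wₙ i * (seq (s i (pos l)) n - z i l)))
                + (sum (λ i → excess i * wₙ i) + β * (sum wₙ - 1ℚ)))
              ≡ sum (λ l → e l * x l) - β
      total = begin
        X + (Y + (Z + β * (W - 1ℚ)))
          ≡⟨ sym (+-assoc X Y (Z + β * (W - 1ℚ))) ⟩
        (X + Y) + (Z + β * (W - 1ℚ))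
          ≡⟨ cong₂ (λ p q → p + (q + β * (W - 1ℚ)))
               (trans (sym (∑-distrib-+ (λ l → e l * (x l - P l)) (λ l → e l * sum (λ i → wₙ i * (seq (s i (pos l)) n - z i l)))))
                 (trans (sum-cong-≗ difference) (trans (∑-distrib-+ (λ l → e l * x l) (λ l → - (e l * Q l)))
                   (cong (EX +_) (sum-neg (λ l → e l * Q l))))))
               (trans (sum-cong-≗ λ i → spread (sum (λ l → e l * z i l)) β (wₙ i))
                 (trans (∑-distrib-+ (λ i → wₙ i * sum (λ l → e l * z i l)) (λ i → - β * wₙ i))
                   (cong₂ _+_ (sym (sum-swap e wₙ z)) (sym (*-distribˡ-sum (- β) wₙ))))) ⟩
        (EX + - EQ) + ((EQ + - β * W) + β * (W - 1ℚ))
          ≡⟨ finish EX EQ β W ⟩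
        EX - β ∎
        where
        X = sum (λ l → e l * (x l - P l))
        Y = sum (λ l → e l * sum (λ i → wₙ i * (seq (s i (pos l)) n - z i l)))
        Z = sum (λ i → excess i * wₙ i)
        W = sum wₙ
        EX = sum (λ l → e l * x l)
        EQ = sum (λ l → e l * Q l)
        spread : ∀ a β w → (a - β) * w ≡ w * a + - β * w
        spread = solve 3 (λ a β w → (a :- β) :* w := w :* a :+ (:- β) :* w) refl
        finish : ∀ x q β w → (x + - q) + ((q + - β * w) + β * (w - 1ℚ)) ≡ x - β
        finish = solve 4 (λ x q β w → (x :- q) :+ ((q :+ (:- β) :* w) :+ β :* (w :- con 1ℚ)) := x :- β) refl

  vertex-in-conv : ∀ {L ℓ} (u : Vec Bool ℓ) → L (toList u) → conv (slice L ℓ) (embed u)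
  vertex-in-conv u u∈ = 1 , (λ _ → 1ℝ) , (λ _ → embed u) ,
    (λ _ → u , u∈ , λ i → pointwise⇒≃ {embed u i} {embed u i} λ _ → refl) ,
    (λ _ → nonneg⇒≤ {0ℝ} {1ℝ} (nonneg-const (<⇒≤ (positive⁻¹ 1ℚ)))) ,
    pointwise⇒≃ {∑ {1} (λ _ → 1ℝ)} {1ℝ} (λ _ → +-identityʳ 1ℚ) ,
    λ j → pointwise⇒≃ {embed u j} {∑ {1} (λ _ → 1ℝ *ʳ embed u j)} λ n →
      sym (trans (+-identityʳ (1ℚ * seq (embed u j) n)) (*-identityˡ (seq (embed u j) n)))

  -- An affine function commutes with mixing when the weights sum to one; the weights may be
  -- negative.
  affine-mix : ∀ {t ℓ c} (w : Fin t → ℚ) (z : Fin t → Fin ℓ → ℚ) (y : Fin t → Fin c → ℚ) (a : Fin ℓ → ℚ) (d : Fin c → ℚ) b → sum w ≡ 1ℚ →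
    sum (λ i → w i * (b - (sum (λ l → a l * z i l) + sum (λ k → d k * y i k)))) ≡
    b - (sum (λ l → a l * sum (λ i → w i * z i l)) + sum (λ k → d k * sum (λ i → w i * y i k)))
  affine-mix w z y a d b Σw = begin
    sum (λ i → w i * (b - (P i + Q i)))
      ≡⟨ sum-cong-≗ (λ i → spread (w i) b (P i) (Q i)) ⟩
    sum (λ i → b * w i + - (w i * P i + w i * Q i))
      ≡⟨ ∑-distrib-+ (λ i → b * w i) (λ i → - (w i * P i + w i * Q i)) ⟩
    sum (λ i → b * w i) + sum (λ i → - (w i * P i + w i * Q i))
      ≡⟨ cong₂ _+_ (trans (sym (*-distribˡ-sum b w)) (trans (cong (b *_) Σw) (*-identityʳ b)))
           (trans (sum-neg (λ i → w i * P i + w i * Q i)) (cong -_ (∑-distrib-+ (λ i → w i * P i) (λ i → w i * Q i)))) ⟩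
    b - (sum (λ i → w i * P i) + sum (λ i → w i * Q i))
      ≡⟨ cong₂ (λ p q → b - (p + q)) (sym (sum-swap a w z)) (sym (sum-swap d w y)) ⟩
    b - (sum (λ l → a l * sum (λ i → w i * z i l)) + sum (λ k → d k * sum (λ i → w i * y i k))) ∎
    where
    open ≡-Reasoning
    open +-*-Solver using (solve; _:=_; _:+_; _:*_; _:-_; :-_)
    P Q : Fin _ → ℚ
    P i = sum λ l → a l * z i l
    Q i = sum λ k → d k * y i k
    spread : ∀ w b p q → w * (b - (p + q)) ≡ b * w + - (w * p + w * q)
    spread = solve 4 (λ w b p q → w :* (b :- (p :+ q)) := b :* w :+ :- (w :* p :+ w :* q)) refl

  seq-affine : ∀ {r ℓ c} (A : Matrix r ℓ) (B : Matrix r c) (x : Vector ℝ ℓ) (y : Vector ℝ c) j n →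
    seq ((A · x +ᵛ B · y) j) n ≡ sum (λ l → seq (A j l) n * seq (x l) n) + sum (λ k → seq (B j k) n * seq (y k) n)
  seq-affine A B x y j n = cong₂ _+_ (seq-∑ (λ l → A j l *ʳ x l) n) (seq-∑ (λ k → B j k *ʳ y k) n)

  module Relaxation {L : Language} {ℓ r c : ℕ} (A : Matrix r ℓ) (B : Matrix r c) (b : Vector ℝ r)
                    (describes : ∀ x → conv (slice L ℓ) x ⇔ ∃ λ y → A · x +ᵛ B · y ≤ᵛ b) where

    -- Opaque because comparing unfolded slacks compares convergence proofs.
    opaque
      slack : Vec Bool ℓ → Vector ℝ c → Fin r → ℝ
      slack u y j = b j -ʳ (A · embed u +ᵛ B · y) j

      seq-slack : ∀ u y j n → seq (slack u y j) n ≡ seq (b j) n - seq ((A · embed u +ᵛ B · y) j) n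
      seq-slack u y j n = seq-minus (b j) ((A · embed u +ᵛ B · y) j) n

    slack-nonneg : ∀ u y j → (A · embed u +ᵛ B · y) j ≤ʳ b j → Nonneg (seq (slack u y j))
    slack-nonneg u y j le = nonneg-cong {λ n → seq (b j) n - seq ((A · embed u +ᵛ B · y) j) n} {seq (slack u y j)}
      (λ n → sym (seq-slack u y j n))
      (≤⇒nonneg {(A · embed u +ᵛ B · y) j} {b j} le)

    lift-vertex : ∀ u → L (toList u) → ∃ λ y → ∀ j → Nonneg (seq (slack u y j))
    lift-vertex u u∈ =
      let y , le = Equivalence.to (describes (embed u)) (vertex-in-conv {L} u u∈)
      in y , λ j → slack-nonneg u y j (le j)

    module _ {t : ℕ} (w : Fin t → ℚ) (u : Fin t → Vec Bool ℓ) (y : Fin t → Vector ℝ c) where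

      point : Vector ℝ ℓ
      point l = fromℚ (sum λ i → w i * indicator (lookup (u i) l))

      -- Slack is affine in the vertex together with its lift, so the slack of the mixed point, with
      -- the lifts mixed in the same way, is the mix of the slacks. Where that is nonnegative the
      -- mixed point satisfies the inequalities and hence lies in the hull, even when some weights
      -- are negative.
      combination-in-conv : sum w ≡ 1ℚ → (∀ j → Nonneg (λ n → sum λ i → w i * seq (slack (u i) (y i) j) n)) →
                            conv (slice L ℓ) point
      combination-in-conv Σw h = Equivalence.from (describes point) (y′ , λ j →
        nonneg⇒≤ {(A · point +ᵛ B · y′) j} {b j} (nonneg-cong (rewritten j) (h j)))
        where
        y′ : Vector ℝ c
        y′ k = ∑ λ i → fromℚ (w i) *ʳ y i k
        module _ (j : Fin r) (n : ℕ) where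
          slack-value : ∀ i → seq (slack (u i) (y i) j) n ≡
            seq (b j) n - (sum (λ l → seq (A j l) n * indicator (lookup (u i) l)) + sum (λ k → seq (B j k) n * seq (y i k) n))
          slack-value i = trans (seq-slack (u i) (y i) j n)
            (cong (λ p → seq (b j) n - p) (trans (seq-affine A B (embed (u i)) (y i) j n)
              (cong (_+ sum (λ k → seq (B j k) n * seq (y i k) n))
                (sum-cong-≗ λ l → cong (seq (A j l) n *_) (seq-embed (u i) l n)))))
          y′-value : seq ((A · point +ᵛ B · y′) j) n ≡
            sum (λ l → seq (A j l) n * sum (λ i → w i * indicator (lookup (u i) l))) + sum (λ k → seq (B j k) n * sum (λ i → w i * seq (y i k) n))
          y′-value = trans (seq-affine A B point y′ j n)
            (cong (λ q → sum (λ l → seq (A j l) n * sum (λ i → w i * indicator (lookup (u i) l))) + q)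
              (sum-cong-≗ λ k → cong (seq (B j k) n *_) (seq-∑ (λ i → fromℚ (w i) *ʳ y i k) n)))
          rewritten : sum (λ i → w i * seq (slack (u i) (y i) j) n) ≡ seq (b j) n - seq ((A · point +ᵛ B · y′) j) n
          rewritten = trans (sum-cong-≗ λ i → cong (w i *_) (slack-value i))
            (trans (affine-mix w (λ i l → indicator (lookup (u i) l)) (λ i k → seq (y i k) n)
                     (λ l → seq (A j l) n) (λ k → seq (B j k) n) (seq (b j) n) Σw)
              (cong (λ p → seq (b j) n - p) (sym y′-value)))

    -- Division by the total weight reduces to weights of sum one, since nonnegative slack survives
    -- positive scaling; the bound is then scaled back.
    combination-lower-bound : ∀ {t m} (w : Fin t → ℚ) (u : Fin t → Vec Bool ℓ) (y : Fin t → Vector ℝ c) →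
      0ℚ < sum w → (∀ j → Nonneg (λ n → sum λ i → w i * seq (slack (u i) (y i) j) n)) →
      (e : Fin m → ℚ) (pos : Fin m → Fin ℓ) {β : ℚ} →
      (∀ u → L (toList u) → β ≤ sum λ l → e l * indicator (lookup u (pos l))) →
      β * sum w ≤ sum λ i → w i * sum λ l → e l * indicator (lookup (u i) (pos l))
    combination-lower-bound {t} {m} w u y W>0 h e pos {β} bound = begin
      β * W                               ≤⟨ *-monoʳ-≤-nonNeg W {{pos⇒nonNeg W {{positive W>0}}}} β≤ ⟩
      sum (λ i → w′ i * F i) * W          ≡⟨ *-distribʳ-sum W (λ i → w′ i * F i) ⟩
      sum (λ i → w′ i * F i * W)          ≡⟨ sum-cong-≗ (λ i → unscale (w i) (F i)) ⟩
      sum (λ i → w i * F i)               ∎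
      where
      open ≤-Reasoning
      open +-*-Solver using (solve; _:=_; _:*_; _:+_; _:-_)
      W = sum w
      W≢0 = pos⇒nonZero W {{positive W>0}}
      W⁻¹ = (1/ W) {{W≢0}}
      W⁻¹≥0 : 0ℚ ≤ W⁻¹
      W⁻¹≥0 = nonNegative⁻¹ W⁻¹ {{pos⇒nonNeg W⁻¹ {{1/pos⇒pos W {{positive W>0}}}}}}
      w′ : Fin t → ℚ
      w′ i = W⁻¹ * w i
      F : Fin t → ℚ
      F i = sum λ l → e l * indicator (lookup (u i) (pos l))
      unscale : ∀ a f → W⁻¹ * a * f * W ≡ a * f
      unscale a f = trans (solve 4 (λ v a f w → v :* a :* f :* w := v :* w :* (a :* f)) refl W⁻¹ a f W)
        (trans (cong (_* (a * f)) (*-inverseˡ W {{W≢0}})) (*-identityˡ (a * f)))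
      scaled : ∀ j → Nonneg (λ n → sum λ i → w′ i * seq (slack (u i) (y i) j) n)
      scaled j = nonneg-cong (λ n → trans (*-distribˡ-sum W⁻¹ (λ i → w i * seq (slack (u i) (y i) j) n))
          (sum-cong-≗ λ i → sym (*-assoc W⁻¹ (w i) (seq (slack (u i) (y i) j) n))))
        (nonneg-* W⁻¹≥0 (h j))
      in-conv : conv (slice L ℓ) (point w′ u y)
      in-conv = combination-in-conv w′ u y (trans (sym (*-distribˡ-sum W⁻¹ w)) (*-inverseˡ W {{W≢0}})) scaled
      β≤ : β ≤ sum (λ i → w′ i * F i)
      β≤ = subst₂ _≤_ (+-identityʳ β) (trans (add β _) (sum-swap e w′ (λ i l → indicator (lookup (u i) (pos l)))))
        (+-monoʳ-≤ β (nonneg-const⁻¹ (conv-lower-bound {L} {v = point w′ u y} e pos bound in-conv)))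
        where
        add : ∀ β s → β + (s - β) ≡ s
        add = solve 2 (λ β s → β :+ (s :- β) := s) refl

-- Integer weights and Hamming distance.

module Integrality where

  open import Data.Integer.Base as ℤ using (ℤ; +_; 0ℤ; 1ℤ)
  import Data.Integer.Properties as ℤₚ
  import Data.Integer.Solver as ℤ-Solver
  import Data.Nat.Base as ℕ
  import Data.Nat.Coprimality as Coprime
  open import Data.Rational.Base hiding (_≃_)
  open import Data.Rational.Properties
  open import Data.Rational.Solver using (module +-*-Solver)
  import Data.Rational.Unnormalised.Base as ℚᵘ
  import Data.Rational.Unnormalised.Properties as ℚᵘₚ
  open import Data.Vec.Functional using (Vector)
  open import Algebra.Properties.Semiring.Sum ℤₚ.+-*-semiring using () renaming (sum to sumᶻ)

  open import Defs using (ℝ; seq; Matrix; _·_; _+ᵛ_; _≤ᵛ_; conv; slice; Language)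
  open Perceptron using (sum-nonneg)
  open Reals
  open Polytopes

  -- Built with the constructor, so that numerator and denominator 1 are visible to computation and
  -- order reduces to that of the integers.
  ι : ℤ → ℚ
  ι i = mkℚ i 0 (Coprime.sym (Coprime.1-coprimeTo _))

  ι-+ : ∀ i j → ι (i ℤ.+ j) ≡ ι i + ι j
  ι-+ i j = toℚᵘ-injective (ℚᵘₚ.≃-trans (ℚᵘ.*≡* (identity i j)) (ℚᵘₚ.≃-sym (toℚᵘ-homo-+ (ι i) (ι j))))
    where
    open ℤ-Solver.+-*-Solver using (solve; _:=_; _:+_; _:*_; con)
    identity : ∀ i j → (i ℤ.+ j) ℤ.* 1ℤ ≡ (i ℤ.* 1ℤ ℤ.+ j ℤ.* 1ℤ) ℤ.* 1ℤ
    identity = solve 2 (λ i j → (i :+ j) :* con 1ℤ := (i :* con 1ℤ :+ j :* con 1ℤ) :* con 1ℤ) refl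

  ι-* : ∀ i j → ι (i ℤ.* j) ≡ ι i * ι j
  ι-* i j = toℚᵘ-injective (ℚᵘₚ.≃-trans (ℚᵘ.*≡* refl) (ℚᵘₚ.≃-sym (toℚᵘ-homo-* (ι i) (ι j))))

  ι-neg : ∀ i → ι (ℤ.- i) ≡ - ι i
  ι-neg i = toℚᵘ-injective (ℚᵘₚ.≃-trans (ℚᵘ.*≡* refl) (ℚᵘₚ.≃-sym (toℚᵘ-homo‿- (ι i))))

  ι-mono-≤ : ∀ {i j} → i ℤ.≤ j → ι i ≤ ι j
  ι-mono-≤ {i} {j} h = *≤* (subst₂ ℤ._≤_ (sym (ℤₚ.*-identityʳ i)) (sym (ℤₚ.*-identityʳ j)) h)

  ι-cancel-≤ : ∀ {i j} → ι i ≤ ι j → i ℤ.≤ j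
  ι-cancel-≤ {i} {j} (*≤* h) = subst₂ ℤ._≤_ (ℤₚ.*-identityʳ i) (ℤₚ.*-identityʳ j) h

  ι-mono-< : ∀ {i j} → i ℤ.< j → ι i < ι j
  ι-mono-< {i} {j} h = *<* (subst₂ ℤ._<_ (sym (ℤₚ.*-identityʳ i)) (sym (ℤₚ.*-identityʳ j)) h)

  ι-sum : ∀ {k} (f : Fin k → ℤ) → ι (sumᶻ f) ≡ sum (ι ∘ f)
  ι-sum {zero}  f = refl
  ι-sum {suc k} f = trans (ι-+ (f zero) (sumᶻ (f ∘ suc))) (cong (λ q → ι (f zero) + q) (ι-sum (f ∘ suc)))

  mismatch : Bool → Bool → ℕ
  mismatch true  true  = 0
  mismatch false false = 0
  mismatch _     _     = 1

  mismatch≤1 : ∀ a b → mismatch a b ℕ.≤ 1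
  mismatch≤1 true  true  = ℕ.z≤n
  mismatch≤1 true  false = ℕ.s≤s ℕ.z≤n
  mismatch≤1 false true  = ℕ.s≤s ℕ.z≤n
  mismatch≤1 false false = ℕ.z≤n

  mismatch-≢ : ∀ {a b} → a ≢ b → mismatch a b ≡ 1
  mismatch-≢ {true}  {true}  a≢b = contradiction refl a≢b
  mismatch-≢ {true}  {false} a≢b = refl
  mismatch-≢ {false} {true}  a≢b = refl
  mismatch-≢ {false} {false} a≢b = contradiction refl a≢b

  term≤sum : ∀ {k} (f : Fin k → ℤ) → (∀ i → 0ℤ ℤ.≤ f i) → ∀ i → f i ℤ.≤ sumᶻ f
  term≤sum f f≥0 zero    = subst (ℤ._≤ sumᶻ f) (ℤₚ.+-identityʳ (f zero)) (ℤₚ.+-monoʳ-≤ (f zero) (sum-nonneg (f≥0 ∘ suc)))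
  term≤sum f f≥0 (suc i) = subst (ℤ._≤ sumᶻ f) (ℤₚ.+-identityˡ (f (suc i))) (ℤₚ.+-mono-≤ (f≥0 zero) (term≤sum (f ∘ suc) (f≥0 ∘ suc) i))

  mismatches : ∀ {ℓ m} → (Fin m → Fin ℓ) → Vec Bool m → Vec Bool ℓ → ℤ
  mismatches pos x u = sumᶻ λ l → + mismatch (lookup u (pos l)) (lookup x l)

  module _ {L : Language} {ℓ r c : ℕ} (A : Matrix r ℓ) (B : Matrix r c) (b : Vector ℝ r)
           (describes : ∀ x → conv (slice L ℓ) x ⇔ ∃ λ y → A · x +ᵛ B · y ≤ᵛ b) where

    open Relaxation {L} A B b describes

    -- Hamming distance to x is affine on the cube, so the bound of at least one
    -- mismatch on the slice extends to combinations with nonnegative slack.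
    mismatch-bound : ∀ {t m} (w : Fin t → ℤ) (u : Fin t → Vec Bool ℓ) (y : Fin t → Vector ℝ c) →
      0ℤ ℤ.< sumᶻ w → (∀ j → Nonneg (λ n → sum λ i → ι (w i) * seq (slack (u i) (y i) j) n)) →
      (pos : Fin m → Fin ℓ) (x : Vec Bool m) →
      (∀ u → L (toList u) → ∃ λ l → lookup u (pos l) ≢ lookup x l) →
      sumᶻ w ℤ.≤ sumᶻ λ i → w i ℤ.* mismatches pos x (u i)
    mismatch-bound {t} {m} w u y w>0 h pos x differ = ι-cancel-≤ (begin
      ι (sumᶻ w)                                        ≡⟨ ι-sum w ⟩
      W                                                 ≡⟨ split o W ⟩
      (1ℚ - o) * W + o * W                              ≤⟨ +-monoˡ-≤ (o * W) (combination-lower-bound (ι ∘ w) u y W>0 h e pos lower) ⟩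
      sum (λ i → ι (w i) * F (u i)) + o * W             ≡⟨ cong (λ q → sum (λ i → ι (w i) * F (u i)) + q) (*-distribˡ-sum o (ι ∘ w)) ⟩
      sum (λ i → ι (w i) * F (u i)) + sum (λ i → o * ι (w i)) ≡⟨ sym (∑-distrib-+ (λ i → ι (w i) * F (u i)) (λ i → o * ι (w i))) ⟩
      sum (λ i → ι (w i) * F (u i) + o * ι (w i))       ≡⟨ sum-cong-≗ (λ i → trans (factor (ι (w i)) (F (u i)) o)
                                                             (trans (cong (ι (w i) *_) (affine (u i))) (sym (ι-* (w i) (mismatches pos x (u i)))))) ⟩
      sum (λ i → ι (w i ℤ.* mismatches pos x (u i)))    ≡⟨ sym (ι-sum (λ i → w i ℤ.* mismatches pos x (u i))) ⟩
      ι (sumᶻ λ i → w i ℤ.* mismatches pos x (u i))     ∎)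
      where
      open ≤-Reasoning
      open +-*-Solver using (solve; _:=_; _:+_; _:*_; _:-_; con)
      W = sum (ι ∘ w)
      W>0 : 0ℚ < W
      W>0 = subst (0ℚ <_) (ι-sum w) (ι-mono-< w>0)
      -- Against a bit `b` of `x`, the mismatch of `a` is `a` if `b` is false and `1 - a` if it is
      -- true: `e` holds the slopes and `o` the sum of the constant terms.
      e : Fin m → ℚ
      e l = if lookup x l then - 1ℚ else 1ℚ
      o : ℚ
      o = sum (λ l → indicator (lookup x l))
      F : Vec Bool ℓ → ℚ
      F u = sum λ l → e l * indicator (lookup u (pos l))
      pointwise : ∀ a b → (if b then - 1ℚ else 1ℚ) * indicator a + indicator b ≡ ι (+ mismatch a b)
      pointwise true  true  = refl
      pointwise true  false = refl
      pointwise false true  = refl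
      pointwise false false = refl
      affine : ∀ u → F u + o ≡ ι (mismatches pos x u)
      affine u = trans (sym (∑-distrib-+ (λ l → e l * indicator (lookup u (pos l))) (λ l → indicator (lookup x l))))
        (trans (sum-cong-≗ λ l → pointwise (lookup u (pos l)) (lookup x l))
          (sym (ι-sum (λ l → + mismatch (lookup u (pos l)) (lookup x l)))))
      split : ∀ o w → w ≡ (1ℚ - o) * w + o * w
      split = solve 2 (λ o w → w := (con 1ℚ :- o) :* w :+ o :* w) refl
      factor : ∀ w f o → w * f + o * w ≡ w * (f + o)
      factor = solve 3 (λ w f o → w :* f :+ o :* w := w :* (f :+ o)) refl
      lower : ∀ u → L (toList u) → 1ℚ - o ≤ F u
      lower u u∈ = subst (1ℚ - o ≤_) (trans (cong (_- o) (sym (affine u))) (back (F u) o))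
        (+-monoˡ-≤ (- o) (ι-mono-≤ {1ℤ} (subst (ℤ._≤ mismatches pos x u)
          (cong +_ (mismatch-≢ (proj₂ (differ u u∈))))
          (term≤sum (λ l → + mismatch (lookup u (pos l)) (lookup x l)) (λ _ → ℤ.+≤+ ℕ.z≤n) (proj₁ (differ u u∈))))))
        where
        back : ∀ f o → f + o - o ≡ f
        back = solve 2 (λ f o → f :+ o :- o := f) refl

-- Rounding slacks relative to their maxima.

module Rounding where

  open import Data.Integer.Base as ℤ using (ℤ; +_; -[1+_]; 0ℤ; 1ℤ)
  import Data.Integer.Properties as ℤₚ
  import Data.Nat.Base as ℕ
  import Data.Nat.Properties as ℕₚ
  open import Data.Rational.Base hiding (_≃_)
  open import Data.Rational.Properties
  open import Data.Rational.Solver using (module +-*-Solver)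
  open import Algebra.Properties.Semiring.Sum ℤₚ.+-*-semiring using () renaming (sum to sumᶻ)

  open Polytopes using (sum-neg)
  open import Defs using (ℝ; seq; fromℚ) renaming (_*_ to _*ʳ_)
  open Reals
  open Integrality

  infix 4 _≼_

  _≼_ : Sequence → Sequence → Set
  s ≼ t = Nonneg (λ n → t n - s n)

  ≼-refl : ∀ {s} → s ≼ s
  ≼-refl {s} = nonneg-cong (λ n → sym (+-inverseʳ (s n))) (nonneg-const ≤-refl)

  ≼-trans : ∀ {s t u} → s ≼ t → t ≼ u → s ≼ u
  ≼-trans {s} {t} {u} p q = nonneg-cong (λ n → chain (s n) (t n) (u n)) (nonneg-+ p q)
    where
    open +-*-Solver using (solve; _:=_; _:+_; _:-_)
    chain : ∀ s t u → (t - s) + (u - t) ≡ u - s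
    chain = solve 3 (λ s t u → (t :- s) :+ (u :- t) := u :- s) refl

  ≼-total : ∀ x y → ¬ ¬ (seq x ≼ seq y ⊎ seq y ≼ seq x)
  ≼-total x y k = dichotomy (y -ʳ x) λ
    { (inj₁ p) → k (inj₁ (nonneg-cong (seq-minus y x) p))
    ; (inj₂ p) → k (inj₂ (nonneg-cong (λ n → trans (cong -_ (seq-minus y x n)) (swap (seq y n) (seq x n))) p)) }
    where
    open +-*-Solver using (solve; _:=_; :-_; _:-_)
    swap : ∀ y x → - (y - x) ≡ x - y
    swap = solve 2 (λ y x → :- (y :- x) := x :- y) refl

  maximum : ∀ {k} (f : Fin (suc k) → ℝ) → ¬ ¬ ∃ λ i → ∀ j → seq (f j) ≼ seq (f i)
  maximum {zero}  f none = none (zero , λ { zero → ≼-refl {seq (f zero)} })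
  maximum {suc k} f none = maximum (f ∘ suc) λ (i , max) → ≼-total (f zero) (f (suc i)) λ
    { (inj₁ le) → none (suc i , λ { zero → le ; (suc j) → max j })
    ; (inj₂ ge) → none (zero , λ { zero → ≼-refl {seq (f zero)} ; (suc j) → ≼-trans {seq (f (suc j))} {seq (f (suc i))} {seq (f zero)} (max j) ge }) }

  times : ℕ → Sequence → Sequence
  times a s n = ι (+ a) * s n

  -- w is N x / μ rounded down.
  Floor : ℕ → Sequence → Sequence → ℕ → Set
  Floor N x μ w = times w μ ≼ times N x × times N x ≼ times (suc w) μ

  times-suc : ∀ a q → ι (+ suc a) * q ≡ q + ι (+ a) * q
  times-suc a q = trans (cong (_* q) (ι-+ 1ℤ (+ a))) (trans (*-distribʳ-+ q 1ℚ (ι (+ a))) (cong (_+ ι (+ a) * q) (*-identityˡ q)))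

  0≤ι : ∀ a → 0ℚ ≤ ι (+ a)
  0≤ι a = ι-mono-≤ {0ℤ} {+ a} (ℤ.+≤+ ℕ.z≤n)

  nonneg-times : ∀ a {s} → Nonneg s → Nonneg (times a s)
  nonneg-times a = nonneg-* (0≤ι a)

  -- Linear search for the last multiple of `μ` that is at most `N` times `x`. Each comparison is
  -- available only up to double negation, and so is the result. If the search reaches `N`, then
  -- `x ≼ μ` supplies the upper half. Nothing is divided by `μ`, so the case of zero slack
  -- everywhere is included.
  scaled-floor : ∀ N (x μ : ℝ) → Nonneg (seq x) → seq x ≼ seq μ → ¬ ¬ ∃ λ w → w ℕ.≤ N × Floor N (seq x) (seq μ) w
  scaled-floor N x μ x≥0 x≼μ none = search N λ
    { (inj₂ (w , w<N , fl)) → none (w , ℕₚ.<⇒≤ w<N , fl)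
    ; (inj₁ low) → none (N , ℕₚ.≤-refl , low , nonneg-cong (λ n → top (seq μ n) (seq x n))
        (nonneg-+ μ≥0 (nonneg-times N x≼μ))) }
    where
    open +-*-Solver using (solve; _:=_; _:+_; _:-_; _:*_)
    μ≥0 : Nonneg (seq μ)
    μ≥0 = nonneg-cong (λ n → add (seq x n) (seq μ n)) (nonneg-+ x≥0 x≼μ)
      where
      add : ∀ x μ → x + (μ - x) ≡ μ
      add = solve 2 (λ x μ → x :+ (μ :- x) := μ) refl
    top : ∀ μ x → μ + ι (+ N) * (μ - x) ≡ ι (+ suc N) * μ - ι (+ N) * x
    top μ x = trans (expand (ι (+ N)) μ x) (cong (_- ι (+ N) * x) (sym (times-suc N μ)))
      where
      expand : ∀ a μ x → μ + a * (μ - x) ≡ μ + a * μ - a * x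
      expand = solve 3 (λ a μ x → μ :+ a :* (μ :- x) := μ :+ a :* μ :- a :* x) refl
    scaled : ℕ → ℝ → ℝ
    scaled a y = fromℚ (ι (+ a)) *ʳ y
    search : ∀ t → ¬ ¬ (times t (seq μ) ≼ times N (seq x) ⊎ ∃ λ w → w ℕ.< t × Floor N (seq x) (seq μ) w)
    search zero    k = k (inj₁ (nonneg-cong (λ n → sym (drop (seq x n) (seq μ n))) (nonneg-times N x≥0)))
      where
      drop : ∀ x μ → ι (+ N) * x - ι 0ℤ * μ ≡ ι (+ N) * x
      drop x μ = trans (cong (λ q → ι (+ N) * x - q) (*-zeroˡ μ)) (+-identityʳ (ι (+ N) * x))
    search (suc t) k = search t λ
      { (inj₂ (w , w<t , fl)) → k (inj₂ (w , ℕₚ.m<n⇒m<1+n w<t , fl))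
      ; (inj₁ low) → ≼-total (scaled (suc t) μ) (scaled N x) λ
          { (inj₁ le) → k (inj₁ le)
          ; (inj₂ ge) → k (inj₂ (t , ℕₚ.≤-refl , low , ge)) } }

  sum-dominates : ∀ {k} (s : Fin k → Sequence) → (∀ i → Nonneg (s i)) → ∀ i → s i ≼ (λ n → sum λ j → s j n)
  sum-dominates {suc k} s s≥0 zero = nonneg-cong (λ n → front (s zero n) (sum λ j → s (suc j) n)) (nonneg-sum (s≥0 ∘ suc))
    where
    open +-*-Solver using (solve; _:=_; _:+_; _:-_)
    front : ∀ a b → b ≡ a + b - a
    front = solve 2 (λ a b → b := a :+ b :- a) refl
  sum-dominates {suc k} s s≥0 (suc i) = nonneg-cong (λ n → back (s zero n) (sum λ j → s (suc j) n) (s (suc i) n))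
    (nonneg-+ (s≥0 zero) (sum-dominates (s ∘ suc) (s≥0 ∘ suc) i))
    where
    open +-*-Solver using (solve; _:=_; _:+_; _:-_)
    back : ∀ a b c → a + (b - c) ≡ a + b - c
    back = solve 3 (λ a b c → a :+ (b :- c) := a :+ b :- c) refl

  -- A nonnegative coefficient uses the lower half of `Floor`, a negative one the upper half, where
  -- the unit between the two halves is multiplied by the absolute value of the coefficient.
  -- Subtracting that value covers both signs.
  floor-term : ∀ N {x μ w} → Nonneg μ → Floor N x μ w → ∀ C →
               (λ n → ι (C ℤ.* + w ℤ.- + ℤ.∣ C ∣) * μ n) ≼ (λ n → ι (+ N) * (ι C * x n))
  floor-term N {x} {μ} {w} μ≥0 (low , _) (+ c) = nonneg-cong (λ n → trans
      (regroup (ι (+ c)) (ι (+ N)) (ι (+ w)) (x n) (μ n))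
      (cong (λ q → ι (+ N) * (ι (+ c) * x n) - q * μ n) (sym (ι-affine (+ c)))))
    (nonneg-+ (nonneg-times c low) (nonneg-times c μ≥0))
    where
    open +-*-Solver using (solve; _:=_; _:+_; _:-_; _:*_)
    ι-affine : ∀ C → ι (C ℤ.* + w ℤ.- + ℤ.∣ C ∣) ≡ ι C * ι (+ w) - ι (+ ℤ.∣ C ∣)
    ι-affine C = trans (ι-+ (C ℤ.* + w) (ℤ.- + ℤ.∣ C ∣)) (cong₂ _+_ (ι-* C (+ w)) (ι-neg (+ ℤ.∣ C ∣)))
    regroup : ∀ c N w x μ → c * (N * x - w * μ) + c * μ ≡ N * (c * x) - (c * w - c) * μ
    regroup = solve 5 (λ c N w x μ → c :* (N :* x :- w :* μ) :+ c :* μ := N :* (c :* x) :- (c :* w :- c) :* μ) refl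
  floor-term N {x} {μ} {w} μ≥0 (_ , high) -[1+ c ] = nonneg-cong (λ n → trans
      (cong (λ q → ι (+ suc c) * (q - ι (+ N) * x n)) (times-suc w (μ n)))
      (trans (regroup (ι (+ suc c)) (ι (+ N)) (ι (+ w)) (x n) (μ n))
        (cong₂ (λ p q → ι (+ N) * (p * x n) - q * μ n) (sym (ι-neg (+ suc c))) (sym ι-affine))))
    (nonneg-times (suc c) high)
    where
    open +-*-Solver using (solve; _:=_; _:+_; _:-_; _:*_; :-_)
    ι-affine : ι (-[1+ c ] ℤ.* + w ℤ.- + suc c) ≡ (- ι (+ suc c)) * ι (+ w) - ι (+ suc c)
    ι-affine = trans (ι-+ (-[1+ c ] ℤ.* + w) (ℤ.- + suc c))
      (cong₂ _+_ (trans (ι-* -[1+ c ] (+ w)) (cong (_* ι (+ w)) (ι-neg (+ suc c)))) (ι-neg (+ suc c)))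
    regroup : ∀ c N w x μ → c * (μ + w * μ - N * x) ≡ N * ((- c) * x) - ((- c) * w - c) * μ
    regroup = solve 5 (λ c N w x μ → c :* (μ :+ w :* μ :- N :* x) := N :* ((:- c) :* x) :- ((:- c) :* w :- c) :* μ) refl

  -- Each weight loses at most its absolute value to the rounding; h copies of
  -- the maximisers (one of which attains μ) pay for that.
  rounded-combination : ∀ {k r N} (h : ℕ) (C : Fin k → ℤ) (x : Fin k → Sequence) (W : Fin k → ℕ) (μ : Fin r → Sequence) j →
    0 ℕ.< N → (∀ i → Nonneg (μ i)) → (∀ i → Floor N (x i) (μ j) (W i)) →
    0ℤ ℤ.≤ sumᶻ (λ i → C i ℤ.* + W i ℤ.- + ℤ.∣ C i ∣) ℤ.+ + h ℤ.* + N →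
    Nonneg (λ n → sum (λ i → ι (C i) * x i n) + sum (λ i → ι (+ h) * μ i n))
  rounded-combination {N = N} h C x W μ j N>0 μ≥0 floors enough =
    nonneg-cong (λ n → unscale (sum (λ i → ι (C i) * x i n) + sum (λ i → ι (+ h) * μ i n)))
      (nonneg-* N⁻¹≥0 (nonneg-cong collect
        (nonneg-+ (nonneg-sum λ i → floor-term N {x i} {μ j} {W i} (μ≥0 j) (floors i) (C i))
        -- The slack of all maximisers at the inequality is at least that of maximiser `j` alone,
        -- which is `μ j`; the hypothesis `enough` says that `h` times it outweighs the deficit.
        (nonneg-+ (nonneg-times N (nonneg-times h (sum-dominates μ μ≥0 j)))
                  (nonneg-* (ι-mono-≤ enough) (μ≥0 j))))))
    where
    open ≡-Reasoning
    open +-*-Solver using (solve; _:=_; _:+_; _:-_; _:*_; :-_)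
    ιN>0 : 0ℚ < ι (+ N)
    ιN>0 = ι-mono-< {0ℤ} (ℤ.+<+ N>0)
    ιN≢0 = pos⇒nonZero (ι (+ N)) {{positive ιN>0}}
    N⁻¹ = (1/ ι (+ N)) {{ιN≢0}}
    N⁻¹≥0 : 0ℚ ≤ N⁻¹
    N⁻¹≥0 = nonNegative⁻¹ N⁻¹ {{pos⇒nonNeg N⁻¹ {{1/pos⇒pos (ι (+ N)) {{positive ιN>0}}}}}}
    unscale : ∀ q → N⁻¹ * (ι (+ N) * q) ≡ q
    unscale q = trans (sym (*-assoc N⁻¹ (ι (+ N)) q)) (trans (cong (_* q) (*-inverseˡ (ι (+ N)) {{ιN≢0}})) (*-identityˡ q))
    a : Fin _ → ℤ
    a i = C i ℤ.* + W i ℤ.- + ℤ.∣ C i ∣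
    collect : ∀ n → sum (λ i → ι (+ N) * (ι (C i) * x i n) - ι (a i) * μ j n)
                    + (ι (+ N) * (ι (+ h) * (sum (λ i → μ i n) - μ j n)) + ι (sumᶻ a ℤ.+ + h ℤ.* + N) * μ j n)
                  ≡ ι (+ N) * (sum (λ i → ι (C i) * x i n) + sum (λ i → ι (+ h) * μ i n))
    collect n = begin
      sum (λ i → ι (+ N) * (ι (C i) * x i n) - ι (a i) * m) + (ι (+ N) * (ι (+ h) * (M - m)) + ι (sumᶻ a ℤ.+ + h ℤ.* + N) * m)
        ≡⟨ cong₂ (λ p q → p + (ι (+ N) * (ι (+ h) * (M - m)) + q * m))
             (trans (∑-distrib-+ (λ i → ι (+ N) * (ι (C i) * x i n)) (λ i → - (ι (a i) * m)))
               (cong₂ _+_ (sym (*-distribˡ-sum (ι (+ N)) (λ i → ι (C i) * x i n)))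
                 (trans (sum-neg (λ i → ι (a i) * m)) (cong -_ (sym (*-distribʳ-sum m (ι ∘ a)))))))
             (trans (ι-+ (sumᶻ a) (+ h ℤ.* + N)) (cong₂ _+_ (ι-sum a) (ι-* (+ h) (+ N)))) ⟩
      (ι (+ N) * X - A * m) + (ι (+ N) * (ι (+ h) * (M - m)) + (A + ι (+ h) * ι (+ N)) * m)
        ≡⟨ finish (ι (+ N)) X A m (ι (+ h)) M ⟩
      ι (+ N) * (X + ι (+ h) * M)
        ≡⟨ cong (λ q → ι (+ N) * (X + q)) (*-distribˡ-sum (ι (+ h)) (λ i → μ i n)) ⟩
      ι (+ N) * (X + sum (λ i → ι (+ h) * μ i n)) ∎
      where
      m = μ j n
      M = sum (λ i → μ i n)
      X = sum (λ i → ι (C i) * x i n)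
      A = sum (ι ∘ a)
      finish : ∀ N X A m h M → (N * X - A * m) + (N * (h * (M - m)) + (A + h * N) * m) ≡ N * (X + h * M)
      finish = solve 6 (λ N X A m h M → (N :* X :- A :* m) :+ (N :* (h :* (M :- m)) :+ (A :+ h :* N) :* m) := N :* (X :+ h :* M)) refl

-- Extracting finite integer data from the polyhedron.

module Extraction where

  open import Data.Fin.Properties using (splitAt-↑ˡ; splitAt-↑ʳ)
  open import Data.Integer.Base as ℤ using (ℤ; +_; 0ℤ; ∣_∣; _+_; _*_; _-_; -_; _≤_; _<_)
  open import Data.Integer.Properties
  import Data.Nat.Base as ℕ
  open import Data.Vec.Functional using (Vector)
  open import Algebra.Properties.Semiring.Sum +-*-semiring using (sum; sum-cong-≗)

  open import Defs using (ℝ; seq; Matrix; _·_; _+ᵛ_; _≤ᵛ_; conv; slice; Language)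
  open Perceptron
  open Spanner
  open Reals using (Nonneg; nonneg-cong) renaming (sum to sumℚ; sum-cong-≗ to sumℚ-cong)
  import Data.Rational.Base as ℚ
  import Data.Rational.Properties as ℚₚ
  open Integrality
  open Polytopes using (module Relaxation)
  open Rounding

  sum-const : ∀ k a → sum {k} (λ _ → + a) ≡ + (k ℕ.* a)
  sum-const zero    a = refl
  sum-const (suc k) a = cong (_+_ (+ a)) (sum-const k a)

  sum-splitAt : ∀ k {r} (f : Fin (k ℕ.+ r) → ℤ) → sum f ≡ sum (λ i → f (i ↑ˡ r)) + sum (λ j → f (k ↑ʳ j))
  sum-splitAt zero    f = sym (+-identityˡ (sum f))
  sum-splitAt (suc k) {r} f = trans (cong (_+_ (f zero)) (sum-splitAt k (f ∘ suc)))
    (sym (+-assoc (f zero) (sum (λ i → f (suc (i ↑ˡ r)))) (sum (λ j → f (suc (k ↑ʳ j))))))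

  sumℚ-splitAt : ∀ k {r} (f : Fin (k ℕ.+ r) → ℚ.ℚ) → sumℚ f ≡ sumℚ (λ i → f (i ↑ˡ r)) ℚ.+ sumℚ (λ j → f (k ↑ʳ j))
  sumℚ-splitAt zero    f = sym (ℚₚ.+-identityˡ (sumℚ f))
  sumℚ-splitAt (suc k) {r} f = trans (cong (ℚ._+_ (f zero)) (sumℚ-splitAt k (f ∘ suc)))
    (sym (ℚₚ.+-assoc (f zero) (sumℚ (λ i → f (suc (i ↑ˡ r)))) (sumℚ (λ j → f (suc (k ↑ʳ j))))))

  -- Integer data that suffice to refute membership: the rounded slacks W of the
  -- points, and for each inequality a point of maximal slack.
  record Rounded {ℓ m} (L : Language) (pos : Fin m → Fin ℓ) (r N : ℕ) {V} (zs : Fin V → Vec Bool ℓ) : Set where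
    field
      W   : Fin V → Fin r → ℕ
      W≤N : ∀ z j → W z j ℕ.≤ N
      top : Fin r → Fin V
      refute : ∀ {k} (σ : Fin k → Fin V) (C : Weights k) h →
        (∀ j → 0ℤ ≤ sum (λ i → C i * + W (σ i) j - + ∣ C i ∣) + + h * + N) →
        0ℤ < sum C + sum {r} (λ _ → + h) →
        ∀ x → (∀ u → L (toList u) → ∃ λ l → lookup u (pos l) ≢ lookup x l) →
        sum C + sum {r} (λ _ → + h) ≤ sum (λ i → C i * mismatches pos x (zs (σ i))) + sum (λ j → + h * mismatches pos x (zs (top j)))

  -- The conclusion of `mismatch-bound` detached from the polyhedron, as a property of a table of
  -- slacks for listed points.
  Refutes : ∀ {ℓ m} → Language → (Fin m → Fin ℓ) → ∀ {V} → (Fin V → Vec Bool ℓ) → ∀ {r} → (Fin V → Fin r → ℝ) → Set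
  Refutes L pos {V} zs {r} s =
    ∀ {t} (w : Fin t → ℤ) (at : Fin t → Fin V) → 0ℤ < sum w →
    (∀ j → Nonneg (λ n → sumℚ λ i → ι (w i) ℚ.* seq (s (at i) j) n)) →
    ∀ x → (∀ u → L (toList u) → ∃ λ l → lookup u (pos l) ≢ lookup x l) →
    sum w ≤ sum λ i → w i * mismatches pos x (zs (at i))

  -- Maxima and floors exist only up to double negation, but there are finitely many of them, so
  -- they can be chosen together. The weights handed to `refutes` are those of `C` followed by `h`
  -- for each maximiser. The list of points is nonempty so that maxima exist.
  round : ∀ {ℓ m r V} {L : Language} (pos : Fin m → Fin ℓ) {N} → 0 ℕ.< N → (zs : Fin (suc V) → Vec Bool ℓ) →
          (s : Fin (suc V) → Fin r → ℝ) → (∀ z j → Nonneg (seq (s z j))) → Refutes L pos zs s →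
          ¬ ¬ Rounded L pos r N zs
  round {r = r} {V} {L} pos {N} N>0 zs s s≥0 refutes none =
    ¬¬-all (λ j → maximum (λ z → s z j)) λ tops →
    ¬¬-all (λ z → ¬¬-all λ j → scaled-floor N (s z j) (s (proj₁ (tops j)) j) (s≥0 z j) (proj₂ (tops j) z)) λ floors →
    none (build (λ j → proj₁ (tops j)) (λ z j → proj₁ (floors z j)) (λ z j → proj₁ (proj₂ (floors z j))) (λ z j → proj₂ (proj₂ (floors z j))))
    where
    build : (top : Fin r → Fin (suc V)) (W : Fin (suc V) → Fin r → ℕ) → (∀ z j → W z j ℕ.≤ N) →
            (∀ z j → Floor N (seq (s z j)) (seq (s (top j) j)) (W z j)) → Rounded L pos r N zs
    build top W W≤N floors = record { W = W ; W≤N = W≤N ; top = top ; refute = refute }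
      where
      module _ {k} (σ : Fin k → Fin (suc V)) (C : Weights k) (h : ℕ) where
        w : Fin (k ℕ.+ r) → ℤ
        w i = [ C , (λ _ → + h) ]′ (splitAt k i)
        at : Fin (k ℕ.+ r) → Fin (suc V)
        at i = [ σ , top ]′ (splitAt k i)
        split : (F : ℤ → Fin (suc V) → ℤ) → sum (λ i → F (w i) (at i)) ≡ sum (λ i → F (C i) (σ i)) + sum (λ j → F (+ h) (top j))
        split F = trans (sum-splitAt k (λ i → F (w i) (at i))) (cong₂ _+_
          (sum-cong-≗ λ i → cong (λ t → F ([ C , (λ _ → + h) ]′ t) ([ σ , top ]′ t)) (splitAt-↑ˡ k i r))
          (sum-cong-≗ λ j → cong (λ t → F ([ C , (λ _ → + h) ]′ t) ([ σ , top ]′ t)) (splitAt-↑ʳ k r j)))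
        splitℚ : (F : ℤ → Fin (suc V) → ℚ.ℚ) → sumℚ (λ i → F (w i) (at i)) ≡ sumℚ (λ i → F (C i) (σ i)) ℚ.+ sumℚ (λ j → F (+ h) (top j))
        splitℚ F = trans (sumℚ-splitAt k (λ i → F (w i) (at i))) (cong₂ ℚ._+_
          (sumℚ-cong λ i → cong (λ t → F ([ C , (λ _ → + h) ]′ t) ([ σ , top ]′ t)) (splitAt-↑ˡ k i r))
          (sumℚ-cong λ j → cong (λ t → F ([ C , (λ _ → + h) ]′ t) ([ σ , top ]′ t)) (splitAt-↑ʳ k r j)))
        refute : (∀ j → 0ℤ ≤ sum (λ i → C i * + W (σ i) j - + ∣ C i ∣) + + h * + N) →
                 0ℤ < sum C + sum {r} (λ _ → + h) →
                 ∀ x → (∀ u → L (toList u) → ∃ λ l → lookup u (pos l) ≢ lookup x l) →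
                 sum C + sum {r} (λ _ → + h) ≤ sum (λ i → C i * mismatches pos x (zs (σ i))) + sum (λ j → + h * mismatches pos x (zs (top j)))
        refute enough positive x differ = subst₂ _≤_ (split (λ a _ → a)) (split (λ a z → a * mismatches pos x (zs z)))
          (refutes w at (subst (0ℤ <_) (sym (split (λ a _ → a))) positive)
            (λ j → nonneg-cong (λ n → sym (splitℚ (λ a z → ι a ℚ.* seq (s z j) n)))
              (rounded-combination h C (λ i → seq (s (σ i) j)) (λ i → W (σ i) j) (λ t → seq (s (top t) j)) j N>0
                (λ t → s≥0 (top t) j) (λ i → floors (σ i) j) (enough j)))
            x differ)

  module _ {L : Language} {ℓ r c : ℕ} (A : Matrix r ℓ) (B : Matrix r c) (b : Vector ℝ r)
           (describes : ∀ x → conv (slice L ℓ) x ⇔ ∃ λ y → A · x +ᵛ B · y ≤ᵛ b) where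

    open Relaxation {L} A B b describes

    rounded : ∀ {m V} (pos : Fin m → Fin ℓ) {N} → 0 ℕ.< N → (zs : Fin (suc V) → Vec Bool ℓ) →
              (∀ z → L (toList (zs z))) → ¬ ¬ Rounded L pos r N zs
    rounded {m} {V} pos N>0 zs zs∈ = round pos N>0 zs s (λ z → proj₂ (lift-vertex (zs z) (zs∈ z)))
      λ w at → λ w>0 h x → mismatch-bound {L} A B b describes w (zs ∘ at) (Y ∘ at) w>0 h pos x
      where
      Y : Fin (suc V) → Vector ℝ c
      Y z = proj₁ (lift-vertex (zs z) (zs∈ z))
      s : Fin (suc V) → Fin r → ℝ
      s z j = slack (zs z) (Y z) j

-- The linear system: margins for accepted inputs, contradiction for the others.

module Rows where

  import Data.Bool.Properties as Boolₚ
  open import Data.Fin.Properties using (splitAt-↑ˡ; splitAt-↑ʳ; remQuot-combine; ¬∀⟶∃¬)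
  open import Data.Integer.Base as ℤ using (ℤ; +_; -[1+_]; 0ℤ; 1ℤ; ∣_∣; _+_; _*_; _-_; -_; _≤_; _<_; +≤+; +<+)
  open import Data.Integer.Properties
  open import Data.Integer.Solver using (module +-*-Solver)
  open import Data.List.Base as List using (_++_; tabulate)
  open import Data.List.Properties using (length-++; length-tabulate)
  open import Data.List.Relation.Unary.All as All using (All; []; _∷_)
  open import Data.List.Relation.Unary.All.Properties using (++⁺; ++⁻; tabulate⁺; tabulate⁻)
  open import Data.Maybe.Base using (nothing; just)
  import Data.Nat.Base as ℕ
  import Data.Nat.Properties as ℕₚ
  open import Relation.Nullary.Decidable using (⌊_⌋)
  open import Algebra.Properties.Semiring.Sum +-*-semiring using (sum; sum-cong-≗; ∑-distrib-+; ∑-comm; *-distribˡ-sum; *-distribʳ-sum)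

  open import Defs using (Language)
  open Perceptron
  open Separation using (decideCost; ∣∣-bound; ∣∣-lower; ∣∣-upper)
  open Spanner
  open Integrality
  open Extraction

  self-≤ : ∀ {k n} (a : Weights k) → (∀ i → ∣ a i ∣ ℕ.≤ n) → a ∙ a ≤ + (k ℕ.* (n ℕ.* n))
  self-≤ {k} {n} a a≤ = ≤-trans (sum-mono λ i → ≤-trans (≤-reflexive (square (a i))) (+≤+ (ℕₚ.*-mono-≤ (a≤ i) (a≤ i))))
    (≤-reflexive (sum-const k (n ℕ.* n)))
    where
    square : ∀ i → i * i ≡ + (∣ i ∣ ℕ.* ∣ i ∣)
    square (+ m)    = sym (pos-* m m)
    square -[1+ m ] = refl

  ∙-scale : ∀ {k} (a c : Weights k) q → a ∙ (λ i → q * c i) ≡ q * (a ∙ c)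
  ∙-scale a c q = trans (sum-cong-≗ λ i → solve 3 (λ a q c → a :* (q :* c) := q :* (a :* c)) refl (a i) q (c i))
    (sym (*-distribˡ-sum q (λ i → a i * c i)))
    where open +-*-Solver using (solve; _:=_; _:*_)

  ∙-neg : ∀ {k} (a c : Weights k) → (λ i → - a i) ∙ c ≡ - (a ∙ c)
  ∙-neg {zero}  a c = refl
  ∙-neg {suc k} a c = trans (cong₂ _+_ (sym (neg-distribˡ-* (a zero) (c zero))) (∙-neg (a ∘ suc) (c ∘ suc)))
    (sym (neg-distrib-+ (a zero * c zero) ((a ∘ suc) ∙ (c ∘ suc))))

  unit : ∀ {k} → Fin k → Weights k
  unit zero    zero    = 1ℤ
  unit zero    (suc _) = 0ℤ
  unit (suc i) zero    = 0ℤ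
  unit (suc i) (suc j) = unit i j

  unit≤1 : ∀ {k} (i j : Fin k) → ∣ unit i j ∣ ℕ.≤ 1
  unit≤1 zero    zero    = ℕₚ.≤-refl
  unit≤1 zero    (suc _) = ℕ.z≤n
  unit≤1 (suc i) zero    = ℕ.z≤n
  unit≤1 (suc i) (suc j) = unit≤1 i j

  unit-∙ : ∀ {k} (i : Fin k) c → unit i ∙ c ≡ c i
  unit-∙ zero    c = trans (cong₂ _+_ (*-identityˡ (c zero)) (zeros (c ∘ suc))) (+-identityʳ (c zero))
    where
    zeros : ∀ {k} (c : Weights k) → sum (λ i → 0ℤ * c i) ≡ 0ℤ
    zeros {zero}  c = refl
    zeros {suc k} c = trans (+-identityˡ _) (zeros (c ∘ suc))
  unit-∙ (suc i) c = trans (+-identityˡ (unit i ∙ (c ∘ suc))) (unit-∙ i (c ∘ suc))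

  -- Multiples of `N` less than `N` apart coincide. This makes the approximate relations of the
  -- spanning set exact on coordinates that are multiples of `N`.
  exact : ∀ {a t N} → ∣ a * + N - t * + N ∣ ℕ.< N → a ≡ t
  exact {a} {t} {N} h = i-j≡0⇒i≡j a t (∣i∣≡0⇒i≡0 (small (subst (ℕ._< N) factored h)))
    where
    open +-*-Solver using (solve; _:=_; _:*_; _:-_)
    factored : ∣ a * + N - t * + N ∣ ≡ ∣ a - t ∣ ℕ.* N
    factored = trans (cong ∣_∣ (solve 3 (λ a t n → a :* n :- t :* n := (a :- t) :* n) refl a t (+ N))) (abs-* (a - t) (+ N))
    small : ∀ {d} → d ℕ.* N ℕ.< N → d ≡ 0
    small {zero}  _ = refl
    small {suc d} h = contradiction (ℕₚ.m≤m+n N (d ℕ.* N)) (ℕₚ.<⇒≱ h)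

  bit : Fin 2 → Bool
  bit zero       = false
  bit (suc zero) = true

  index : Bool → Fin 2
  index false = zero
  index true  = suc zero

  bit-index : ∀ b → bit (index b) ≡ b
  bit-index false = refl
  bit-index true  = refl

  -- One coordinate for the total weight, one per inequality for the rounded slack, and two per
  -- input letter: the spanning points are chosen before the input is known, so mismatches with
  -- either value have to be approximated.
  dimension : ℕ → ℕ → ℕ
  dimension r m = suc (r ℕ.+ m ℕ.* 2)

  module _ {r m : ℕ} (a : ℕ) (f : Fin r → ℕ) (g : Fin m → Bool → ℕ) where

    coordinates : Fin (dimension r m) → ℕ
    coordinates zero    = a
    coordinates (suc i) = [ f , (λ j → g (proj₁ (remQuot {m} 2 j)) (bit (proj₂ (remQuot {m} 2 j)))) ]′ (splitAt r i)

    coordinates-f : ∀ j → coordinates (suc (j ↑ˡ (m ℕ.* 2))) ≡ f j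
    coordinates-f j = cong [ f , _ ]′ (splitAt-↑ˡ r j (m ℕ.* 2))

    coordinates-g : ∀ l b → coordinates (suc (r ↑ʳ combine l (index b))) ≡ g l b
    coordinates-g l b = trans (cong [ f , _ ]′ (splitAt-↑ʳ r (m ℕ.* 2) (combine l (index b))))
      (trans (cong (λ p → g (proj₁ p) (bit (proj₂ p))) (remQuot-combine l (index b))) (cong (g l) (bit-index b)))

    coordinates≤ : ∀ {n} → a ℕ.≤ n → (∀ j → f j ℕ.≤ n) → (∀ l b → g l b ℕ.≤ n) → ∀ d → coordinates d ℕ.≤ n
    coordinates≤ a≤ f≤ g≤ zero    = a≤
    coordinates≤ a≤ f≤ g≤ (suc i) with splitAt r i
    ... | inj₁ j = f≤ j
    ... | inj₂ j = g≤ _ _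

  -- The constants for m input bits and r inequalities: slacks are rounded to
  -- multiples of 1 / (K M) and matched up to 1 / M by at most K spanning points,
  -- weights are scaled by Q, S bounds squared lengths and h is the multiplicity
  -- of the points of maximal slack.
  record Constants (m r : ℕ) : Set where
    field
      K M S Q h : ℕ
      {{K≢0}}   : ℕ.NonZero K
      {{M≢0}}   : ℕ.NonZero M
      norms     : K ℕ.* ((K ℕ.* M) ℕ.* (K ℕ.* M)) ℕ.≤ S
      mixing    : K ℕ.* (Q ℕ.+ S) ℕ.+ (Q ℕ.* K ℕ.+ S) ℕ.≤ h ℕ.* (K ℕ.* M)
      gap       : m ℕ.* S ℕ.+ r ℕ.* (h ℕ.* m) ℕ.+ S ℕ.< Q
      many      : suc (K ℕ.* M) ℕ.^ dimension r m ℕ.< 2 ℕ.^ K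

    size : ℕ
    size = 1 ℕ.+ decideCost (suc (r ℕ.+ (K ℕ.+ (K ℕ.+ (m ℕ.+ m))))) S (K ℕ.* (Q ℕ.* Q))

  module _ {L : Language} {ℓ m r V : ℕ} (constants : Constants m r) where

    open Constants constants

    module _ (pos : Fin m → Fin ℓ) (zs : Fin V → Vec Bool ℓ) (complete : ∀ u → L (toList u) → ∃ λ z → zs z ≡ u)
             (R : Rounded L pos r (K ℕ.* M) zs) where

      open Rounded R

      private
        N : ℕ
        N = K ℕ.* M

      K≤N : K ℕ.≤ N
      K≤N = ℕₚ.m≤m*n K M

      1≤N : 1 ℕ.≤ N
      1≤N = ℕₚ.≤-trans (ℕ.>-nonZero⁻¹ K) K≤N

      miss : Fin V → Fin m → Bool → ℕ
      miss z l b = mismatch (lookup (zs z) (pos l)) b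

      -- The constant coordinate and the mismatches are multiples of `N`, and the tolerance `K` is
      -- at most `N`, so spanning reproduces them exactly. The slacks are reproduced up to `K` only.
      U : Fin V → Fin (dimension r m) → ℕ
      U z = coordinates N (W z) (λ l b → miss z l b ℕ.* N)

      U≤ : ∀ z d → U z d ℕ.≤ N
      U≤ z = coordinates≤ N (W z) (λ l b → miss z l b ℕ.* N) ℕₚ.≤-refl (W≤N z)
        (λ l b → ℕₚ.≤-trans (ℕₚ.*-monoˡ-≤ N (mismatch≤1 (lookup (zs z) (pos l)) b)) (ℕₚ.≤-reflexive (ℕₚ.*-identityˡ N)))

      Accepted : Vec Bool m → Set
      Accepted x = ∃ λ u → L (toList u) × (∀ l → lookup u (pos l) ≡ lookup x l)

      module _ {k : ℕ} (k≤K : k ℕ.≤ K) (σ : Vec (Fin V) k) where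

        -- As for all rows, the threshold is what the target is sure to reach, here `- (Q * K)`,
        -- lowered by the margin `S`.
        slackRow : Fin r → Row k m
        slackRow j = record { coefficients = λ i → + W (lookup σ i) j ; threshold = - + (Q ℕ.* K ℕ.+ S) ; guard = nothing }

        -- These bound the weights, and with them the total loss to rounding, which grows with the
        -- absolute values of the weights.
        lowerRow upperRow : Fin k → Row k m
        lowerRow i = record { coefficients = unit i ; threshold = - + (Q ℕ.+ S) ; guard = nothing }
        upperRow i = record { coefficients = λ j → - unit i j ; threshold = - + (Q ℕ.+ S) ; guard = nothing }

        sumRow : Row k m
        sumRow = record { coefficients = λ _ → 1ℤ ; threshold = + Q - + S ; guard = nothing }

        missRow : Bool → Fin m → Row k m
        missRow b l = record { coefficients = λ i → - + miss (lookup σ i) l b ; threshold = - + S ; guard = just (l , b) }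

        rows : List (Row k m)
        rows = sumRow ∷ tabulate slackRow ++ tabulate lowerRow ++ tabulate upperRow ++ tabulate (missRow true) ++ tabulate (missRow false)

        all-rows : ∀ {P : Row k m → Set} → P sumRow → (∀ j → P (slackRow j)) → (∀ i → P (lowerRow i)) → (∀ i → P (upperRow i)) →
                   (∀ b l → P (missRow b l)) → All P rows
        all-rows p s l u g = p ∷ ++⁺ (tabulate⁺ s) (++⁺ (tabulate⁺ l) (++⁺ (tabulate⁺ u) (++⁺ (tabulate⁺ (g true)) (tabulate⁺ (g false)))))

        rows-length : length rows ≡ suc (r ℕ.+ (k ℕ.+ (k ℕ.+ (m ℕ.+ m))))
        rows-length = cong suc
          (trans (length-++ (tabulate slackRow)) (cong₂ ℕ._+_ (length-tabulate slackRow)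
          (trans (length-++ (tabulate lowerRow)) (cong₂ ℕ._+_ (length-tabulate lowerRow)
          (trans (length-++ (tabulate upperRow)) (cong₂ ℕ._+_ (length-tabulate upperRow)
          (trans (length-++ (tabulate (missRow true))) (cong₂ ℕ._+_ (length-tabulate (missRow true)) (length-tabulate (missRow false))))))))))

        small : ∀ (a : Weights k) → (∀ i → ∣ a i ∣ ℕ.≤ N) → a ∙ a ≤ + S
        small a a≤ = ≤-trans (self-≤ a a≤) (+≤+ (ℕₚ.≤-trans (ℕₚ.*-monoˡ-≤ (N ℕ.* N) k≤K) norms))

        rows-small : All (λ ρ → coefficients ρ ∙ coefficients ρ ≤ + S) rows
        rows-small = all-rows {P = λ ρ → coefficients ρ ∙ coefficients ρ ≤ + S} (small (λ _ → 1ℤ) λ _ → 1≤N) (λ j → small (λ i → + W (lookup σ i) j) λ i → W≤N (lookup σ i) j)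
          (λ i → small (unit i) λ j → ℕₚ.≤-trans (unit≤1 i j) 1≤N)
          (λ i → small (λ j → - unit i j) λ j → ℕₚ.≤-trans (ℕₚ.≤-reflexive (∣-i∣≡∣i∣ (unit i j))) (ℕₚ.≤-trans (unit≤1 i j) 1≤N))
          (λ b l → small (λ i → - + miss (lookup σ i) l b) λ i →
            ℕₚ.≤-trans (ℕₚ.≤-reflexive (∣-i∣≡∣i∣ (+ miss (lookup σ i) l b)))
              (ℕₚ.≤-trans (mismatch≤1 (lookup (zs (lookup σ i)) (pos l)) b) 1≤N))

        module _ (spans : ∀ z → Spans U K M U≤ σ z) {x : Vec Bool m} (acc : Accepted x) where

          private
            u = proj₁ acc
            z = proj₁ (complete u (proj₁ (proj₂ acc)))
            zs≡u = proj₂ (complete u (proj₁ (proj₂ acc)))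
            c = proj₁ (spans z)
            c≤1 = proj₁ (proj₂ (spans z))

          near : ∀ d {f : Fin k → ℤ} {t} → (∀ i → + U (lookup σ i) d ≡ f i) → + U z d ≡ t → ∣ sum (λ i → c i * f i) - t ∣ ℕ.< K
          near d {f} U≡ t≡ = subst₂ (λ s t → ∣ s - t ∣ ℕ.< K) (sum-cong-≗ λ i → cong (c i *_) (U≡ i)) t≡ (proj₂ (proj₂ (spans z)) d)

          -- The margin `S` is fixed by the size of the coefficients; scaling the spanning
          -- coefficients by a large `Q` makes it insignificant.
          target : Weights k
          target i = + Q * c i

          target-small : target ∙ target ≤ + (K ℕ.* (Q ℕ.* Q))
          target-small = ≤-trans (self-≤ target λ i → ℕₚ.≤-trans (ℕₚ.≤-reflexive (abs-* (+ Q) (c i)))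
              (ℕₚ.≤-trans (ℕₚ.*-monoʳ-≤ Q (c≤1 i)) (ℕₚ.≤-reflexive (ℕₚ.*-identityʳ Q))))
            (+≤+ (ℕₚ.*-monoˡ-≤ (Q ℕ.* Q) k≤K))

          sum-c : sum c ≡ 1ℤ
          sum-c = exact {N = N} (ℕₚ.<-≤-trans (subst (λ s → ∣ s - 1ℤ * + N ∣ ℕ.< K) (sym (*-distribʳ-sum (+ N) c))
            (near zero {λ _ → + N} {1ℤ * + N} (λ _ → refl) (sym (*-identityˡ (+ N))))) K≤N)

          slack-c : ∀ j → - + K ≤ (λ i → + W (lookup σ i) j) ∙ c
          slack-c j = begin
            - + K                                ≤⟨ ∣∣-lower (ℕₚ.<⇒≤ close) ⟩
            s - + W z j                          ≤⟨ i-n≤i s (W z j) ⟩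
            s                                    ≡⟨ sum-cong-≗ (λ i → *-comm (c i) (+ W (lookup σ i) j)) ⟩
            (λ i → + W (lookup σ i) j) ∙ c       ∎
            where
            open ≤-Reasoning
            s = sum (λ i → c i * + W (lookup σ i) j)
            close : ∣ s - + W z j ∣ ℕ.< K
            close = near (suc (j ↑ˡ (m ℕ.* 2))) (λ i → cong +_ (coordinates-f N (W (lookup σ i)) (λ l b → miss (lookup σ i) l b ℕ.* N) j))
              (cong +_ (coordinates-f N (W z) (λ l b → miss z l b ℕ.* N) j))
            i-n≤i : ∀ i n → i - + n ≤ i
            i-n≤i i n = subst (i - + n ≤_) (+-identityʳ i) (+-monoʳ-≤ i (neg-≤-pos {n} {0}))

          miss-c : ∀ b l → lookup x l ≡ b → (λ i → + miss (lookup σ i) l b) ∙ c ≡ 0ℤ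
          miss-c b l xl≡b = exact {N = N} (ℕₚ.<-≤-trans (subst (λ s → ∣ s - 0ℤ * + N ∣ ℕ.< K)
              (trans (sum-cong-≗ λ i → trans (cong (c i *_) (pos-* (miss (lookup σ i) l b) N)) (shuffle (c i) (+ miss (lookup σ i) l b) (+ N)))
                (sym (*-distribʳ-sum (+ N) (λ i → + miss (lookup σ i) l b * c i))))
              (near (suc (r ↑ʳ combine l (index b)))
                (λ i → cong +_ (coordinates-g N (W (lookup σ i)) (λ l b → miss (lookup σ i) l b ℕ.* N) l b))
                (trans (cong +_ (coordinates-g N (W z) (λ l b → miss z l b ℕ.* N) l b)) (cong (λ t → + (t ℕ.* N)) zero-miss)))) K≤N)
            where
            open +-*-Solver using (solve; _:=_; _:*_)
            shuffle : ∀ c m n → c * (m * n) ≡ m * c * n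
            shuffle = solve 3 (λ c m n → c :* (m :* n) := m :* c :* n) refl
            mismatch-refl : ∀ a → mismatch a a ≡ 0
            mismatch-refl true  = refl
            mismatch-refl false = refl
            zero-miss : miss z l b ≡ 0
            zero-miss = trans (cong₂ mismatch (trans (cong (λ v → lookup v (pos l)) zs≡u) (trans (proj₂ (proj₂ acc) l) xl≡b)) (refl {x = b})) (mismatch-refl b)

          scaled-row : ∀ (ρ : Row k m) {t} → t ≤ coefficients ρ ∙ c → threshold ρ + + S ≡ + Q * t → threshold ρ + + S ≤ coefficients ρ ∙ target
          scaled-row ρ t≤ eq = ≤-trans (≤-reflexive eq) (≤-trans (*-monoˡ-≤-nonNeg (+ Q) t≤) (≤-reflexive (sym (∙-scale (coefficients ρ) c (+ Q)))))

          margins : All (Margin x S target) rows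
          margins = All.zip (rows-small , all-rows {P = λ ρ → active ρ x ≡ true → threshold ρ + + S ≤ coefficients ρ ∙ target}
            (λ _ → scaled-row sumRow {1ℤ} (≤-reflexive (sym (trans (sum-cong-≗ λ i → *-identityˡ (c i)) sum-c)))
              (solve 2 (λ q s → q :- s :+ s := q :* con 1ℤ) refl (+ Q) (+ S)))
            (λ j _ → scaled-row (slackRow j) (slack-c j)
              (trans (cong (λ t → - t + + S) (cong (_+ + S) (pos-* Q K))) (solve 3 (λ q e s → :- (q :* e :+ s) :+ s := q :* (:- e)) refl (+ Q) (+ K) (+ S))))
            (λ i _ → scaled-row (lowerRow i) (≤-trans (∣∣-lower (c≤1 i)) (≤-reflexive (sym (unit-∙ i c))))
              (solve 2 (λ q s → :- (q :+ s) :+ s := q :* (:- con 1ℤ)) refl (+ Q) (+ S)))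
            (λ i _ → scaled-row (upperRow i) (≤-trans (neg-mono-≤ (∣∣-upper (c≤1 i))) (≤-reflexive (sym (trans (∙-neg (unit i) c) (cong -_ (unit-∙ i c))))))
              (solve 2 (λ q s → :- (q :+ s) :+ s := q :* (:- con 1ℤ)) refl (+ Q) (+ S)))
            (λ b l act → scaled-row (missRow b l)
              (≤-reflexive (sym (trans (∙-neg (λ i → + miss (lookup σ i) l b) c) (cong -_ (miss-c b l (matches b l act))))))
              (solve 2 (λ q s → :- s :+ s := q :* con 0ℤ) refl (+ Q) (+ S))))
            where
            open +-*-Solver using (solve; _:=_; _:+_; _:*_; _:-_; :-_; con)
            matches : ∀ b l → ⌊ lookup x l Boolₚ.≟ b ⌋ ≡ true → lookup x l ≡ b
            matches b l act with lookup x l Boolₚ.≟ b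
            ... | yes p = p

        module _ (x : Vec Bool m) (C : Weights k) (sat : All (Satisfied x C) rows) where

          private
            sum-sat    = All.head sat
            parts₁     = ++⁻ (tabulate slackRow) (All.tail sat)
            parts₂     = ++⁻ (tabulate lowerRow) (proj₂ parts₁)
            parts₃     = ++⁻ (tabulate upperRow) (proj₂ parts₂)
            parts₄     = ++⁻ (tabulate (missRow true)) (proj₂ parts₃)
            slack-sat  = tabulate⁻ (proj₁ parts₁)
            lower-sat  = tabulate⁻ (proj₁ parts₂)
            upper-sat  = tabulate⁻ (proj₁ parts₃)

            miss-sat : ∀ b l → Satisfied x C (missRow b l)
            miss-sat true  = tabulate⁻ (proj₁ parts₄)
            miss-sat false = tabulate⁻ (proj₂ parts₄)

          open +-*-Solver using (solve; _:=_; _:+_; _:*_; _:-_; :-_; con)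
          open ≤-Reasoning

          C≤ : ∀ i → ∣ C i ∣ ℕ.≤ Q ℕ.+ S
          C≤ i = ∣∣-bound (≤-trans (lower-sat i refl) (≤-reflexive (unit-∙ i C)))
            (neg-cancel-≤ (≤-trans (upper-sat i refl) (≤-reflexive (trans (∙-neg (unit i) C) (cong -_ (unit-∙ i C))))))

          ΣC≥ : + Q - + S ≤ sum C
          ΣC≥ = ≤-trans (sum-sat refl) (≤-reflexive (sum-cong-≗ λ i → *-identityˡ (C i)))

          -- Two deficits have to be paid for: the rounding loss, at most `K * (Q + S)`, and the
          -- negative slack of at most `Q * K + S` that `slackRow` tolerates. `mixing` is the
          -- statement that `h` maximisers cover their sum.
          enough : ∀ j → 0ℤ ≤ sum (λ i → C i * + W (lookup σ i) j - + ∣ C i ∣) + + h * + N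
          enough j = begin
            0ℤ                                    ≡⟨ solve 2 (λ a b → con 0ℤ := (:- b :+ :- a) :+ (a :+ b)) refl (+ (K ℕ.* (Q ℕ.+ S))) (+ (Q ℕ.* K ℕ.+ S)) ⟩
            - + (Q ℕ.* K ℕ.+ S) + - + (K ℕ.* (Q ℕ.+ S)) + + (K ℕ.* (Q ℕ.+ S) ℕ.+ (Q ℕ.* K ℕ.+ S))
              ≤⟨ +-mono-≤ (+-mono-≤ (slack-sat j refl) (neg-mono-≤ weights)) (≤-trans (+≤+ mixing) (≤-reflexive (pos-* h N))) ⟩
            a ∙ C + - sum ∣C∣ + + h * + N         ≡⟨ cong (_+ + h * + N) (sym split) ⟩
            sum (λ i → C i * a i - ∣C∣ i) + + h * + N ∎
            where
            a ∣C∣ : Weights k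
            a i = + W (lookup σ i) j
            ∣C∣ i = + ∣ C i ∣
            weights : sum ∣C∣ ≤ + (K ℕ.* (Q ℕ.+ S))
            weights = ≤-trans (sum-mono λ i → +≤+ (C≤ i)) (≤-trans (≤-reflexive (sum-const k (Q ℕ.+ S))) (+≤+ (ℕₚ.*-monoˡ-≤ (Q ℕ.+ S) k≤K)))
            sum-neg : ∀ {k} (f : Weights k) → sum (λ i → - f i) ≡ - sum f
            sum-neg {zero}  f = refl
            sum-neg {suc k} f = trans (cong (_+_ (- f zero)) (sum-neg (f ∘ suc))) (sym (neg-distrib-+ (f zero) (sum (f ∘ suc))))
            split : sum (λ i → C i * a i - ∣C∣ i) ≡ a ∙ C + - sum ∣C∣
            split = trans (∑-distrib-+ (λ i → C i * a i) (λ i → - ∣C∣ i))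
              (cong₂ _+_ (sum-cong-≗ λ i → *-comm (C i) (a i)) (sum-neg ∣C∣))

          S<Q : S ℕ.< Q
          S<Q = ℕₚ.≤-<-trans (ℕₚ.m≤n+m S _) gap

          positive : 0ℤ < sum C + sum {r} (λ _ → + h)
          positive = <-≤-trans (subst (_< + Q - + S) (+-inverseʳ (+ S)) (+-monoˡ-< (- + S) (ℤ.+<+ S<Q)))
            (≤-trans ΣC≥ (≤-trans (≤-reflexive (sym (+-identityʳ (sum C)))) (+-monoʳ-≤ (sum C) (sum-nonneg {r} λ _ → +≤+ ℕ.z≤n))))

          few-misses : ∀ l → sum (λ i → C i * + miss (lookup σ i) l (lookup x l)) ≤ + S
          few-misses l = neg-cancel-≤ (begin
            - + S                                              ≤⟨ miss-sat (lookup x l) l (matches l) ⟩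
            (λ i → - + miss (lookup σ i) l (lookup x l)) ∙ C   ≡⟨ ∙-neg (λ i → + miss (lookup σ i) l (lookup x l)) C ⟩
            - sum (λ i → + miss (lookup σ i) l (lookup x l) * C i) ≡⟨ cong -_ (sum-cong-≗ λ i → *-comm (+ miss (lookup σ i) l (lookup x l)) (C i)) ⟩
            - sum (λ i → C i * + miss (lookup σ i) l (lookup x l)) ∎)
            where
            matches : ∀ l → ⌊ lookup x l Boolₚ.≟ lookup x l ⌋ ≡ true
            matches l with lookup x l Boolₚ.≟ lookup x l
            ... | yes _ = refl
            ... | no ¬p = contradiction refl ¬p

          -- The active rows limit the weighted misses of the spanning points to `S` for each
          -- letter. The maximisers are chosen without regard to `x`, so each is charged all `m`
          -- letters.
          mismatches≤ : sum (λ i → C i * mismatches pos x (zs (lookup σ i))) + sum (λ j → + h * mismatches pos x (zs (top j)))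
                        ≤ + (m ℕ.* S ℕ.+ r ℕ.* (h ℕ.* m))
          mismatches≤ = +-mono-≤
            (begin
              sum (λ i → C i * sum (λ l → + miss (lookup σ i) l (lookup x l)))
                ≡⟨ sum-cong-≗ (λ i → *-distribˡ-sum (C i) (λ l → + miss (lookup σ i) l (lookup x l))) ⟩
              sum (λ i → sum (λ l → C i * + miss (lookup σ i) l (lookup x l)))
                ≡⟨ ∑-comm (λ i l → C i * + miss (lookup σ i) l (lookup x l)) ⟩
              sum (λ l → sum (λ i → C i * + miss (lookup σ i) l (lookup x l)))
                ≤⟨ sum-mono few-misses ⟩
              sum {m} (λ _ → + S)  ≡⟨ sum-const m S ⟩
              + (m ℕ.* S) ∎)
            (begin
              sum (λ j → + h * mismatches pos x (zs (top j)))
                ≤⟨ sum-mono (λ j → *-monoˡ-≤-nonNeg (+ h) (at-most-m (zs (top j)))) ⟩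
              sum {r} (λ _ → + h * + m)  ≡⟨ sum-cong-≗ {r} (λ _ → sym (pos-* h m)) ⟩
              sum {r} (λ _ → + (h ℕ.* m))  ≡⟨ sum-const r (h ℕ.* m) ⟩
              + (r ℕ.* (h ℕ.* m)) ∎)
            where
            at-most-m : ∀ u → mismatches pos x u ≤ + m
            at-most-m u = ≤-trans (sum-mono λ l → +≤+ (mismatch≤1 (lookup u (pos l)) (lookup x l)))
              (≤-reflexive (trans (sum-const m 1) (cong +_ (ℕₚ.*-identityʳ m))))

          -- If every word of the slice differed from `x` on some input letter, `refute` would bound
          -- the total weight, at least `Q - S`, by the mismatches, at most `m * S + r * (h * m)`;
          -- `gap` says otherwise.
          sound : ¬ ¬ Accepted x
          sound ¬acc = contradiction gap (ℕₚ.≤⇒≯ (drop‿+≤+ (begin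
            + Q                                         ≡⟨ solve 2 (λ q s → q := q :- s :+ s) refl (+ Q) (+ S) ⟩
            + Q - + S + + S                             ≤⟨ +-monoˡ-≤ (+ S) (begin
              + Q - + S                                   ≤⟨ ΣC≥ ⟩
              sum C                                       ≤⟨ ≤-trans (≤-reflexive (sym (+-identityʳ (sum C)))) (+-monoʳ-≤ (sum C) (sum-nonneg {r} λ _ → +≤+ ℕ.z≤n)) ⟩
              sum C + sum {r} (λ _ → + h)                 ≤⟨ refute (lookup σ) C h enough positive x differ ⟩
              _                                           ≤⟨ mismatches≤ ⟩
              + (m ℕ.* S ℕ.+ r ℕ.* (h ℕ.* m))             ∎) ⟩
            + (m ℕ.* S ℕ.+ r ℕ.* (h ℕ.* m) ℕ.+ S)      ∎)))
            where
            differ : ∀ u → L (toList u) → ∃ λ l → lookup u (pos l) ≢ lookup x l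
            differ u u∈ = ¬∀⟶∃¬ m (λ l → lookup u (pos l) ≡ lookup x l) (λ l → lookup u (pos l) Boolₚ.≟ lookup x l)
              λ agree → ¬acc (u , u∈ , agree)

-- Deciding by exhaustion whether a small circuit exists.

module Search where

  import Data.Bool.Properties as Boolₚ
  open import Data.List.Base as List using (_++_; map; concatMap; cartesianProductWith; allFin; upTo)
  open import Data.List.Membership.Propositional using (_∈_; find; lose)
  open import Data.List.Membership.Propositional.Properties using (∈-map⁺; ∈-++⁺ˡ; ∈-++⁺ʳ; ∈-cartesianProductWith⁺; ∈-allFin; ∈-upTo⁺; ∈-concat⁺′)
  open import Data.List.Relation.Unary.All as All using (All; all?)
  open import Data.List.Relation.Unary.Any as Any using (any?; here; there)
  open import Data.Nat.Base using (_+_; _≤_; s≤s)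
  open import Data.Nat.Properties using (_≤?_; m⊔n≤o⇒m≤o; m⊔n≤o⇒n≤o)
  open import Relation.Nullary.Decidable using (map′; _×-dec_)

  open import Defs using (Gate; Gates; AND; OR; NOT; []; _∷_; Circuit; evaluate; fanIn; maxFanIn; gateInputs; DecidesSlice; Language)

  search : ∀ {A : Set} {P : A → Set} (as : List A) → (∀ {a} → P a → a ∈ as) → (∀ a → Dec (P a)) → Dec (∃ P)
  search as complete P? = map′ (λ p → let a , _ , pa = find p in a , pa) (λ (a , pa) → lose (complete pa) pa) (any? P? as)

  bitVectors : ∀ n → List (Vec Bool n)
  bitVectors zero    = [] ∷ []
  bitVectors (suc n) = cartesianProductWith _∷_ (true ∷ false ∷ []) (bitVectors n)

  ∈-bitVectors : ∀ {n} (v : Vec Bool n) → v ∈ bitVectors n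
  ∈-bitVectors []      = here refl
  ∈-bitVectors (b ∷ v) = ∈-cartesianProductWith⁺ _∷_ (∈-bools b) (∈-bitVectors v)
    where
    ∈-bools : ∀ b → b ∈ true ∷ false ∷ []
    ∈-bools true  = here refl
    ∈-bools false = there (here refl)

  module _ (w : ℕ) where

    -- Gates carry input lists of any length, so the fan-in bound is what leaves finitely many
    -- candidates.
    shortLists : List (List (Fin w))
    shortLists = [] ∷ map (_∷ []) (allFin w) ++ cartesianProductWith (λ i j → i ∷ j ∷ []) (allFin w) (allFin w)

    ∈-shortLists : ∀ is → length is ≤ 2 → is ∈ shortLists
    ∈-shortLists []           _ = here refl
    ∈-shortLists (i ∷ [])     _ = there (∈-++⁺ˡ (∈-map⁺ (_∷ []) (∈-allFin i)))
    ∈-shortLists (i ∷ j ∷ []) _ = there (∈-++⁺ʳ (map (_∷ []) (allFin w))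
      (∈-cartesianProductWith⁺ (λ i j → i ∷ j ∷ []) (∈-allFin i) (∈-allFin j)))
    ∈-shortLists (_ ∷ _ ∷ _ ∷ _) (s≤s (s≤s ()))

    narrowGates : List (Gate w)
    narrowGates = map NOT (allFin w) ++ map AND shortLists ++ map OR shortLists

    ∈-narrowGates : ∀ g → length (gateInputs g) ≤ 2 → g ∈ narrowGates
    ∈-narrowGates (NOT i)  _  = ∈-++⁺ˡ (∈-map⁺ NOT (∈-allFin i))
    ∈-narrowGates (AND is) ≤2 = ∈-++⁺ʳ (map NOT (allFin w)) (∈-++⁺ˡ (∈-map⁺ AND (∈-shortLists is ≤2)))
    ∈-narrowGates (OR is)  ≤2 = ∈-++⁺ʳ (map NOT (allFin w)) (∈-++⁺ʳ (map AND shortLists) (∈-map⁺ OR (∈-shortLists is ≤2)))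

  narrowNets : ∀ n s → List (Gates n s)
  narrowNets n zero    = [] ∷ []
  narrowNets n (suc s) = cartesianProductWith _∷_ (narrowGates (s + n)) (narrowNets n s)

  ∈-narrowNets : ∀ {n s} (gs : Gates n s) → maxFanIn gs ≤ 2 → gs ∈ narrowNets n s
  ∈-narrowNets []       _  = here refl
  ∈-narrowNets (g ∷ gs) ≤2 = ∈-cartesianProductWith⁺ _∷_ (∈-narrowGates _ g (m⊔n≤o⇒m≤o _ _ ≤2)) (∈-narrowNets gs (m⊔n≤o⇒n≤o _ _ ≤2))

  narrowCircuits : ∀ n s → List (Circuit n)
  narrowCircuits n s = concatMap (λ t →
    cartesianProductWith (λ gs o → record { size = t ; gates = gs ; output = o }) (narrowNets n t) (allFin (t + n))) (upTo (suc s))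

  ∈-narrowCircuits : ∀ {n s} (C : Circuit n) → Circuit.size C ≤ s → fanIn C ≤ 2 → C ∈ narrowCircuits n s
  ∈-narrowCircuits C size≤ ≤2 = ∈-concat⁺′
    (∈-cartesianProductWith⁺ _ (∈-narrowNets (Circuit.gates C) ≤2) (∈-allFin (Circuit.output C)))
    (∈-map⁺ _ (∈-upTo⁺ (s≤s size≤)))

  ⇔-dec : ∀ {A B : Set} → Dec A → Dec B → Dec (A ⇔ B)
  ⇔-dec (yes a) (yes b) = yes (mk⇔ (λ _ → b) (λ _ → a))
  ⇔-dec (yes a) (no ¬b) = no λ e → ¬b (Equivalence.to e a)
  ⇔-dec (no ¬a) (yes b) = no λ e → ¬a (Equivalence.from e b)
  ⇔-dec (no ¬a) (no ¬b) = yes (mk⇔ (λ a → contradiction a ¬a) (λ b → contradiction b ¬b))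

  ∀-bits? : ∀ {n} {P : Vec Bool n → Set} → (∀ v → Dec (P v)) → Dec (∀ v → P v)
  ∀-bits? P? = map′ (λ ps v → All.lookup ps (∈-bitVectors v)) (λ p → All.universal p _) (all? P? (bitVectors _))

  ∃-bits? : ∀ {n} {P : Vec Bool n → Set} → (∀ v → Dec (P v)) → Dec (∃ P)
  ∃-bits? = search (bitVectors _) λ {v} _ → ∈-bitVectors v

  -- Decidability makes the existence of the circuit stable, so a proof that its absence is absurd
  -- yields an actual circuit.
  narrowCircuit? : ∀ {L : Language} {n} s → (∀ (x : Vec Bool n) → Dec (L (toList x))) →
                   Dec (∃ λ (C : Circuit n) → Circuit.size C ≤ s × fanIn C ≤ 2 × DecidesSlice C L)
  narrowCircuit? {n = n} s L? = search (narrowCircuits n s) (λ {C} (size≤ , ≤2 , _) → ∈-narrowCircuits C size≤ ≤2)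
    λ C → Circuit.size C ≤? s ×-dec fanIn C ≤? 2 ×-dec ∀-bits? λ x → ⇔-dec (L? x) (evaluate C x Boolₚ.≟ true)

import Data.Bool.Properties as Boolₚ
open import Data.Empty using (⊥)
import Data.Fin.Properties as Finₚ
open import Data.Integer.Base using (+_; 0ℤ) renaming (_≤_ to _≤ᶻ_)
open import Data.List.Base as List using (filter)
open import Data.List.Membership.Propositional using (_∈_)
open import Data.List.Membership.Propositional.Properties using (∈-filter⁺; ∈-filter⁻; ∈-lookup)
open import Data.List.Relation.Unary.All as All using (All)
import Data.List.Relation.Unary.Any as Any
open import Data.List.Relation.Unary.Any.Properties using (lookup-index)
open import Data.Nat.Base using (_+_; _*_; _≤_; _<_; z≤n; s≤s; NonZero; >-nonZero⁻¹)
open import Data.Nat.Properties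
  using (≤-refl; ≤-trans; ≤-reflexive; +-mono-≤; +-monoʳ-≤; +-monoˡ-≤; *-mono-≤; *-monoʳ-≤; *-monoˡ-≤; m≤n+m; m≤m*n; m*n≢0; module ≤-Reasoning)
open import Data.Nat.Solver using (module +-*-Solver)
open import Data.Vec.Base using (fromList)
open import Relation.Nullary.Decidable using (map′; decidable-stable; _×-dec_)

open import Defs using (Language; NP; P/poly; AC⁰; CF; Circuit; fanIn; evaluate; DecidesSlice; Matrix; ℝ; _·_; _+ᵛ_; _≤ᵛ_; conv; slice; ⟦_⟧)
open Polynomials
open Circuits
open Simulation using (Verifier; verifier)
open Tableau
open Perceptron
open Separation
open Spanner
open Extraction
open Rows
open Search

-- Choice of the constants, and assembly of the theorem.

module _ (m r : ℕ) where

  private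
    -- With `Q = q * M` the deficits of `mixing` equal `2 * q * N + S * suc K`, so the given `h`
    -- covers them. In `gap` the main part `2 * q * r * m` of the price of the maximisers is
    -- absorbed by `q * M` with `M = 1 + 2 * r * m`. The remaining `q` exceeds what is left,
    -- `suc m * S + S * suc K * (r * m)`, by one. `K` depends on `M` alone among the other
    -- constants, so the choices are not circular.
    M K N S q Q h : ℕ
    M = suc (2 * (r * m))
    K = spannerSize (suc (r + m * 2)) M
    N = K * M
    S = K * (N * N)
    q = suc (suc m * S + S * suc K * (r * m))
    Q = q * M
    h = 2 * q + S * suc K

    mixing′ : ∀ K M q S .{{_ : NonZero (K * M)}} →
              K * (q * M + S) + (q * M * K + S) ≤ (2 * q + S * suc K) * (K * M)
    mixing′ K M q S = begin
      K * (q * M + S) + (q * M * K + S)     ≡⟨ solve 4 (λ k q m s → k :* (q :* m :+ s) :+ (q :* m :* k :+ s)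
                                                := con 2 :* q :* (k :* m) :+ s :* (con 1 :+ k)) refl K q M S ⟩
      2 * q * (K * M) + S * suc K           ≤⟨ +-monoʳ-≤ (2 * q * (K * M)) (m≤m*n (S * suc K) (K * M)) ⟩
      2 * q * (K * M) + S * suc K * (K * M) ≡⟨ solve 3 (λ a b n → a :* n :+ b :* n := (a :+ b) :* n) refl (2 * q) (S * suc K) (K * M) ⟩
      (2 * q + S * suc K) * (K * M)         ∎
      where
      open ≤-Reasoning
      open +-*-Solver using (solve; _:=_; _:+_; _:*_; con)

    gap′ : ∀ K S → let q = suc (suc m * S + S * suc K * (r * m)) in
           m * S + r * ((2 * q + S * suc K) * m) + S < q * suc (2 * (r * m))
    gap′ K S = ≤-reflexive (solve 4 (λ m r s k →
        let q = con 1 :+ ((con 1 :+ m) :* s :+ s :* (con 1 :+ k) :* (r :* m)) in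
        con 1 :+ (m :* s :+ r :* ((con 2 :* q :+ s :* (con 1 :+ k)) :* m) :+ s)
        := q :* (con 1 :+ con 2 :* (r :* m))) refl m r S K)
      where open +-*-Solver using (solve; _:=_; _:+_; _:*_; con)

    K≢0 : NonZero K
    K≢0 = _

  constants : Constants m r
  constants = record
    { K = K ; M = M ; S = S ; Q = Q ; h = h ; K≢0 = K≢0 ; norms = ≤-refl
    ; mixing = mixing′ K M q S {{m*n≢0 K M {{K≢0}}}}
    ; gap = gap′ K S
    ; many = few-cells (r + m * 2) M }

thermometerCost-mono : ∀ {B B′} c → B ≤ B′ → thermometerCost B c ≤ thermometerCost B′ c
thermometerCost-mono c B≤ = +-monoʳ-≤ 1 (+-monoʳ-≤ 1 (+-monoˡ-≤ 0 (*-monoˡ-≤ c (+-mono-≤ B≤ B≤))))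

decideCost-mono : ∀ {J J′} S R → J ≤ J′ → decideCost J S R ≤ decideCost J′ S R
decideCost-mono S R J≤ = +-mono-≤ (*-monoˡ-≤ (thermometerCost 0 1) J≤) (+-mono-≤
  (*-monoʳ-≤ (suc R) (*-mono-≤ J≤ (+-monoʳ-≤ (localCost 2) (*-mono-≤ J≤
    (thermometerCost-mono (localCost 3) (*-monoˡ-≤ S (*-monoʳ-≤ (suc R) J≤)))))))
  (+-monoˡ-≤ 1 (*-monoˡ-≤ (localCost 2 + 2) J≤)))

size-poly : ∀ {f} → IsPolynomial f → IsPolynomial (λ m → Constants.size (constants m (f m)))
size-poly {f} r = poly-+ (poly-const 1) (poly-+ (poly-* J (poly-const (thermometerCost 0 1)))
  (poly-+ (poly-* R+1 (poly-* J (poly-+ (poly-const (localCost 2)) (poly-* J (thermometer (poly-* (poly-* R+1 J) S))))))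
    (poly-+ (poly-* J (poly-const (localCost 2 + 2))) (poly-const 1))))
  where
  suc-poly : ∀ {g} → IsPolynomial g → IsPolynomial (λ n → suc (g n))
  suc-poly = poly-+ (poly-const 1)
  thermometer : ∀ {g} → IsPolynomial g → IsPolynomial (λ n → thermometerCost (g n) (localCost 3))
  thermometer g = poly-+ (poly-const 1) (poly-+ (poly-const 1) (poly-+ (poly-* (poly-+ g g) (poly-const (localCost 3))) (poly-const 0)))
  M = suc-poly (poly-* (poly-const 2) (poly-* r poly-id))
  D = suc-poly (poly-+ r (poly-* poly-id (poly-const 2)))
  K = poly-* (poly-* (poly-const 4) (poly-+ D M)) D
  N = poly-* K M
  S = poly-* K (poly-* N N)
  q = suc-poly (poly-+ (poly-* (suc-poly poly-id) S) (poly-* (poly-* S (suc-poly K)) (poly-* r poly-id)))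
  Q = poly-* q M
  R+1 = suc-poly (poly-* K (poly-* Q Q))
  J = suc-poly (poly-+ r (poly-+ K (poly-+ K (poly-+ poly-id poly-id))))

Described : Language → ℕ → ℕ → Set
Described L ℓ r = ∃ λ (A : Matrix r ℓ) → ∃ λ (B : Matrix r r) → ∃ λ (b : Fin r → ℝ) →
  ∀ x → conv (slice L ℓ) x ⇔ ∃ λ y → A · x +ᵛ B · y ≤ᵛ b

module _ {L : Language} {ℓ m r : ℕ} (pos : Fin m → Fin ℓ) (L? : ∀ (u : Vec Bool ℓ) → Dec (L (toList u)))
         (constants : Constants m r) where

  open Constants constants

  Hit : Vec Bool m → Set
  Hit x = ∃ λ u → L (toList u) × (∀ l → lookup u (pos l) ≡ lookup x l)

  Small : Set
  Small = ∃ λ (C : Circuit m) → Circuit.size C ≤ size × fanIn C ≤ 2 × (∀ x → Hit x ⇔ evaluate C x ≡ true)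

  members : List (Vec Bool ℓ)
  members = filter L? (bitVectors ℓ)

  hit? : ∀ x → Dec (Hit x)
  hit? x = ∃-bits? λ u → L? u ×-dec agree? u
    where
    agree? : ∀ u → Dec (∀ l → lookup u (pos l) ≡ lookup x l)
    agree? u = Finₚ.all? λ l → lookup u (pos l) Boolₚ.≟ lookup x l

  -- The circuit is correct in both directions for separate reasons: an accepted input provides a
  -- target with margin, so the perceptron settles; a settled perceptron satisfies all active rows,
  -- and `sound` applies.
  small-circuit : Described L ℓ r → ¬ ¬ Small
  small-circuit (A , B , b , describes) none = from-members members
      (λ u u∈ → ∈-filter⁺ L? (∈-bitVectors u) u∈) (λ {u} u∈ → proj₂ (∈-filter⁻ L? {xs = bitVectors ℓ} u∈))
    where
    from-members : ∀ us → (∀ u → L (toList u) → u ∈ us) → (∀ {u} → u ∈ us → L (toList u)) → ⊥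
    -- An empty slice has no points to take maxima over. The constant circuit serves instead, and
    -- the summand 1 in `size` pays for its gate.
    from-members [] complete _ = none (falseCircuit , s≤s z≤n , z≤n , λ x →
      mk⇔ (λ (u , u∈ , _) → contradiction (complete u u∈) λ ()) λ ())
    from-members us@(_ ∷ us′) complete members-only =
      rounded {L} A B b describes pos {K * M} (>-nonZero⁻¹ (K * M) {{m*n≢0 K M}}) zs (λ z → members-only (∈-lookup z)) λ R →
      spanning (U constants pos zs named R) K M (U≤ constants pos zs named R)
        many λ (k , k≤K , σ , spans) → decided R k≤K σ spans
      where
      zs : Fin (suc (length us′)) → Vec Bool ℓ
      zs = List.lookup us
      named : ∀ u → L (toList u) → ∃ λ z → zs z ≡ u
      named u u∈ = Any.index (complete u u∈) , sym (lookup-index (complete u u∈))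
      decided : ∀ (Rd : Rounded L pos r (K * M) zs) {k} (k≤K : k ≤ K) (σ : Vec (Fin _) k) →
                (∀ z → Spans (U constants pos zs named Rd) K M (U≤ constants pos zs named Rd) σ z) → ⊥
      decided Rd {k} k≤K σ spans = finish (circuitOf (build-decide ρs S small-rows R))
        where
        R = K * (Q * Q)
        ρs : List (Row k m)
        ρs = rows constants pos zs named Rd k≤K σ
        small-rows : ∀ {ρ} → ρ ∈ ρs → coefficients ρ ∙ coefficients ρ ≤ᶻ + S
        small-rows = All.lookup (rows-small constants pos zs named Rd k≤K σ)
        finish : (∃ λ (C : Circuit m) → Circuit.size C ≤ decideCost (length ρs) S R × fanIn C ≤ 2 ×
                   (∀ x → evaluate C x ≡ decide ρs S small-rows R x)) → ⊥
        finish (C , size≤ , narrow , evaluates) = none (C ,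
          ≤-trans size≤ (≤-trans (decideCost-mono S R (≤-trans (≤-reflexive (rows-length constants pos zs named Rd k≤K σ))
            (s≤s (+-monoʳ-≤ r (+-mono-≤ k≤K (+-monoˡ-≤ (m + m) k≤K)))))) (m≤n+m _ 1)) ,
          narrow , λ x → mk⇔
            (λ hit → trans (evaluates x)
              (settles x S (target constants pos zs named Rd k≤K σ spans {x} hit) ρs
                (margins constants pos zs named Rd k≤K σ spans {x} hit)
                (target-small constants pos zs named Rd k≤K σ spans {x} hit)))
            -- `sound` only excludes that no word agrees with `x`; searching the finite slice
            -- produces one.
            (λ accepted → decidable-stable (hit? x)
              (sound constants pos zs named Rd k≤K σ x (sweeps (suc R) x ρs (λ _ → 0ℤ))
                (settled⇒satisfied x ρs _ (trans (sym (evaluates x)) accepted)))))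

CF⇒P/poly : ∀ {L} (V : Verifier L) → CF (Words V) → P/poly L
CF⇒P/poly {L} V (p , slices) = proj₁ bound , circuit
  where
  rank : ℕ → ℕ
  rank m = ⟦ p ⟧ (wordLength V m)
  bound : IsPolynomial (λ m → Constants.size (constants m (rank m)))
  bound = size-poly {rank} (poly-∘ p (wordLength-poly V))
  words? : ∀ {ℓ} (u : Vec Bool ℓ) → Dec (Words V (toList u))
  words? u = evaluate (wordCircuit V (length (toList u))) (fromList (toList u)) Boolₚ.≟ true
  module _ (m : ℕ) where
    open Equivalence
    pos : Fin m → Fin (wordLength V m)
    pos = inputLetter V m
    hit⇔ : ∀ x → L (toList x) ⇔ Hit {Words V} pos words? (constants m (rank m)) x
    hit⇔ x = mk⇔
      (λ l → let u , a , agree = to (accepting-correct V m x) l in u , to (accepting⇔Words V m u) a , agree)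
      (λ (u , w , agree) → from (accepting-correct V m x) (u , from (accepting⇔Words V m u) w , agree))
    L? : ∀ x → Dec (L (toList x))
    L? x = map′ (from (hit⇔ x)) (to (hit⇔ x)) (hit? {Words V} pos words? (constants m (rank m)) x)
    circuit : ∃ λ (C : Circuit m) → Circuit.size C ≤ ⟦ proj₁ bound ⟧ m × fanIn C ≤ 2 × DecidesSlice C L
    circuit = decidable-stable (narrowCircuit? {L} (⟦ proj₁ bound ⟧ m) L?) λ none →
      small-circuit {Words V} pos words? (constants m (rank m)) (slices (wordLength V m)) λ (C , small , narrow , correct) →
        none (C , ≤-trans small (≤-reflexive (sym (proj₂ bound m))) , narrow , λ x →
          mk⇔ (λ l → to (correct x) (to (hit⇔ x) l)) (λ c → from (hit⇔ x) (from (correct x) c)))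

theorem10 : NP ⊈ P/poly → AC⁰ ⊈ CF
theorem10 NP⊈P/poly AC⁰⊆CF = NP⊈P/poly λ L∈NP → let V = verifier L∈NP in CF⇒P/poly V (AC⁰⊆CF {Words V} (words∈AC⁰ V))
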